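{- Let $\Gamma$ be a countable homomorphism homogeneous weakly connected oriented graph. Then $\Gamma$ is one of the following: (1) $I_1$; (2) $(\mathbb{Q},<)$; (3) a tree with no minimal elements such that no finite subset of vertices has a maximal lower bound; (4) a dual tree with no maximal elements such that no finite subset of vertices has a minimal upper bound; (5) a poset such that every finite subset of vertices is bounded from above and from below, no finite subset of vertices has a maximal lower bound or a minimal upper bound, and no $X_4$-set has a midpoint; (6) any extension of the countable universal homogeneous strict poset; (7) $C_3$; (8) $S(2)[f]$ for a surjective function $f$ with kernel classes of size at most $2$; (9) $T^\infty[f]$ for a surjective function $f$ with a countable domain.
   Context: An oriented graph is a pair $\Gamma=(V,E)$ with $V$ a non-empty set and $E\subseteq V^2$ an asymmetric relation; write $x\to y$ for $(x,y)\in E$, $x\sim y$ if $x\to y$ or $y\to x$. $\Gamma$ is weakly connected if any two vertices are joined by a finite sequence $x=z_0\sim z_1\sim\dots\sim z_k=y$. A homomorphism is an arc-preserving map; $\Gamma$ is homomorphism homogeneous if every homomorphism between finite induced subgraphs extends to an endomorphism. A strict poset $(P,<)$ is regarded as the oriented graph with arcs $x\to y$ iff $x<y$. $I_1$ is the one-vertex graph with no arcs. A poset is a tree if for every $x$ the set of elements below $x$ is a chain; a dual tree if the reverse order is a tree. An $X_4$-set is a 4-element set $\{a_1,a_2,b_1,b_2\}$ with $a_i<b_j$ for all $i,j$ and $a_1,a_2$ incomparable and $b_1,b_2$ incomparable; it has a midpoint if there is a fifth element $m$ with $a_1,a_2<m<b_1,b_2$. The countable universal homogeneous strict poset is the Fraïssé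 limit of the class of all finite strict posets; an extension of a poset $(A,<_1)$ is a poset $(A,<_2)$ with $<_1\subseteq <_2$. $C_3$ is the directed 3-cycle. $S(2)$ is the countable circular tournament: a countable dense subset of the unit circle with no two antipodal points, with $x\to y$ iff the counterclockwise angle from $x$ to $y$ is less than $\pi$. $T^\infty$ is the countable universal homogeneous tournament (Fraïssé limit of all finite tournaments). For a countable oriented graph $\Delta$, a countable set $S$ and a surjective $f\colon S\to\operatorname{V}(\Delta)$, $\Delta[f]$ has vertex set $S$ and arcs $\{(s,t)\mid (f(s),f(t))\in\operatorname{E}(\Delta)\}$; the kernel classes of $f$ are the fibres $f^{ -1}(v)$. -}

module Defs where

open import Level using (0ℓ) renaming (suc to lsuc)
open import Data.Nat using (ℕ; _%_)
open import Data.Fin using (Fin; zero; suc)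
open import Data.Unit using (⊤)
open import Data.Empty using (⊥)
open import Data.Product using (Σ; Σ-syntax; ∃; _×_; _,_)
open import Data.Sum using (_⊎_)
open import Data.List using (List)
open import Data.List.Membership.Propositional using (_∈_)
open import Data.Rational using (ℚ; _<_; _≤_; _-_; 0ℚ; 1ℚ; ½)
import Data.Rational as ℚ
open import Relation.Nullary using (¬_)
open import Relation.Binary.PropositionalEquality using (_≡_; _≢_)

record Digraph : Set₁ where
  constructor digraph
  field
    V : Set
    E : V → V → Set
open Digraph public

_⇔_ : Set → Set → Set
A ⇔ B = (A → B) × (B → A)

NonEmpty : Digraph → Set
NonEmpty Γ = V Γ

IsOriented : Digraph → Set
IsOriented Γ = ∀ {x y} → E Γ x y → ¬ E Γ y x

Countable : Set → Set
Countable A = Σ (A → ℕ) λ c → ∀ x y → c x ≡ c y → x ≡ y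

Surjective : {A B : Set} → (A → B) → Set
Surjective {A} {B} f = ∀ (b : B) → Σ A λ a → f a ≡ b

_⊢_∼_ : (Γ : Digraph) → V Γ → V Γ → Set
Γ ⊢ x ∼ y = E Γ x y ⊎ E Γ y x

data Walk (Γ : Digraph) : V Γ → V Γ → Set where
  here : ∀ {x} → Walk Γ x x
  step : ∀ {x z y} → Γ ⊢ x ∼ z → Walk Γ z y → Walk Γ x y

WeaklyConnected : Digraph → Set
WeaklyConnected Γ = ∀ x y → Walk Γ x y

record _≅_ (Γ Δ : Digraph) : Set where
  field
    to      : V Γ → V Δ
    from    : V Δ → V Γ
    from-to : ∀ x → from (to x) ≡ x
    to-from : ∀ y → to (from y) ≡ y
    arcs    : ∀ x y → E Γ x y ⇔ E Δ (to x) (to y)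
open _≅_ public

-- A map defined on a finite set A of vertices is represented by a total
-- map h : V → V of which only the values on A matter.
-- Homomorphism homogeneity: every homomorphism between finite induced
-- subgraphs extends to an endomorphism.
HomHomogeneous : Digraph → Set
HomHomogeneous Γ =
  ∀ (A : List (V Γ)) (h : V Γ → V Γ) →
  (∀ {x y} → x ∈ A → y ∈ A → E Γ x y → E Γ (h x) (h y)) →
  Σ (V Γ → V Γ) λ g →
    (∀ {x y} → E Γ x y → E Γ (g x) (g y)) × (∀ {x} → x ∈ A → g x ≡ h x)

Homogeneous : Digraph → Set
Homogeneous Γ =
  ∀ (A : List (V Γ)) (h : V Γ → V Γ) →
  (∀ {x y} → x ∈ A → y ∈ A → h x ≡ h y → x ≡ y) →
  (∀ {x y} → x ∈ A → y ∈ A → E Γ x y ⇔ E Γ (h x) (h y)) →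
  Σ (Γ ≅ Γ) λ g → ∀ {x} → x ∈ A → to g x ≡ h x

Transitive : Digraph → Set
Transitive Γ = ∀ {x y z} → E Γ x y → E Γ y z → E Γ x z

IsStrictPoset : Digraph → Set
IsStrictPoset Γ = IsOriented Γ × Transitive Γ

IsTree : Digraph → Set
IsTree Γ = ∀ {x y z} → E Γ y x → E Γ z x → y ≡ z ⊎ E Γ y z ⊎ E Γ z y

IsDualTree : Digraph → Set
IsDualTree Γ = ∀ {x y z} → E Γ x y → E Γ x z → y ≡ z ⊎ E Γ y z ⊎ E Γ z y

NoMinimal : Digraph → Set
NoMinimal Γ = ∀ x → Σ (V Γ) λ y → E Γ y x

NoMaximal : Digraph → Set
NoMaximal Γ = ∀ x → Σ (V Γ) λ y → E Γ x y

LowerBound : (Γ : Digraph) → List (V Γ) → V Γ → Set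
LowerBound Γ S m = ∀ {s} → s ∈ S → E Γ m s

UpperBound : (Γ : Digraph) → List (V Γ) → V Γ → Set
UpperBound Γ S m = ∀ {s} → s ∈ S → E Γ s m

MaximalLowerBound : (Γ : Digraph) → List (V Γ) → V Γ → Set
MaximalLowerBound Γ S m =
  LowerBound Γ S m × (∀ m' → LowerBound Γ S m' → ¬ E Γ m m')

MinimalUpperBound : (Γ : Digraph) → List (V Γ) → V Γ → Set
MinimalUpperBound Γ S m =
  UpperBound Γ S m × (∀ m' → UpperBound Γ S m' → ¬ E Γ m' m)

NoFiniteSetHasMaxLowerBound : Digraph → Set
NoFiniteSetHasMaxLowerBound Γ = ∀ (S : List (V Γ)) m → ¬ MaximalLowerBound Γ S m

NoFiniteSetHasMinUpperBound : Digraph → Set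
NoFiniteSetHasMinUpperBound Γ = ∀ (S : List (V Γ)) m → ¬ MinimalUpperBound Γ S m

FiniteSetsBounded : Digraph → Set
FiniteSetsBounded Γ = ∀ (S : List (V Γ)) →
  Σ (V Γ) (LowerBound Γ S) × Σ (V Γ) (UpperBound Γ S)

Incomparable : (Γ : Digraph) → V Γ → V Γ → Set
Incomparable Γ x y = x ≢ y × ¬ E Γ x y × ¬ E Γ y x

IsX4 : (Γ : Digraph) → V Γ → V Γ → V Γ → V Γ → Set
IsX4 Γ a₁ a₂ b₁ b₂ =
  E Γ a₁ b₁ × E Γ a₁ b₂ × E Γ a₂ b₁ × E Γ a₂ b₂ ×
  Incomparable Γ a₁ a₂ × Incomparable Γ b₁ b₂

HasMidpoint : (Γ : Digraph) → V Γ → V Γ → V Γ → V Γ → Set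
HasMidpoint Γ a₁ a₂ b₁ b₂ = Σ (V Γ) λ m →
  E Γ a₁ m × E Γ a₂ m × E Γ m b₁ × E Γ m b₂

NoX4HasMidpoint : Digraph → Set
NoX4HasMidpoint Γ = ∀ a₁ a₂ b₁ b₂ →
  IsX4 Γ a₁ a₂ b₁ b₂ → ¬ HasMidpoint Γ a₁ a₂ b₁ b₂

-- Fraïssé limits: countable, homogeneous, with age exactly the class

Embeds : (n : ℕ) → (Fin n → Fin n → Set) → Digraph → Set
Embeds n R Γ = Σ (Fin n → V Γ) λ e →
  (∀ i j → e i ≡ e j → i ≡ j) × (∀ i j → R i j ⇔ E Γ (e i) (e j))

FinStrictPoset : (n : ℕ) → (Fin n → Fin n → Set) → Set
FinStrictPoset n R = (∀ {i j} → R i j → ¬ R j i) × (∀ {i j k} → R i j → R j k → R i k)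

FinTournament : (n : ℕ) → (Fin n → Fin n → Set) → Set
FinTournament n R = (∀ {i j} → R i j → ¬ R j i) × (∀ i j → i ≢ j → R i j ⊎ R j i)

IsTournament : Digraph → Set
IsTournament Γ = IsOriented Γ × (∀ x y → x ≢ y → E Γ x y ⊎ E Γ y x)

-- Γ is (a copy of) the countable universal homogeneous strict poset,
-- i.e. the Fraïssé limit of the class of finite strict posets
IsUniversalHomogeneousPoset : Digraph → Set₁
IsUniversalHomogeneousPoset Γ =
  Countable (V Γ) × Homogeneous Γ × IsStrictPoset Γ ×
  (∀ n (R : Fin n → Fin n → Set) → FinStrictPoset n R → Embeds n R Γ)

-- Γ is (a copy of) T^∞, the Fraïssé limit of the class of finite tournaments
IsUniversalHomogeneousTournament : Digraph → Set₁
IsUniversalHomogeneousTournament Γ =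
  Countable (V Γ) × Homogeneous Γ × IsTournament Γ ×
  (∀ n (R : Fin n → Fin n → Set) → FinTournament n R → Embeds n R Γ)

I₁ : Digraph
I₁ = digraph ⊤ (λ _ _ → ⊥)

ℚ< : Digraph
ℚ< = digraph ℚ _<_

data C3Arc : Fin 3 → Fin 3 → Set where
  a01 : C3Arc zero (suc zero)
  a12 : C3Arc (suc zero) (suc (suc zero))
  a20 : C3Arc (suc (suc zero)) zero

C₃ : Digraph
C₃ = digraph (Fin 3) C3Arc

-- S(2): points of the unit circle e^{2πiq} with q ∈ [0,1) rational of odd
-- denominator (a countable dense subset with no antipodal pair, since q and
-- q + 1/2 never both have odd denominator). The counterclockwise angle from
-- q to r is 2π·((r - q) mod 1); x → y iff it is less than π.
S2Point : Set
S2Point = Σ ℚ λ q → (0ℚ ≤ q) × (q < 1ℚ) × (ℚ.denominatorℕ q % 2 ≡ 1)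

S2Arc : S2Point → S2Point → Set
S2Arc (q , _) (r , _) = (q < r × (r - q) < ½) ⊎ (r < q × ½ < (q - r))

S2 : Digraph
S2 = digraph S2Point S2Arc

_[_] : (Δ : Digraph) → {S : Set} → (S → V Δ) → Digraph
Δ [ f ] = digraph _ (λ s t → E Δ (f s) (f t))

KernelClassesAtMost2 : {S B : Set} → (S → B) → Set
KernelClassesAtMost2 f = ∀ x y z → f x ≡ f y → f y ≡ f z → x ≡ y ⊎ y ≡ z ⊎ x ≡ z

data Classification (Γ : Digraph) : Set₁ where
  case1 : Γ ≅ I₁ → Classification Γ
  case2 : Γ ≅ ℚ< → Classification Γ
  case3 : IsStrictPoset Γ → IsTree Γ → NoMinimal Γ →
          NoFiniteSetHasMaxLowerBound Γ → Classification Γ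
  case4 : IsStrictPoset Γ → IsDualTree Γ → NoMaximal Γ →
          NoFiniteSetHasMinUpperBound Γ → Classification Γ
  case5 : IsStrictPoset Γ → FiniteSetsBounded Γ →
          NoFiniteSetHasMaxLowerBound Γ → NoFiniteSetHasMinUpperBound Γ →
          NoX4HasMidpoint Γ → Classification Γ
  case6 : IsStrictPoset Γ →
          (R : V Γ → V Γ → Set) → (∀ x y → R x y → E Γ x y) →
          IsUniversalHomogeneousPoset (digraph (V Γ) R) → Classification Γ
  case7 : Γ ≅ C₃ → Classification Γ
  case8 : (S : Set) → Countable S → (f : S → S2Point) → Surjective f →
          KernelClassesAtMost2 f → Γ ≅ (S2 [ f ]) → Classification Γ
  case9 : (T : Digraph) → IsUniversalHomogeneousTournament T →
          (S : Set) → Countable S → (f : S → V T) → Surjective f →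
          Γ ≅ (T [ f ]) → Classification Γ

{-# OPTIONS --safe #-}
-- If Γ is transitive, one-point extensions of partial homomorphisms show that Γ is one of the
-- posets (1) and (3)-(5), or that between any finite sets A < B there is a further vertex. In
-- the latter case a back-and-forth construction yields a bijective homomorphism from a generic
-- poset onto Γ, which is case (6). The chain (2) is a tree.
--
-- If Γ is not transitive, it contains a 3-cycle, non-adjacent x and z admit no path x → y → z,
-- and "non-adjacent or equal" is a congruence; let T be the quotient tournament. Partial
-- homomorphisms of T extend, so the ideas of Lachlan's classification of the countable
-- homogeneous tournaments apply.
--
-- * If some vertex of T dominates a 3-cycle, every one-point extension is realised in T. By
--   induction on the number k of labels, every blow-up of a tournament on k labels by chains has
--   extensions by one vertex v with arbitrary signs: for a new label q, the set X of vertices of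
--   type q over the blow-up contains a dominated 3-cycle and is split by v, and then X contains
--   chains on which the directions to v are prescribed. Ramsey's theorem provides chains of
--   vertices with prescribed types, from which the dominated 3-cycle in X is built.
-- * If every 3-cycle dominates nothing and is dominated by nothing, either there is no transitive
--   triple and Γ is a 3-cycle, or T is S(2): fixing a vertex o and reversing the vertices x → o
--   turns T into a dense linear order with two dense colours. Three twins in Γ could be mapped to
--   a 3-cycle with a common out-neighbour, so that the classes have size at most 2.

module Submission where

open import Defs
open import Level using (0ℓ; lift; lower; Lift) renaming (suc to lsuc)
open import Axiom.ExcludedMiddle using (ExcludedMiddle)
open import Data.Nat as ℕ using (ℕ; zero; suc; s≤s; z≤n)
import Data.Nat.Properties as ℕₚ
open import Data.Bool using (Bool; true; false; not; if_then_else_)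
open import Data.Unit using (⊤; tt)
open import Data.Empty using (⊥; ⊥-elim)
open import Data.Product using (Σ; _×_; _,_; proj₁; proj₂)
open import Data.Sum using (_⊎_; inj₁; inj₂; [_,_]′)
open import Data.Rational as ℚ′ using (ℚ; mkℚ; 0ℚ; 1ℚ; ½)
import Data.Rational.Properties as ℚₚ
open import Data.Rational.Unnormalised as ℚᵘ using (mkℚᵘ)
import Data.Rational.Unnormalised.Properties as ℚᵘₚ
open import Data.Integer as ℤ using (+_; -[1+_])
import Data.Integer.Properties as ℤₚ
import Data.Integer.GCD as ℤGCD
import Data.Integer.Tactic.RingSolver as ℤ-Solver
open import Data.Nat.Divisibility using (divides; m%n≡0⇒n∣m; n∣m⇒m%n≡0; ∣m⇒∣m*n)
open import Data.Nat.DivMod using (_%_; _/_; m≡m%n+[m/n]*n; m%n<n; m/n*n≤m; [m+kn]%n≡m%n)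
open import Data.Nat.Primality using (prime[2]; euclidsLemma)
import Data.Nat.Tactic.RingSolver as ℕ-Solver
open import Data.Fin as Fin using (Fin; zero; suc; toℕ)
import Data.Fin.Properties as Finₚ
import Data.List
open import Data.List using (List; []; _∷_; _++_; map; length; allFin; cartesianProduct)
open import Data.List.Membership.Propositional using (_∈_; _∉_)
import Data.List.Membership.Propositional.Properties as ∈ₚ
import Data.List.Relation.Unary.Any as Any
import Data.List.Relation.Unary.Any.Properties as Anyₚ
open import Data.List.Relation.Unary.Any using (here; there)
open import Data.List.Relation.Unary.All as All using (All; []; _∷_)
open import Data.List.Relation.Unary.AllPairs using (AllPairs; []; _∷_)
import Data.List.Properties as Listₚ
import Data.List.Relation.Unary.AllPairs as AllPairs
import Data.List.Relation.Unary.AllPairs.Properties as AllPairsₚ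
import Data.List.Relation.Unary.Unique.Propositional.Properties as Uniqueₚ
open import Relation.Binary.Definitions using (tri<; tri≈; tri>)
open import Relation.Nullary using (¬_; Dec; yes; no; does)
import Relation.Nullary.Decidable as Decₚ
open import Relation.Binary.PropositionalEquality
  using (_≡_; _≢_; refl; sym; trans; cong; subst; subst₂)
open import Function using (_∘_; id; case_of_)

-- Back and forth

-- Homomorphism homogeneity yields endomorphisms, not automorphisms: nothing can be pulled back
-- along them, and non-adjacency may be lost. Hence in a poset only the arcs of the generic order
-- can be controlled, and Γ may carry further ones. In a tournament an arc-preserving map is
-- injective and reflects arcs, so it preserves types over the vertices that it fixes. The vertices
-- of a given type over a finite set therefore form a homomorphism homogeneous tournament again, and
-- whatever is proved of `T` can be applied inside this set. Uniqueness is the other tool: a vertex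
-- that is the only one of its kind is fixed by every endomorphism that fixes its description.
-- Automorphisms appear only at the end, by back and forth. Chains instead of single vertices enter
-- the induction on labels because Ramsey's theorem chooses its vertices only after their types are
-- fixed; a long chain has room for the types belonging to every possible outcome.

EM : Set₁
EM = (P : Set) → Dec P

dne : EM → {P : Set} → ¬ ¬ P → P
dne em {P} nn with em P
... | yes p = p
... | no ¬p = ⊥-elim (nn ¬p)

-- Everything that has to pass from good lists to the bijection concerns two vertices at a time, so
-- `together` is all that is kept of the construction.
record GoodBijection {A B : Set} (Good : List (A × B) → Set) (L₀ : List (A × B)) : Set where
  field
    bto : A → B
    bfrom : B → A
    bfrom-bto : ∀ a → bfrom (bto a) ≡ a
    bto-bfrom : ∀ b → bto (bfrom b) ≡ b
    together : ∀ a a' → Σ (List (A × B)) λ L → Good L × (a , bto a) ∈ L × (a' , bto a') ∈ L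
    bto-extends : ∀ {a b} → (a , b) ∈ L₀ → bto a ≡ b

module BackForth (em : EM) {A B : Set} (cA : Countable A) (cB : Countable B)
  (Good : List (A × B) → Set)
  (functional : ∀ {L a b b'} → Good L → (a , b) ∈ L → (a , b') ∈ L → b ≡ b')
  (injective : ∀ {L a a' b} → Good L → (a , b) ∈ L → (a' , b) ∈ L → a ≡ a')
  (forth : ∀ {L} → Good L → ∀ a → (∀ b → (a , b) ∉ L) → Σ B λ b → Good ((a , b) ∷ L))
  (back  : ∀ {L} → Good L → ∀ b → (∀ a → (a , b) ∉ L) → Σ A λ a → Good ((a , b) ∷ L))
  {L₀ : List (A × B)} (good₀ : Good L₀) where

  private
    St : Set
    St = Σ (List (A × B)) Good

    addA : (s : St) (a : A) → Σ St λ s' →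
      (∀ {p} → p ∈ proj₁ s → p ∈ proj₁ s') × Σ B λ b → (a , b) ∈ proj₁ s'
    addA (L , G) a with em (Σ B λ b → (a , b) ∈ L)
    ... | yes p = (L , G) , id , p
    ... | no ¬p with forth G a (λ b m → ¬p (b , m))
    ...   | b , G' = ((a , b) ∷ L , G') , there , b , here refl

    addB : (s : St) (b : B) → Σ St λ s' →
      (∀ {p} → p ∈ proj₁ s → p ∈ proj₁ s') × Σ A λ a → (a , b) ∈ proj₁ s'
    addB (L , G) b with em (Σ A λ a → (a , b) ∈ L)
    ... | yes p = (L , G) , id , p
    ... | no ¬p with back G b (λ a m → ¬p (a , m))
    ...   | a , G' = ((a , b) ∷ L , G') , there , a , here refl

    -- The code need not be surjective, so stage `n` may have nothing to do. As it is injective, one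
    -- added pair serves every vertex with code `n`.
    stepA : (s : St) (n : ℕ) → Σ St λ s' → (∀ {p} → p ∈ proj₁ s → p ∈ proj₁ s') ×
      (∀ a → proj₁ cA a ≡ n → Σ B λ b → (a , b) ∈ proj₁ s')
    stepA s n with em (Σ A λ a → proj₁ cA a ≡ n)
    ... | no ¬p = s , id , λ a e → ⊥-elim (¬p (a , e))
    ... | yes (a , e) with addA s a
    ...   | s' , i , r = s' , i , λ a' e' →
              subst (λ u → Σ B λ b → (u , b) ∈ proj₁ s') (proj₂ cA a a' (trans e (sym e'))) r

    stepB : (s : St) (n : ℕ) → Σ St λ s' → (∀ {p} → p ∈ proj₁ s → p ∈ proj₁ s') ×
      (∀ b → proj₁ cB b ≡ n → Σ A λ a → (a , b) ∈ proj₁ s')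
    stepB s n with em (Σ B λ b → proj₁ cB b ≡ n)
    ... | no ¬p = s , id , λ b e → ⊥-elim (¬p (b , e))
    ... | yes (b , e) with addB s b
    ...   | s' , i , r = s' , i , λ b' e' →
              subst (λ u → Σ A λ a → (a , u) ∈ proj₁ s') (proj₂ cB b b' (trans e (sym e'))) r

    abstract
      next : (s : St) (n : ℕ) → Σ St λ s' → (∀ {p} → p ∈ proj₁ s → p ∈ proj₁ s') ×
        (∀ a → proj₁ cA a ≡ n → Σ B λ b → (a , b) ∈ proj₁ s') ×
        (∀ b → proj₁ cB b ≡ n → Σ A λ a → (a , b) ∈ proj₁ s')
      next s n with stepA s n
      ... | s' , i , hit with stepB s' n
      ...   | s'' , i' , hit' = s'' , (λ m → i' (i m)) , (λ a e → proj₁ (hit a e) , i' (proj₂ (hit a e))) , hit'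

    stage : ℕ → St
    stage zero = L₀ , good₀
    stage (suc n) = proj₁ (next (stage n) n)

    grow : ∀ n k {p} → p ∈ proj₁ (stage n) → p ∈ proj₁ (stage (k ℕ.+ n))
    grow n zero m = m
    grow n (suc k) m = proj₁ (proj₂ (next (stage (k ℕ.+ n)) (k ℕ.+ n))) (grow n k m)

    toΣ : ∀ a → Σ B λ b → (a , b) ∈ proj₁ (stage (suc (proj₁ cA a)))
    toΣ a = proj₁ (proj₂ (proj₂ (next (stage (proj₁ cA a)) (proj₁ cA a)))) a refl

    fromΣ : ∀ b → Σ A λ a → (a , b) ∈ proj₁ (stage (suc (proj₁ cB b)))
    fromΣ b = proj₂ (proj₂ (proj₂ (next (stage (proj₁ cB b)) (proj₁ cB b)))) b refl

    common : ∀ n m {p q} → p ∈ proj₁ (stage n) → q ∈ proj₁ (stage m) →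
      Σ (List (A × B)) λ L → Good L × p ∈ L × q ∈ L
    common n m {_} {q₀} p q = proj₁ (stage (m ℕ.+ n)) , proj₂ (stage (m ℕ.+ n)) , grow n m p ,
      subst (λ k → q₀ ∈ proj₁ (stage k)) (ℕₚ.+-comm n m) (grow m n q)

    bto : A → B
    bto a = proj₁ (toΣ a)

    bfrom : B → A
    bfrom b = proj₁ (fromΣ b)

    together : ∀ a a' → Σ (List (A × B)) λ L → Good L × (a , bto a) ∈ L × (a' , bto a') ∈ L
    together a a' = common (suc (proj₁ cA a)) (suc (proj₁ cA a')) (proj₂ (toΣ a)) (proj₂ (toΣ a'))

    bfrom-bto : ∀ a → bfrom (bto a) ≡ a
    bfrom-bto a with common (suc (proj₁ cA a)) (suc (proj₁ cB (bto a))) (proj₂ (toΣ a)) (proj₂ (fromΣ (bto a)))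
    ... | L , G , p , q = injective G q p

    bto-bfrom : ∀ b → bto (bfrom b) ≡ b
    bto-bfrom b with common (suc (proj₁ cA (bfrom b))) (suc (proj₁ cB b)) (proj₂ (toΣ (bfrom b))) (proj₂ (fromΣ b))
    ... | L , G , p , q = functional G p q

    bto-extends : ∀ {a b} → (a , b) ∈ L₀ → bto a ≡ b
    bto-extends {a} m with common (suc (proj₁ cA a)) 0 (proj₂ (toΣ a)) m
    ... | L , G , p , q = functional G p q

  abstract
    goodBijection : GoodBijection Good L₀
    goodBijection = record
      { bto = bto ; bfrom = bfrom ; bfrom-bto = bfrom-bto ; bto-bfrom = bto-bfrom
      ; together = together ; bto-extends = λ {a} {b} → bto-extends {a} {b} }

-- Extending finite partial homomorphisms

HomPair : (Γ : Digraph) → V Γ × V Γ → V Γ × V Γ → Set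
HomPair Γ (x , y) (x' , y') = (E Γ x x' → E Γ y y') × (E Γ x' x → E Γ y' y) × (x ≡ x' → y ≡ y')

module Extend (em : EM) (Γ : Digraph) (or : IsOriented Γ) (hh : HomHomogeneous Γ) where

  Endo : (V Γ → V Γ) → Set
  Endo g = ∀ {x y} → E Γ x y → E Γ (g x) (g y)

  asym≢ : ∀ {x y} → E Γ x y → x ≢ y
  asym≢ e refl = or e e

  fwd : ∀ {x x' y y'} → E Γ x x' → E Γ y y' → HomPair Γ (x , y) (x' , y')
  fwd e f = (λ _ → f) , (λ e' → ⊥-elim (or e e')) , λ eq → ⊥-elim (asym≢ e eq)

  bwd : ∀ {x x' y y'} → E Γ x' x → E Γ y' y → HomPair Γ (x , y) (x' , y')
  bwd e f = (λ e' → ⊥-elim (or e e')) , (λ _ → f) , λ eq → ⊥-elim (asym≢ e (sym eq))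

  apart : ∀ {x x' y y'} → ¬ E Γ x x' → ¬ E Γ x' x → x ≢ x' → HomPair Γ (x , y) (x' , y')
  apart n n' d = (λ e → ⊥-elim (n e)) , (λ e → ⊥-elim (n' e)) , λ eq → ⊥-elim (d eq)

  -- `HomPair` contains the arcs in both directions and is symmetric, so each two entries of a list
  -- need to be compared only once; the diagonal is free as there are no loops.
  lookupPairs : ∀ {L} → AllPairs (HomPair Γ) L → ∀ {p q} → p ∈ L → q ∈ L → HomPair Γ p q
  lookupPairs (_ ∷ _) (here refl) (here refl) = (λ e → ⊥-elim (or e e)) , (λ e → ⊥-elim (or e e)) , λ _ → refl
  lookupPairs (a ∷ _) (here refl) (there m) = All.lookup a m
  lookupPairs (a ∷ _) (there m) (here refl) with All.lookup a m
  ... | f , b , e = b , f , λ eq → sym (e (sym eq))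
  lookupPairs (_ ∷ r) (there m) (there m') = lookupPairs r m m'

  private module _ {L : List (V Γ × V Γ)} (ok : ∀ {p q} → p ∈ L → q ∈ L → HomPair Γ p q) where
    h : V Γ → V Γ
    h x with em (Σ (V Γ) λ y → (x , y) ∈ L)
    ... | yes (y , _) = y
    ... | no _ = x

    h-spec : ∀ {x y} → (x , y) ∈ L → h x ≡ y
    h-spec {x} {y} m with em (Σ (V Γ) λ y → (x , y) ∈ L)
    ... | yes (y' , m') = proj₂ (proj₂ (ok m' m)) refl
    ... | no ¬p = ⊥-elim (¬p (y , m))

    h-hom : ∀ {x y} → x ∈ map proj₁ L → y ∈ map proj₁ L → E Γ x y → E Γ (h x) (h y)
    h-hom mx my e with ∈ₚ.∈-map⁻ proj₁ mx | ∈ₚ.∈-map⁻ proj₁ my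
    ... | p , p∈ , refl | q , q∈ , refl =
      subst₂ (E Γ) (sym (h-spec p∈)) (sym (h-spec q∈)) (proj₁ (ok p∈ q∈) e)

  abstract
    extendBy : ∀ {L} → (∀ {p q} → p ∈ L → q ∈ L → HomPair Γ p q) →
      Σ (V Γ → V Γ) λ g → Endo g × (∀ {x y} → (x , y) ∈ L → g x ≡ y)
    extendBy {L} ok with hh (map proj₁ L) (h ok) (h-hom ok)
    ... | g , hom , ext = g , hom , λ m → trans (ext (∈ₚ.∈-map⁺ proj₁ m)) (h-spec ok m)

    extend : ∀ {L} → AllPairs (HomPair Γ) L →
      Σ (V Γ → V Γ) λ g → Endo g × All (λ p → g (proj₁ p) ≡ proj₂ p) L
    extend ap with extendBy (lookupPairs ap)
    ... | g , hom , e = g , hom , All.tabulate e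

module _ (em : EM) {X : Set} (P : X → Set) where

  pick : List X → List X
  pick [] = []
  pick (x ∷ xs) with em (P x)
  ... | yes _ = x ∷ pick xs
  ... | no _ = pick xs

  pick⁺ : ∀ {x xs} → x ∈ xs → P x → x ∈ pick xs
  pick⁺ {xs = y ∷ xs} m p with em (P y)
  pick⁺ (here refl) p | yes _ = here refl
  pick⁺ (there m) p | yes _ = there (pick⁺ m p)
  pick⁺ (here refl) p | no ¬p = ⊥-elim (¬p p)
  pick⁺ (there m) p | no _ = pick⁺ m p

  pick⁻ : ∀ {x} xs → x ∈ pick xs → x ∈ xs × P x
  pick⁻ (y ∷ xs) m with em (P y)
  pick⁻ (y ∷ xs) (here refl) | yes p = here refl , p
  pick⁻ (y ∷ xs) (there m) | yes _ = there (proj₁ (pick⁻ xs m)) , proj₂ (pick⁻ xs m)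
  pick⁻ (y ∷ xs) m | no _ = there (proj₁ (pick⁻ xs m)) , proj₂ (pick⁻ xs m)

module _ {X Y : Set} (f : X → Y) where

  pickMap⁻ : (em : EM) (P : X → Set) (xs : List X) → ∀ {y} → y ∈ map f (pick em P xs) →
    Σ X λ x → x ∈ xs × P x × y ≡ f x
  pickMap⁻ em P xs m with ∈ₚ.∈-map⁻ f m
  ... | x , x∈ , eq = x , proj₁ (pick⁻ em P xs x∈) , proj₂ (pick⁻ em P xs x∈) , eq

  pickMap⁺ : (em : EM) (P : X → Set) → ∀ {x xs} → x ∈ xs → P x → f x ∈ map f (pick em P xs)
  pickMap⁺ em P m p = ∈ₚ.∈-map⁺ f (pick⁺ em P m p)

-- The generic poset

-- The vertex `x` is related to `C` only as transitivity through `A` and `B` enforces. This freeness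
-- is what realises every consistent one-point type.
record GenericPoset (P : Digraph) : Set where
  field
    oriented : IsOriented P
    transitive : Transitive P
    ext : ∀ (A B C : List (V P)) → (∀ {a b} → a ∈ A → b ∈ B → E P a b) →
      Σ (V P) λ x → x ∉ C × (∀ {a} → a ∈ A → E P a x) × (∀ {b} → b ∈ B → E P x b) ×
        (∀ {c} → c ∈ C → E P c x → Σ (V P) λ a → a ∈ A × (c ≡ a ⊎ E P c a)) ×
        (∀ {c} → c ∈ C → E P x c → Σ (V P) λ b → b ∈ B × (b ≡ c ⊎ E P b c))

-- The generic poset has the binary trees as elements. A tree of the form node (node l r) j
-- carries the finite lists coded by l and r; it is put above the elements of the first and
-- below those of the second, provided that the first list lies below the second. The third
-- component j only serves to make infinitely many copies.

data Bin : Set where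
  leaf : Bin
  node : Bin → Bin → Bin

size : Bin → ℕ
size leaf = 0
size (node l r) = suc (size l ℕ.+ size r)

spine : Bin → List Bin
spine leaf = []
spine (node x xs) = x ∷ spine xs

unspine : List Bin → Bin
unspine [] = leaf
unspine (x ∷ xs) = node x (unspine xs)

spine-unspine : ∀ xs → spine (unspine xs) ≡ xs
spine-unspine [] = refl
spine-unspine (x ∷ xs) = cong (x ∷_) (spine-unspine xs)

below above : Bin → List Bin
below (node (node l r) _) = spine l
below (node leaf _) = []
below leaf = []
above (node (node l r) _) = spine r
above (node leaf _) = []
above leaf = []

size-spine : ∀ {x t} → x ∈ spine t → size x ℕ.< size t
size-spine {t = node y ys} (here refl) = s≤s (ℕₚ.m≤m+n (size y) (size ys))
size-spine {t = node y ys} (there m) =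
  ℕₚ.<-≤-trans (size-spine m) (ℕₚ.≤-trans (ℕₚ.m≤n+m (size ys) (size y)) (ℕₚ.n≤1+n _))

size-below : ∀ {a} x → a ∈ below x → size a ℕ.< size x
size-below (node (node l r) j) m = ℕₚ.<-trans (size-spine m)
  (s≤s (ℕₚ.≤-trans (ℕₚ.m≤m+n (size l) (size r)) (ℕₚ.≤-trans (ℕₚ.n≤1+n _) (ℕₚ.m≤m+n _ (size j)))))

size-above : ∀ {b} x → b ∈ above x → size b ℕ.< size x
size-above (node (node l r) j) m = ℕₚ.<-trans (size-spine m)
  (s≤s (ℕₚ.≤-trans (ℕₚ.m≤n+m (size r) (size l)) (ℕₚ.≤-trans (ℕₚ.n≤1+n _) (ℕₚ.m≤m+n _ (size j)))))

-- Each step of a derivation uses a list of one of its end points and carries the validity of that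
-- vertex, so an invalid tree contributes no relations through its own lists.
mutual
  data _≼_ : Bin → Bin → Set where
    same : ∀ {x} → x ≼ x
    less : ∀ {x y} → x ≺ y → x ≼ y

  data _≺_ : Bin → Bin → Set where
    up : ∀ {x y a} → a ∈ below y → (∀ {a b} → a ∈ below y → b ∈ above y → a ≺ b) → x ≼ a → x ≺ y
    down : ∀ {x y b} → b ∈ above x → (∀ {a b} → a ∈ below x → b ∈ above x → a ≺ b) → b ≼ y → x ≺ y

-- The critical case is a middle vertex `y` used through its own lists on both sides: `x ≼ a` with
-- `a` in `below y`, and `b ≼ z` with `b` in `above y`. The validity stored in the derivation
-- supplies `a ≺ b`, as a smaller derivation.
≺-trans : ∀ {x y z} → x ≺ y → y ≺ z → x ≺ z
≺-trans d (up m v same) = up m v (less d)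
≺-trans d (up m v (less e)) = up m v (less (≺-trans d e))
≺-trans (down m v same) d@(down _ _ _) = down m v (less d)
≺-trans (down m v (less e)) d@(down _ _ _) = down m v (less (≺-trans e d))
≺-trans (up m _ same) (down m' v same) = v m m'
≺-trans (up m _ (less e)) (down m' v same) = ≺-trans e (v m m')
≺-trans (up m _ same) (down m' v (less f)) = ≺-trans (v m m') f
≺-trans (up m _ (less e)) (down m' v (less f)) = ≺-trans (≺-trans e (v m m')) f

-- A loop at `x` passes through a member of one of the lists of `x`. Rotated, it becomes a loop at
-- this smaller tree.
≺-irrefl : ∀ n {x} → size x ℕ.< n → ¬ x ≺ x
≺-irrefl (suc n) _ (up {x} m v same) = ℕₚ.<-irrefl refl (size-below x m)
≺-irrefl (suc n) (s≤s s) (up {x} m v (less e)) =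
  ≺-irrefl n (ℕₚ.<-≤-trans (size-below x m) s) (≺-trans (up m v same) e)
≺-irrefl (suc n) _ (down {x} m v same) = ℕₚ.<-irrefl refl (size-above x m)
≺-irrefl (suc n) (s≤s s) (down {x} m v (less e)) =
  ≺-irrefl n (ℕₚ.<-≤-trans (size-above x m) s) (≺-trans e (down m v same))

𝕌 : Digraph
𝕌 = digraph Bin _≺_

module _ (A B C : List Bin) (A≺B : ∀ {a b} → a ∈ A → b ∈ B → a ≺ b) where
  private
    -- With `C` stored in the third component, `x` is larger than every element of `C`; hence it is
    -- new and occurs in none of their lists.
    x = node (node (unspine A) (unspine B)) (unspine C)

    belowx : below x ≡ A
    belowx = spine-unspine A

    abovex : above x ≡ B
    abovex = spine-unspine B

    valid : ∀ {a b} → a ∈ below x → b ∈ above x → a ≺ b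
    valid m m' = A≺B (subst (_ ∈_) belowx m) (subst (_ ∈_) abovex m')

    small : ∀ {c} → c ∈ C → size c ℕ.< size x
    small m = ℕₚ.<-≤-trans (size-spine (subst (_ ∈_) (sym (spine-unspine C)) m))
      (ℕₚ.≤-trans (ℕₚ.m≤n+m (size (unspine C)) _) (ℕₚ.n≤1+n _))

    -- As `x` is too large to occur in the lists of `c`, a derivation of `c ≺ x` climbs by `down`
    -- through ever smaller trees until it ends with a step through `below x`.
    below-x : ∀ {c} → c ≺ x → size c ℕ.< size x → Σ Bin λ a → a ∈ A × (c ≡ a ⊎ c ≺ a)
    below-x (up m _ same) _ = _ , subst (_ ∈_) belowx m , inj₁ refl
    below-x (up m _ (less e)) _ = _ , subst (_ ∈_) belowx m , inj₂ e
    below-x {c} (down m _ same) s = ⊥-elim (ℕₚ.<-asym s (size-above c m))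
    below-x {c} (down m v (less e)) s with below-x e (ℕₚ.<-trans (size-above c m) s)
    ... | a , a∈ , inj₁ refl = a , a∈ , inj₂ (down m v same)
    ... | a , a∈ , inj₂ f = a , a∈ , inj₂ (≺-trans (down m v same) f)

    above-x : ∀ {c} → x ≺ c → size c ℕ.< size x → Σ Bin λ b → b ∈ B × (b ≡ c ⊎ b ≺ c)
    above-x (down m _ same) _ = _ , subst (_ ∈_) abovex m , inj₁ refl
    above-x (down m _ (less e)) _ = _ , subst (_ ∈_) abovex m , inj₂ e
    above-x {c} (up m _ same) s = ⊥-elim (ℕₚ.<-asym s (size-below c m))
    above-x {c} (up m v (less e)) s with above-x e (ℕₚ.<-trans (size-below c m) s)
    ... | b , b∈ , inj₁ refl = b , b∈ , inj₂ (up m v same)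
    ... | b , b∈ , inj₂ f = b , b∈ , inj₂ (≺-trans f (up m v same))

  𝕌-ext : Σ Bin λ x → x ∉ C × (∀ {a} → a ∈ A → a ≺ x) × (∀ {b} → b ∈ B → x ≺ b) ×
    (∀ {c} → c ∈ C → c ≺ x → Σ Bin λ a → a ∈ A × (c ≡ a ⊎ c ≺ a)) ×
    (∀ {c} → c ∈ C → x ≺ c → Σ Bin λ b → b ∈ B × (b ≡ c ⊎ b ≺ c))
  𝕌-ext = x , (λ m → ℕₚ.<-irrefl refl (small m)) ,
    (λ m → up (subst (_ ∈_) (sym belowx) m) valid same) ,
    (λ m → down (subst (_ ∈_) (sym abovex) m) valid same) ,
    (λ m d → below-x d (small m)) , (λ m d → above-x d (small m))

𝕌-generic : GenericPoset 𝕌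
𝕌-generic = record
  { oriented = λ {x} e f → ≺-irrefl (suc (size x)) ℕₚ.≤-refl (≺-trans e f)
  ; transitive = ≺-trans
  ; ext = 𝕌-ext }

private
  double : ℕ → ℕ
  double n = n ℕ.+ n

  double-inj : ∀ m n → double m ≡ double n → m ≡ n
  double-inj zero zero _ = refl
  double-inj (suc m) (suc n) e = cong suc (double-inj m n
    (ℕₚ.suc-injective (trans (sym (ℕₚ.+-suc m m)) (trans (ℕₚ.suc-injective e) (ℕₚ.+-suc n n)))))

  even≢odd : ∀ m n → double m ≢ suc (double n)
  even≢odd (suc m) (suc n) e = even≢odd m n
    (ℕₚ.suc-injective (trans (sym (ℕₚ.+-suc m m)) (trans (ℕₚ.suc-injective e) (cong suc (ℕₚ.+-suc n n)))))
  even≢odd (suc m) zero e with trans (sym (ℕₚ.+-suc m m)) (ℕₚ.suc-injective e)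
  ... | ()

  -- A prefix code: the tree is written in preorder into the lowest binary digits, 1 for a node and
  -- 0 for a leaf, and the digits of `k` follow.
  code : Bin → ℕ → ℕ
  code leaf k = double k
  code (node l r) k = suc (double (code l (code r k)))

  code-inj : ∀ t t' k k' → code t k ≡ code t' k' → t ≡ t' × k ≡ k'
  code-inj leaf leaf k k' e = refl , double-inj k k' e
  code-inj leaf (node l r) k k' e = ⊥-elim (even≢odd k (code l (code r k')) e)
  code-inj (node l r) leaf k k' e = ⊥-elim (even≢odd k' (code l (code r k)) (sym e))
  code-inj (node l r) (node l' r') k k' e
    with code-inj l l' _ _ (double-inj _ _ (ℕₚ.suc-injective e))
  ... | refl , e' with code-inj r r' k k' e'
  ...   | refl , refl = refl , refl

Bin-countable : Countable Bin
Bin-countable = (λ t → code t 0) , λ t t' e → proj₁ (code-inj t t' 0 0 e)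

swap-∈ : {A B : Set} {L : List (A × B)} → ∀ {a b} → (b , a) ∈ map (λ p → proj₂ p , proj₁ p) L → (a , b) ∈ L
swap-∈ m with ∈ₚ.∈-map⁻ _ m
... | _ , m' , refl = m'

module _ (em : EM) where

  PartialIso : (P Q : Digraph) → List (V P × V Q) → Set
  PartialIso P Q L = ∀ {a b a' b'} → (a , b) ∈ L → (a' , b') ∈ L →
    (E P a a' ⇔ E Q b b') × ((a ≡ a') ⇔ (b ≡ b'))

  -- Freeness of `b` makes the relations reflect: if `b'` is below `b`, then it is at most the image
  -- of some element below `a`, and `ok` carries this back to `P`.
  poset-forth : ∀ {P Q} → GenericPoset P → GenericPoset Q → ∀ {L} → PartialIso P Q L →
    ∀ a → (∀ b → (a , b) ∉ L) → Σ (V Q) λ b → (∀ a → (a , b) ∉ L) ×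
      ∀ {a' b'} → (a' , b') ∈ L → (E P a' a ⇔ E Q b' b) × (E P a a' ⇔ E Q b b')
  poset-forth {P} {Q} gP gQ {L} ok a new
    with GenericPoset.ext gQ (map proj₂ (pick em (λ p → E P (proj₁ p) a) L))
           (map proj₂ (pick em (λ p → E P a (proj₁ p)) L)) (map proj₂ L) mid
    where
    mid : ∀ {u w} → u ∈ map proj₂ (pick em (λ p → E P (proj₁ p) a) L) →
      w ∈ map proj₂ (pick em (λ p → E P a (proj₁ p)) L) → E Q u w
    mid mu mw with pickMap⁻ proj₂ em _ L mu | pickMap⁻ proj₂ em _ L mw
    ... | p , p∈ , pa , refl | q , q∈ , aq , refl =
      proj₁ (proj₁ (ok p∈ q∈)) (GenericPoset.transitive gP pa aq)
  ... | b , b∉ , lo , hi , lo' , hi' = b , (λ a m → b∉ (∈ₚ.∈-map⁺ proj₂ m)) , λ m →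
      ((λ e → lo (pickMap⁺ proj₂ em _ m e)) , λ e → lower' m (lo' (∈ₚ.∈-map⁺ proj₂ m) e)) ,
      ((λ e → hi (pickMap⁺ proj₂ em _ m e)) , λ e → upper' m (hi' (∈ₚ.∈-map⁺ proj₂ m) e))
    where
    lower' : ∀ {a' b'} → (a' , b') ∈ L →
      (Σ (V Q) λ u → u ∈ map proj₂ (pick em (λ p → E P (proj₁ p) a) L) × (b' ≡ u ⊎ E Q b' u)) → E P a' a
    lower' m (u , mu , r) with pickMap⁻ proj₂ em _ L mu
    lower' m (u , mu , inj₁ refl) | p , p∈ , pa , refl with proj₂ (proj₂ (ok m p∈)) refl
    ... | refl = pa
    lower' m (u , mu , inj₂ e) | p , p∈ , pa , refl =
      GenericPoset.transitive gP (proj₂ (proj₁ (ok m p∈)) e) pa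
    upper' : ∀ {a' b'} → (a' , b') ∈ L →
      (Σ (V Q) λ u → u ∈ map proj₂ (pick em (λ p → E P a (proj₁ p)) L) × (u ≡ b' ⊎ E Q u b')) → E P a a'
    upper' m (u , mu , r) with pickMap⁻ proj₂ em _ L mu
    upper' m (u , mu , inj₁ refl) | p , p∈ , ap , refl with proj₂ (proj₂ (ok p∈ m)) refl
    ... | refl = ap
    upper' m (u , mu , inj₂ e) | p , p∈ , ap , refl =
      GenericPoset.transitive gP ap (proj₂ (proj₁ (ok p∈ m)) e)

  partialIso-cons : ∀ {P Q} → IsOriented P → IsOriented Q → ∀ {L a b} → PartialIso P Q L →
    (∀ b → (a , b) ∉ L) → (∀ a → (a , b) ∉ L) →
    (∀ {a' b'} → (a' , b') ∈ L → (E P a' a ⇔ E Q b' b) × (E P a a' ⇔ E Q b b')) →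
    PartialIso P Q ((a , b) ∷ L)
  partialIso-cons oP oQ ok na nb new (here refl) (here refl) =
    ((λ e → ⊥-elim (oP e e)) , λ e → ⊥-elim (oQ e e)) , (λ _ → refl) , λ _ → refl
  partialIso-cons oP oQ ok na nb new (here refl) (there m) = proj₂ (new m) ,
    (λ { refl → ⊥-elim (na _ m) }) , λ { refl → ⊥-elim (nb _ m) }
  partialIso-cons oP oQ ok na nb new (there m) (here refl) = proj₁ (new m) ,
    (λ { refl → ⊥-elim (na _ m) }) , λ { refl → ⊥-elim (nb _ m) }
  partialIso-cons oP oQ ok na nb new (there m) (there m') = ok m m'

  partialIso-swap : ∀ {P Q L} → PartialIso P Q L → PartialIso Q P (map (λ p → proj₂ p , proj₁ p) L)
  partialIso-swap ok m m' with ok (swap-∈ m) (swap-∈ m')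
  ... | (f , g) , h , k = (g , f) , k , h

  -- The invariant `Inv` is trivial for posets and tournaments; for circular tournaments it keeps
  -- the pair of base points in the list.
  module IsoBackForth {P Q : Digraph} (cP : Countable (V P)) (cQ : Countable (V Q))
    (oP : IsOriented P) (oQ : IsOriented Q) (Inv : List (V P × V Q) → Set)
    (inv-cons : ∀ {L} p → Inv L → Inv (p ∷ L))
    (forth : ∀ {L} → PartialIso P Q L → Inv L → ∀ a → (∀ b → (a , b) ∉ L) →
      Σ (V Q) λ b → (∀ a → (a , b) ∉ L) ×
      ∀ {a' b'} → (a' , b') ∈ L → (E P a' a ⇔ E Q b' b) × (E P a a' ⇔ E Q b b'))
    (back : ∀ {L} → PartialIso P Q L → Inv L → ∀ b → (∀ a → (a , b) ∉ L) →
      Σ (V P) λ a → (∀ b → (a , b) ∉ L) ×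
      ∀ {a' b'} → (a' , b') ∈ L → (E P a' a ⇔ E Q b' b) × (E P a a' ⇔ E Q b b'))
    {L₀ : List (V P × V Q)} (ok₀ : PartialIso P Q L₀) (inv₀ : Inv L₀) where

    record Good (L : List (V P × V Q)) : Set where
      constructor mkGood
      field
        iso : PartialIso P Q L
        inv : Inv L
    open Good

    private
      forth' : ∀ {L} → Good L → ∀ a → (∀ b → (a , b) ∉ L) → Σ (V Q) λ b → Good ((a , b) ∷ L)
      forth' G a n with forth (iso G) (inv G) a n
      ... | b , nb , ok = b , mkGood (partialIso-cons {P} {Q} oP oQ (iso G) n nb ok) (inv-cons _ (inv G))

      back' : ∀ {L} → Good L → ∀ b → (∀ a → (a , b) ∉ L) → Σ (V P) λ a → Good ((a , b) ∷ L)
      back' G b n with back (iso G) (inv G) b n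
      ... | a , na , ok = a , mkGood (partialIso-cons {P} {Q} oP oQ (iso G) na n ok) (inv-cons _ (inv G))

      abstract
        bijection : GoodBijection Good L₀
        bijection = BackForth.goodBijection em cP cQ Good
          (λ G m m' → proj₁ (proj₂ (iso G m m')) refl) (λ G m m' → proj₂ (proj₂ (iso G m m')) refl)
          forth' back' (mkGood ok₀ inv₀)

      module BF = GoodBijection bijection

    isoPQ : P ≅ Q
    isoPQ = record
      { to = BF.bto ; from = BF.bfrom ; from-to = BF.bfrom-bto ; to-from = BF.bto-bfrom
      ; arcs = λ x y → case BF.together x y of λ { (_ , G , m , m') → proj₁ (iso G m m') } }

    isoPQ-extends : ∀ {a b} → (a , b) ∈ L₀ → to isoPQ a ≡ b
    isoPQ-extends = BF.bto-extends

  initial : ∀ (P : Digraph) (A : List (V P)) (h : V P → V P) →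
    (∀ {x y} → x ∈ A → y ∈ A → h x ≡ h y → x ≡ y) →
    (∀ {x y} → x ∈ A → y ∈ A → E P x y ⇔ E P (h x) (h y)) →
    PartialIso P P (map (λ a → a , h a) A)
  initial P A h inj iff m m' with ∈ₚ.∈-map⁻ _ m | ∈ₚ.∈-map⁻ _ m'
  ... | x , x∈ , refl | y , y∈ , refl = iff x∈ y∈ , cong h , inj x∈ y∈

  homogeneous-by-forth : (P : Digraph) → Countable (V P) → IsOriented P →
    (∀ {L} → PartialIso P P L → ∀ a → (∀ b → (a , b) ∉ L) →
      Σ (V P) λ b → (∀ a → (a , b) ∉ L) ×
      ∀ {a' b'} → (a' , b') ∈ L → (E P a' a ⇔ E P b' b) × (E P a a' ⇔ E P b b')) → Homogeneous P
  homogeneous-by-forth P cP oP forth A h inj iff = I.isoPQ , λ m → I.isoPQ-extends (∈ₚ.∈-map⁺ _ m)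
    where
    back : ∀ {L} → PartialIso P P L → ∀ b → (∀ a → (a , b) ∉ L) →
      Σ (V P) λ a → (∀ b → (a , b) ∉ L) ×
      ∀ {a' b'} → (a' , b') ∈ L → (E P a' a ⇔ E P b' b) × (E P a a' ⇔ E P b b')
    back {L} ok b n with forth (partialIso-swap {P} {P} ok) b (λ a m → n a (swap-∈ m))
    ... | a , na , r = a , (λ b m → na b (∈ₚ.∈-map⁺ _ m)) , λ m →
          (proj₂ (proj₁ (r (∈ₚ.∈-map⁺ _ m))) , proj₁ (proj₁ (r (∈ₚ.∈-map⁺ _ m)))) ,
          (proj₂ (proj₂ (r (∈ₚ.∈-map⁺ _ m))) , proj₁ (proj₂ (r (∈ₚ.∈-map⁺ _ m))))
    module I = IsoBackForth {P} {P} cP cP oP oP (λ _ → ⊤) (λ _ _ → tt)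
      (λ ok _ → forth ok) (λ ok _ → back ok) (initial P A h inj iff) tt

  generic⇒universal : ∀ {P} → Countable (V P) → GenericPoset P → IsUniversalHomogeneousPoset P
  generic⇒universal {P} cP gP = cP ,
    homogeneous-by-forth P cP (GenericPoset.oriented gP) (poset-forth gP gP) ,
    (GenericPoset.oriented gP , GenericPoset.transitive gP) , embed
    where
    embed : ∀ n (R : Fin n → Fin n → Set) → FinStrictPoset n R → Embeds n R P
    embed zero R _ = (λ ()) , (λ ()) , λ ()
    embed (suc n) R (as , tr) with embed n (λ i j → R (suc i) (suc j)) (as , tr)
    ... | e , inj , iff with GenericPoset.ext gP
          (map e (pick em (λ i → R (suc i) zero) (allFin n)))
          (map e (pick em (λ i → R zero (suc i)) (allFin n))) (map e (allFin n)) mid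
      where
      mid : ∀ {a b} → a ∈ map e (pick em (λ i → R (suc i) zero) (allFin n)) →
        b ∈ map e (pick em (λ i → R zero (suc i)) (allFin n)) → E P a b
      mid ma mb with pickMap⁻ e em _ (allFin n) ma | pickMap⁻ e em _ (allFin n) mb
      ... | i , _ , ri , refl | j , _ , rj , refl = proj₁ (iff i j) (tr ri rj)
    ... | x , x∉ , lo , hi , lo' , hi' = e' , inj' , iff'
      where
      e' : Fin (suc n) → V P
      e' zero = x
      e' (suc i) = e i
      ∈e : ∀ i → e i ∈ map e (allFin n)
      ∈e i = ∈ₚ.∈-map⁺ e (∈ₚ.∈-allFin i)
      inj' : ∀ i j → e' i ≡ e' j → i ≡ j
      inj' zero zero _ = refl
      inj' zero (suc j) refl = ⊥-elim (x∉ (∈e j))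
      inj' (suc i) zero refl = ⊥-elim (x∉ (∈e i))
      inj' (suc i) (suc j) eq = cong suc (inj i j eq)
      lower' : ∀ i → (Σ (V P) λ a → a ∈ map e (pick em (λ i → R (suc i) zero) (allFin n)) ×
        (e i ≡ a ⊎ E P (e i) a)) → R (suc i) zero
      lower' i (a , ma , r) with pickMap⁻ e em _ (allFin n) ma
      lower' i (a , ma , inj₁ eq) | k , _ , rk , refl with inj i k eq
      ... | refl = rk
      lower' i (a , ma , inj₂ d) | k , _ , rk , refl = tr (proj₂ (iff i k) d) rk
      upper' : ∀ i → (Σ (V P) λ b → b ∈ map e (pick em (λ i → R zero (suc i)) (allFin n)) ×
        (b ≡ e i ⊎ E P b (e i))) → R zero (suc i)
      upper' i (a , ma , r) with pickMap⁻ e em _ (allFin n) ma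
      upper' i (a , ma , inj₁ eq) | k , _ , rk , refl with inj k i eq
      ... | refl = rk
      upper' i (a , ma , inj₂ d) | k , _ , rk , refl = tr rk (proj₂ (iff k i) d)
      iff' : ∀ i j → R i j ⇔ E P (e' i) (e' j)
      iff' zero zero = (λ r → ⊥-elim (as r r)) , λ d → ⊥-elim (GenericPoset.oriented gP d d)
      iff' (suc i) zero = (λ r → lo (pickMap⁺ e em _ (∈ₚ.∈-allFin i) r)) , λ d → lower' i (lo' (∈e i) d)
      iff' zero (suc i) = (λ r → hi (pickMap⁺ e em _ (∈ₚ.∈-allFin i) r)) , λ d → upper' i (hi' (∈e i) d)
      iff' (suc i) (suc j) = iff i j

-- Homomorphism homogeneous posets

op : Digraph → Digraph
op Γ = digraph (V Γ) (λ x y → E Γ y x)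

op-hh : ∀ Γ → HomHomogeneous Γ → HomHomogeneous (op Γ)
op-hh Γ hh A h ok with hh A h (λ mx my → ok my mx)
... | g , hom , ext = g , hom , ext

module PosetOneSided (em : EM) (Γ : Digraph) (or : IsOriented Γ) (hh : HomHomogeneous Γ)
  (tr : Transitive Γ) where
  open Extend em Γ or hh

  noMaximal : ∀ {p q} → E Γ p q → NoMaximal Γ
  noMaximal {p} {q} pq x with extend {L = (p , x) ∷ []} ([] ∷ [])
  ... | g , hom , refl ∷ [] = g q , hom pq

  noMinimal : ∀ {p q} → E Γ p q → NoMinimal Γ
  noMinimal {p} {q} pq x with extend {L = (q , x) ∷ []} ([] ∷ [])
  ... | g , hom , refl ∷ [] = g p , hom pq

  -- A point m₀ below a maximal lower bound m of S can be mapped to m with S fixed; the image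
  -- of m is then a larger lower bound.
  noMaxLB : NoMinimal Γ → NoFiniteSetHasMaxLowerBound Γ
  noMaxLB nomin S m (lb , maximal) = maximal (g m) (λ s∈ → subst (E Γ (g m)) (fix (there (∈ₚ.∈-map⁺ _ s∈))) (hom (lb s∈)))
      (subst (λ u → E Γ u (g m)) (fix (here refl)) (hom m₀m))
    where
    m₀ = proj₁ (nomin m)
    m₀m = proj₂ (nomin m)
    L = (m₀ , m) ∷ map (λ s → s , s) S
    ok : ∀ {p q} → p ∈ L → q ∈ L → HomPair Γ p q
    ok (here refl) (here refl) = (λ e → ⊥-elim (or e e)) , (λ e → ⊥-elim (or e e)) , λ _ → refl
    ok (here refl) (there q∈) with ∈ₚ.∈-map⁻ _ q∈
    ... | s , s∈ , refl = fwd (tr m₀m (lb s∈)) (lb s∈)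
    ok (there p∈) (here refl) with ∈ₚ.∈-map⁻ _ p∈
    ... | s , s∈ , refl = bwd (tr m₀m (lb s∈)) (lb s∈)
    ok (there p∈) (there q∈) with ∈ₚ.∈-map⁻ _ p∈ | ∈ₚ.∈-map⁻ _ q∈
    ... | s , _ , refl | t , _ , refl = id , id , id
    g = proj₁ (extendBy ok)
    hom = proj₁ (proj₂ (extendBy ok))
    fix : ∀ {x y} → (x , y) ∈ L → g x ≡ y
    fix = proj₂ (proj₂ (extendBy ok))

  -- The failure of the tree property gives two incomparable elements with a common upper bound.
  -- Incomparable elements can be mapped to any two vertices, so any two vertices have an upper
  -- bound.
  upperBounds : V Γ → ¬ IsTree Γ → ∀ S → Σ (V Γ) (UpperBound Γ S)
  upperBounds v₀ ¬tree = ub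
    where
    fork : Σ (V Γ) λ x → Σ (V Γ) λ y → Σ (V Γ) λ z →
      E Γ y x × E Γ z x × y ≢ z × ¬ E Γ y z × ¬ E Γ z y
    fork = dne em λ none → ¬tree λ {x} {y} {z} yx zx → dne em λ bad →
      none (x , y , z , yx , zx , (λ e → bad (inj₁ e)) , (λ e → bad (inj₂ (inj₁ e))) , λ e → bad (inj₂ (inj₂ e)))
    two : ∀ u v → Σ (V Γ) λ w → E Γ u w × E Γ v w
    two u v with fork
    ... | x , y , z , yx , zx , y≢z , ¬yz , ¬zy
      with extend {L = (y , u) ∷ (z , v) ∷ []} ((apart ¬yz ¬zy y≢z ∷ []) ∷ [] ∷ [])
    ...   | g , hom , refl ∷ refl ∷ [] = g x , hom yx , hom zx
    ub : ∀ S → Σ (V Γ) (UpperBound Γ S)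
    ub [] = v₀ , λ ()
    ub (s ∷ S) with ub S
    ... | w , b with two s w
    ...   | w' , sw' , ww' = w' , λ { (here refl) → sw' ; (there m) → tr (b m) ww' }

module Posets (em : EM) (Γ : Digraph) (ne : NonEmpty Γ) (or : IsOriented Γ) (cΓ : Countable (V Γ))
  (hh : HomHomogeneous Γ) (wc : WeaklyConnected Γ) (tr : Transitive Γ) where
  open Extend em Γ or hh

  private
    module Up = PosetOneSided em Γ or hh tr
    module Down = PosetOneSided em (op Γ) or (op-hh Γ hh) (λ e f → tr f e)

  module Dense (bdd : FiniteSetsBounded Γ)
    {a₁ a₂ b₁ b₂ : V Γ} (x4 : IsX4 Γ a₁ a₂ b₁ b₂) (mp : HasMidpoint Γ a₁ a₂ b₁ b₂) where

    -- Since both pairs of an X₄-set are incomparable, it maps onto any such `u₁, u₂, w₁, w₂`, even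
    -- if these coincide or are comparable; the midpoint goes along.
    between : ∀ {u₁ u₂ w₁ w₂} → E Γ u₁ w₁ → E Γ u₁ w₂ → E Γ u₂ w₁ → E Γ u₂ w₂ →
      HasMidpoint Γ u₁ u₂ w₁ w₂
    between {u₁} {u₂} {w₁} {w₂} e₁₁ e₁₂ e₂₁ e₂₂ = move x4 mp
      where
      move : IsX4 Γ a₁ a₂ b₁ b₂ → HasMidpoint Γ a₁ a₂ b₁ b₂ → HasMidpoint Γ u₁ u₂ w₁ w₂
      move (f₁₁ , f₁₂ , f₂₁ , f₂₂ , (da , na , na') , (db , nb , nb')) (m , p , q , r , s)
        with extend ((apart na na' da ∷ fwd f₁₁ e₁₁ ∷ fwd f₁₂ e₁₂ ∷ []) ∷
                     (fwd f₂₁ e₂₁ ∷ fwd f₂₂ e₂₂ ∷ []) ∷ (apart nb nb' db ∷ []) ∷ [] ∷ [])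
      ... | g , hom , refl ∷ refl ∷ refl ∷ refl ∷ [] = g m , hom p , hom q , hom r , hom s

    interpolate₂ : ∀ u₁ u₂ B → LowerBound Γ B u₁ → LowerBound Γ B u₂ →
      Σ (V Γ) λ m → E Γ u₁ m × E Γ u₂ m × LowerBound Γ B m
    interpolate₂ u₁ u₂ [] _ _ with proj₂ (bdd (u₁ ∷ u₂ ∷ []))
    ... | m , ub = m , ub (here refl) , ub (there (here refl)) , λ ()
    interpolate₂ u₁ u₂ (b ∷ B) l₁ l₂ with interpolate₂ u₁ u₂ B (λ m → l₁ (there m)) (λ m → l₂ (there m))
    ... | m , p , q , l with between (l₁ (here refl)) p (l₂ (here refl)) q
    ...   | m' , p' , q' , r' , s' = m' , p' , q' , λ { (here refl) → r' ; (there x) → tr s' (l x) }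

    interpolate : ∀ A B → (∀ {a b} → a ∈ A → b ∈ B → E Γ a b) →
      Σ (V Γ) λ m → UpperBound Γ A m × LowerBound Γ B m
    interpolate [] B _ with proj₁ (bdd B)
    ... | m , lb = m , (λ ()) , lb
    interpolate (a ∷ A) B lt with interpolate A B (λ m m' → lt (there m) m')
    ... | m , ub , lb with interpolate₂ a m B (lt (here refl)) lb
    ...   | m' , p , q , lb' = m' , (λ { (here refl) → p ; (there x) → tr (ub x) q }) , lb'

    -- If a forbidden `x` lies between `A` and `B` itself, adding it to `A` forces the solution
    -- strictly above it. Otherwise `x` cannot be the solution anyway.
    interpolate-new : ∀ F A B → (∀ {a b} → a ∈ A → b ∈ B → E Γ a b) →
      Σ (V Γ) λ m → UpperBound Γ A m × LowerBound Γ B m × m ∉ F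
    interpolate-new [] A B lt with interpolate A B lt
    ... | m , ub , lb = m , ub , lb , λ ()
    interpolate-new (x ∷ F) A B lt with em (UpperBound Γ A x × LowerBound Γ B x)
    ... | yes (ubx , lbx) with interpolate-new F (x ∷ A) B (λ { (here refl) m → lbx m ; (there m) m' → lt m m' })
    ...   | m , ub , lb , new = m , (λ y → ub (there y)) , lb ,
              λ { (here refl) → or (ub (here refl)) (ub (here refl)) ; (there y) → new y }
    interpolate-new (x ∷ F) A B lt | no ¬b with interpolate-new F A B lt
    ... | m , ub , lb , new = m , ub , lb , λ { (here refl) → ¬b (ub , lb) ; (there y) → new y }

    -- The order is preserved but not reflected, as Γ may have more arcs than the generic poset that
    -- is built in it.
    record Good (L : List (Bin × V Γ)) : Set where
      constructor mkGood
      field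
        good : ∀ {a b a' b'} → (a , b) ∈ L → (a' , b') ∈ L → (a ≺ a' → E Γ b b') × ((a ≡ a') ⇔ (b ≡ b'))
    open Good

    private
      irr : ∀ {x} → ¬ x ≺ x
      irr e = GenericPoset.oriented 𝕌-generic e e

      cons : ∀ {L a b} → Good L → (∀ b → (a , b) ∉ L) → (∀ a → (a , b) ∉ L) →
        (∀ {a' b'} → (a' , b') ∈ L → (a' ≺ a → E Γ b' b) × (a ≺ a' → E Γ b b')) → Good ((a , b) ∷ L)
      good (cons G na nb new) (here refl) (here refl) = (λ e → ⊥-elim (irr e)) , (λ _ → refl) , λ _ → refl
      good (cons G na nb new) (here refl) (there m) = proj₂ (new m) ,
        (λ { refl → ⊥-elim (na _ m) }) , λ { refl → ⊥-elim (nb _ m) }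
      good (cons G na nb new) (there m) (here refl) = proj₁ (new m) ,
        (λ { refl → ⊥-elim (na _ m) }) , λ { refl → ⊥-elim (nb _ m) }
      good (cons G na nb new) (there m) (there m') = good G m m'

      forth : ∀ {L} → Good L → ∀ a → (∀ b → (a , b) ∉ L) → Σ (V Γ) λ b → Good ((a , b) ∷ L)
      forth {L} G a na with interpolate-new (map proj₂ L)
          (map proj₂ (pick em (λ p → proj₁ p ≺ a) L)) (map proj₂ (pick em (λ p → a ≺ proj₁ p) L)) mid
        where
        mid : ∀ {u w} → u ∈ map proj₂ (pick em (λ p → proj₁ p ≺ a) L) →
          w ∈ map proj₂ (pick em (λ p → a ≺ proj₁ p) L) → E Γ u w
        mid mu mw with pickMap⁻ proj₂ em _ L mu | pickMap⁻ proj₂ em _ L mw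
        ... | p , p∈ , pa , refl | q , q∈ , aq , refl = proj₁ (good G p∈ q∈) (≺-trans pa aq)
      ... | b , ub , lb , new = b , cons G na (λ a m → new (∈ₚ.∈-map⁺ proj₂ m)) λ m →
            (λ e → ub (pickMap⁺ proj₂ em _ m e)) , λ e → lb (pickMap⁺ proj₂ em _ m e)

      -- The preimage is taken incomparable to all earlier trees, which leaves no arc to be
      -- preserved.
      back : ∀ {L} → Good L → ∀ b → (∀ a → (a , b) ∉ L) → Σ Bin λ a → Good ((a , b) ∷ L)
      back {L} G b nb with 𝕌-ext [] [] (map proj₁ L) (λ ())
      ... | a , new , _ , _ , lo , hi = a , cons G (λ b m → new (∈ₚ.∈-map⁺ proj₁ m)) nb λ m →
            (λ e → case proj₁ (proj₂ (lo (∈ₚ.∈-map⁺ proj₁ m) e)) of λ ()) ,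
            (λ e → case proj₁ (proj₂ (hi (∈ₚ.∈-map⁺ proj₁ m) e)) of λ ())

      abstract
        bijection : GoodBijection Good []
        bijection = BackForth.goodBijection em Bin-countable cΓ Good
          (λ G m m' → proj₁ (proj₂ (good G m m')) refl) (λ G m m' → proj₂ (proj₂ (good G m m')) refl)
          forth back {[]} (mkGood λ ())

      module BF = GoodBijection bijection

      R : V Γ → V Γ → Set
      R x y = BF.bfrom x ≺ BF.bfrom y

      R⊆E : ∀ x y → R x y → E Γ x y
      R⊆E x y r with BF.together (BF.bfrom x) (BF.bfrom y)
      ... | L , G , m , m' = subst₂ (E Γ) (BF.bto-bfrom x) (BF.bto-bfrom y) (proj₁ (good G m m') r)

      R-ext : ∀ (A B C : List (V Γ)) → (∀ {a b} → a ∈ A → b ∈ B → R a b) →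
        Σ (V Γ) λ x → x ∉ C × (∀ {a} → a ∈ A → R a x) × (∀ {b} → b ∈ B → R x b) ×
          (∀ {c} → c ∈ C → R c x → Σ (V Γ) λ a → a ∈ A × (c ≡ a ⊎ R c a)) ×
          (∀ {c} → c ∈ C → R x c → Σ (V Γ) λ b → b ∈ B × (b ≡ c ⊎ R b c))
      R-ext A B C lt with 𝕌-ext (map BF.bfrom A) (map BF.bfrom B) (map BF.bfrom C) mid
        where
        mid : ∀ {a b} → a ∈ map BF.bfrom A → b ∈ map BF.bfrom B → a ≺ b
        mid ma mb with ∈ₚ.∈-map⁻ _ ma | ∈ₚ.∈-map⁻ _ mb
        ... | _ , a∈ , refl | _ , b∈ , refl = lt a∈ b∈
      ... | u , u∉ , lo , hi , lo' , hi' = BF.bto u ,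
        (λ m → u∉ (subst (_∈ map BF.bfrom C) (BF.bfrom-bto u) (∈ₚ.∈-map⁺ _ m))) ,
        (λ m → subst (_ ≺_) (sym (BF.bfrom-bto u)) (lo (∈ₚ.∈-map⁺ _ m))) ,
        (λ m → subst (_≺ _) (sym (BF.bfrom-bto u)) (hi (∈ₚ.∈-map⁺ _ m))) ,
        (λ m r → low (lo' (∈ₚ.∈-map⁺ _ m) (subst (_ ≺_) (BF.bfrom-bto u) r))) ,
        (λ m r → high (hi' (∈ₚ.∈-map⁺ _ m) (subst (_≺ _) (BF.bfrom-bto u) r)))
        where
        bfrom-inj : ∀ {x y} → BF.bfrom x ≡ BF.bfrom y → x ≡ y
        bfrom-inj {x} {y} e = trans (sym (BF.bto-bfrom x)) (trans (cong BF.bto e) (BF.bto-bfrom y))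
        low : ∀ {c} → (Σ Bin λ a → a ∈ map BF.bfrom A × (BF.bfrom c ≡ a ⊎ BF.bfrom c ≺ a)) →
          Σ (V Γ) λ a → a ∈ A × (c ≡ a ⊎ R c a)
        low (a , a∈ , r) with ∈ₚ.∈-map⁻ _ a∈
        low (a , a∈ , inj₁ e) | a' , m , refl = a' , m , inj₁ (bfrom-inj e)
        low (a , a∈ , inj₂ e) | a' , m , refl = a' , m , inj₂ e
        high : ∀ {c} → (Σ Bin λ b → b ∈ map BF.bfrom B × (b ≡ BF.bfrom c ⊎ b ≺ BF.bfrom c)) →
          Σ (V Γ) λ b → b ∈ B × (b ≡ c ⊎ R b c)
        high (b , b∈ , r) with ∈ₚ.∈-map⁻ _ b∈
        high (b , b∈ , inj₁ e) | b' , m , refl = b' , m , inj₁ (bfrom-inj e)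
        high (b , b∈ , inj₂ e) | b' , m , refl = b' , m , inj₂ e

    dense-case : Classification Γ
    dense-case = case6 (or , tr) R R⊆E (generic⇒universal em cΓ record
      { oriented = GenericPoset.oriented 𝕌-generic ; transitive = ≺-trans ; ext = R-ext })

  classify : Classification Γ
  classify with em (Σ (V Γ) λ p → Σ (V Γ) λ q → E Γ p q)
  ... | no none = case1 record
        { to = λ _ → tt ; from = λ _ → ne ; to-from = λ _ → refl ; from-to = λ x → single (wc ne x)
        ; arcs = λ x y → (λ e → none (x , y , e)) , λ () }
    where
    single : ∀ {x y} → Walk Γ x y → x ≡ y
    single here = refl
    single (step (inj₁ e) _) = ⊥-elim (none (_ , _ , e))
    single (step (inj₂ e) _) = ⊥-elim (none (_ , _ , e))
  ... | yes (p , q , pq) with em (IsTree Γ) | em (IsDualTree Γ)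
  ...   | yes t | _ = case3 (or , tr) t (Up.noMinimal pq) (Up.noMaxLB (Up.noMinimal pq))
  ...   | no _ | yes t = case4 (or , tr) t (Up.noMaximal pq) (Down.noMaxLB (Up.noMaximal pq))
  ...   | no ¬t | no ¬d
    with em (Σ (V Γ) λ a₁ → Σ (V Γ) λ a₂ → Σ (V Γ) λ b₁ → Σ (V Γ) λ b₂ →
             IsX4 Γ a₁ a₂ b₁ b₂ × HasMidpoint Γ a₁ a₂ b₁ b₂)
  ...     | no none = case5 (or , tr) bdd (Up.noMaxLB (Up.noMinimal pq)) (Down.noMaxLB (Up.noMaximal pq))
                        λ a₁ a₂ b₁ b₂ x4 m → none (a₁ , a₂ , b₁ , b₂ , x4 , m)
    where
    bdd : FiniteSetsBounded Γ
    bdd S = Down.upperBounds ne (λ d → ¬d λ e f → [ inj₁ , [ (λ u → inj₂ (inj₂ u)) , (λ u → inj₂ (inj₁ u)) ]′ ]′ (d e f)) S , Up.upperBounds ne ¬t S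
  ...     | yes (a₁ , a₂ , b₁ , b₂ , x4 , m) = Dense.dense-case bdd x4 m
    where
    bdd : FiniteSetsBounded Γ
    bdd S = Down.upperBounds ne (λ d → ¬d λ e f → [ inj₁ , [ (λ u → inj₂ (inj₂ u)) , (λ u → inj₂ (inj₁ u)) ]′ ]′ (d e f)) S , Up.upperBounds ne ¬t S

-- Non-adjacency as a congruence

Apart : (Γ : Digraph) → V Γ → V Γ → Set
Apart Γ x y = ¬ E Γ x y × ¬ E Γ y x

apart-sym : ∀ Γ {x y} → Apart Γ x y → Apart Γ y x
apart-sym Γ (n , m) = m , n

Cyc : (Γ : Digraph) → V Γ → V Γ → V Γ → Set
Cyc Γ a b c = E Γ a b × E Γ b c × E Γ c a

module NonAdjacent (em : EM) (Γ : Digraph) (or : IsOriented Γ) (hh : HomHomogeneous Γ) where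
  open Extend em Γ or hh

  adjacent : ∀ {x y} → ¬ Apart Γ x y → E Γ x y ⊎ E Γ y x
  adjacent {x} {y} n = dne em λ bad → n ((λ e → bad (inj₁ e)) , λ e → bad (inj₂ e))

  -- Non-adjacent x and z can both be mapped to x.
  noPath : ∀ {x y z} → Apart Γ x z → E Γ x y → ¬ E Γ y z
  noPath {x} {y} {z} (n , n') xy yz
    with extend {L = (x , x) ∷ (z , x) ∷ []}
           ((((λ e → ⊥-elim (n e)) , (λ e → ⊥-elim (n' e)) , λ _ → refl) ∷ []) ∷ [] ∷ [])
  ... | g , hom , gx ∷ gz ∷ [] =
    or (subst (λ t → E Γ t (g y)) gx (hom xy)) (subst (E Γ (g y)) gz (hom yz))

  private
    apart′ : ∀ {x x' y y'} → Apart Γ x x' → x ≢ x' → HomPair Γ (x , y) (x' , y')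
    apart′ (n , n') d = apart n n' d

  -- Mapping (a,b,u) to (w,a,b) moves c to a point c' above a, b and u. Mapping (a,b,u) to the
  -- 3-cycle then gives a point r above the 3-cycle, and mapping (b,c,r) to (w,a,b) moves a to
  -- a point y with a → y → b and y → w → u, whose position relative to u is contradictory.
  dominatedCycle : ∀ {a b c u w} → Cyc Γ a b c → Apart Γ u a → Apart Γ u b → Apart Γ u c →
    E Γ w a → E Γ w b → E Γ w c → ¬ E Γ w u
  dominatedCycle {a} {b} {c} {u} {w} (ab , bc , ca) ua ub uc wa wb wc wu
    with extend {L = (a , w) ∷ (b , a) ∷ (u , b) ∷ []}
           ((fwd ab wa ∷ apart′ (apart-sym Γ ua) a≢u ∷ []) ∷ (apart′ (apart-sym Γ ub) b≢u ∷ []) ∷ [] ∷ [])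
       | extend {L = (a , a) ∷ (b , b) ∷ (u , c) ∷ []}
           ((fwd ab ab ∷ apart′ (apart-sym Γ ua) a≢u ∷ []) ∷ (apart′ (apart-sym Γ ub) b≢u ∷ []) ∷ [] ∷ [])
    where
    a≢u : a ≢ u
    a≢u refl = proj₁ ub ab
    b≢u : b ≢ u
    b≢u refl = proj₁ uc bc
  ... | g , hom , ga ∷ gb ∷ gu ∷ [] | h , hom' , ha ∷ hb ∷ hu ∷ []
    with extend ((fwd bc wa ∷ fwd br wb ∷ []) ∷ (fwd cr ab ∷ []) ∷ [] ∷ [])
    where
    ac' : E Γ a (g c)
    ac' = subst (λ t → E Γ t (g c)) gb (hom bc)
    c'w : E Γ (g c) w
    c'w = subst (E Γ (g c)) ga (hom ca)
    uc' : E Γ u (g c)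
    uc' with adjacent (λ ap → noPath ap c'w wu)
    ... | inj₁ e = ⊥-elim (noPath (apart-sym Γ ua) ac' e)
    ... | inj₂ e = e
    bc' : E Γ b (g c)
    bc' with adjacent (λ ap → noPath ap c'w wb)
    ... | inj₁ e = ⊥-elim (noPath ub uc' e)
    ... | inj₂ e = e
    br : E Γ b (h (g c))
    br = subst (λ t → E Γ t (h (g c))) hb (hom' bc')
    cr : E Γ c (h (g c))
    cr = subst (λ t → E Γ t (h (g c))) hu (hom' uc')
  ... | k , hom'' , kb ∷ kc ∷ kr ∷ []
    with adjacent (λ ap → noPath ap (subst (E Γ (k a)) kb (hom'' ab)) wu)
  ... | inj₁ yu = noPath (apart-sym Γ ua) (subst (λ t → E Γ t (k a)) kc (hom'' ca)) yu
  ... | inj₂ uy = noPath ub uy (subst (E Γ (k a)) kr (hom'' (subst (λ t → E Γ t (h (g c))) ha (hom' ac'))))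
    where
    ac' : E Γ a (g c)
    ac' = subst (λ t → E Γ t (g c)) gb (hom bc)

  Isolated : V Γ → V Γ → V Γ → V Γ → Set
  Isolated a b c u = Apart Γ u a × Apart Γ u b × Apart Γ u c

  private
    beat : ∀ {s t x y} → E Γ t s → Apart Γ s y → E Γ t x → E Γ x y → E Γ t y
    beat ts sy tx xy with adjacent (λ ap → noPath ap tx xy)
    ... | inj₁ e = e
    ... | inj₂ e = ⊥-elim (noPath (apart-sym Γ sy) e ts)

  -- By `noPath`, the arc `t → s` excludes arcs from the cycle to `t`. So if `t` is adjacent to the
  -- cycle, it has an arc into it; `beat` spreads this around the cycle, and `dominatedCycle`
  -- applies.
  leaving : ∀ {a b c s t} → Cyc Γ a b c → Isolated a b c s → ¬ Isolated a b c t → ¬ E Γ t s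
  leaving {a} {b} {c} {s} {t} (ab , bc , ca) (sa , sb , sc) nt ts
    with em (E Γ t a) | em (E Γ t b) | em (E Γ t c)
  ... | yes ta | _ | _ = dominatedCycle (ab , bc , ca) sa sb sc ta tb (beat ts sc tb bc) ts
    where
    tb = beat ts sb ta ab
  ... | no _ | yes tb | _ = dominatedCycle (ab , bc , ca) sa sb sc (beat ts sa tc ca) tb tc ts
    where
    tc = beat ts sc tb bc
  ... | no _ | no _ | yes tc = dominatedCycle (ab , bc , ca) sa sb sc ta (beat ts sb ta ab) tc ts
    where
    ta = beat ts sa tc ca
  ... | no na | no nb | no nc = nt
    ((na , λ e → noPath (apart-sym Γ sa) e ts) , (nb , λ e → noPath (apart-sym Γ sb) e ts) ,
     (nc , λ e → noPath (apart-sym Γ sc) e ts))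

least : EM → {P : ℕ → Set} → Σ ℕ P → Σ ℕ λ n → P n × (∀ m → P m → n ℕ.≤ m)
least em {P} (n , p) = go n n ℕₚ.≤-refl p
  where
  go : ∀ b n → n ℕ.≤ b → P n → Σ ℕ λ n → P n × (∀ m → P m → n ℕ.≤ m)
  go zero zero _ p = 0 , p , λ _ _ → z≤n
  go (suc b) n n≤b p with em (Σ ℕ λ m → m ℕ.< n × P m)
  ... | yes (m , m<n , q) = go b m (ℕₚ.≤-pred (ℕₚ.≤-trans m<n n≤b)) q
  ... | no none = n , p , λ m q → ℕₚ.≮⇒≥ λ m<n → none (m , m<n , q)

uip : ∀ {A : Set} {x y : A} (p q : x ≡ y) → p ≡ q
uip refl refl = refl

-- The quotient tournament

module Quotient (em : EM) (Γ : Digraph) (or : IsOriented Γ) (cΓ : Countable (V Γ))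
  (hh : HomHomogeneous Γ) (wc : WeaklyConnected Γ) (¬tr : ¬ Transitive Γ) where
  open Extend em Γ or hh
  open NonAdjacent em Γ or hh
  private module Op = NonAdjacent em (op Γ) or (op-hh Γ hh)

  -- On a walk from `u` to `a` isolation would be lost at some arc. One direction of this arc is
  -- excluded by `leaving`, the other by `leaving` in the opposite graph with the cycle reversed.
  notIsolated : ∀ {a b c} → Cyc Γ a b c → ∀ u → ¬ Isolated a b c u
  notIsolated {a} {b} {c} cyc@(ab , bc , ca) u is = walk (wc u a) is
    where
    walk : ∀ {s} → Walk Γ s a → ¬ Isolated a b c s
    walk here is = proj₁ (proj₁ (proj₂ is)) ab
    walk (step {z = t} st w) is with em (Isolated a b c t)
    ... | yes is' = walk w is'
    walk (step (inj₁ e) w) (sa , sb , sc) | no nis =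
      Op.leaving (ca , bc , ab) (apart-sym Γ sa , apart-sym Γ sc , apart-sym Γ sb)
        (λ { (ta , tc , tb) → nis (apart-sym Γ ta , apart-sym Γ tb , apart-sym Γ tc) }) e
    walk (step (inj₂ e) w) is | no nis = leaving cyc is nis e

  someCycle : Σ (V Γ) λ a → Σ (V Γ) λ b → Σ (V Γ) λ c → Cyc Γ a b c
  someCycle = dne em λ none → ¬tr λ {x} {y} {z} xy yz → dne em λ ¬xz →
    case em (E Γ z x) of λ
      { (yes zx) → none (x , y , z , xy , yz , zx)
      ; (no ¬zx) → noPath (¬xz , ¬zx) xy yz }

  arcInCycle : ∀ {x y} → E Γ x y → Σ (V Γ) λ c → Cyc Γ x y c
  arcInCycle xy with someCycle
  ... | a , b , c , ab , bc , ca with extend ((fwd ab xy ∷ []) ∷ [] ∷ [])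
  ...   | g , hom , refl ∷ refl ∷ [] = g c , xy , hom bc , hom ca

  -- If `z` were not adjacent to `y`, it would be isolated from a 3-cycle through `x → y`: an arc
  -- between `z` and the third vertex would create a path of length two between non-adjacent
  -- vertices.
  twin-out : ∀ {x z y} → Apart Γ x z → E Γ x y → E Γ z y
  twin-out {x} {z} {y} xz xy with arcInCycle xy
  ... | c , cyc@(_ , yc , cx) with adjacent (λ zy → notIsolated cyc z (apart-sym Γ xz , zy ,
          ((λ zc → noPath (apart-sym Γ xz) zc cx) , λ cz → noPath (apart-sym Γ zy) yc cz)))
  ...   | inj₁ zy = zy
  ...   | inj₂ yz = ⊥-elim (noPath xz xy yz)

  twin-in : ∀ {x z y} → Apart Γ x z → E Γ y x → E Γ y z
  twin-in {x} {z} {y} xz yx with arcInCycle yx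
  ... | c , cyc@(_ , xc , cy) with adjacent (λ zy → notIsolated cyc z (zy , apart-sym Γ xz ,
          ((λ zc → noPath zy zc cy) , λ cz → noPath xz xc cz)))
  ...   | inj₁ zy = ⊥-elim (noPath (apart-sym Γ xz) zy yx)
  ...   | inj₂ yz = yz

  apart-trans : ∀ {x y z} → Apart Γ x y → Apart Γ y z → Apart Γ x z
  apart-trans xy (yz , zy) = (λ e → yz (twin-out xy e)) , λ e → zy (twin-in xy e)

  private
    leastTwin : ∀ x → Σ ℕ λ n → (Σ (V Γ) λ y → proj₁ cΓ y ≡ n × Apart Γ x y) ×
      (∀ m → (Σ (V Γ) λ y → proj₁ cΓ y ≡ m × Apart Γ x y) → n ℕ.≤ m)
    leastTwin x = least em (proj₁ cΓ x , x , refl , (λ e → or e e) , λ e → or e e)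

  abstract
    -- Each class is represented by its vertex of least code, so that the quotient lives on a subset
    -- of Γ and inherits countability and partial homomorphisms.
    rep : V Γ → V Γ
    rep x = proj₁ (proj₁ (proj₂ (leastTwin x)))

    rep-apart : ∀ x → Apart Γ x (rep x)
    rep-apart x = proj₂ (proj₂ (proj₁ (proj₂ (leastTwin x))))

    rep-cong : ∀ {x x'} → Apart Γ x x' → rep x ≡ rep x'
    rep-cong {x} {x'} ap = proj₂ cΓ _ _ (ℕₚ.≤-antisym (le ap) (le (apart-sym Γ ap)))
      where
      le : ∀ {x x'} → Apart Γ x x' → proj₁ cΓ (rep x) ℕ.≤ proj₁ cΓ (rep x')
      le {x} {x'} ap = subst (ℕ._≤ _) (sym (proj₁ (proj₂ (proj₁ (proj₂ (leastTwin x))))))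
        (proj₂ (proj₂ (leastTwin x)) _ (rep x' , refl , apart-trans ap (rep-apart x')))

  T : Digraph
  T = digraph (Σ (V Γ) λ x → rep x ≡ x) λ x y → E Γ (proj₁ x) (proj₁ y)

  T-≡ : ∀ {x y : V T} → proj₁ x ≡ proj₁ y → x ≡ y
  T-≡ {x , p} {_ , q} refl = cong (x ,_) (uip p q)

  π : V Γ → V T
  π x = rep x , sym (rep-cong (rep-apart x))

  π-surjective : Surjective π
  π-surjective (x , p) = x , T-≡ p

  π-arcs : ∀ x y → E Γ x y ⇔ E T (π x) (π y)
  π-arcs x y = (λ e → twin-in (rep-apart y) (twin-out (rep-apart x) e)) ,
    λ e → twin-in (apart-sym Γ (rep-apart y)) (twin-out (apart-sym Γ (rep-apart x)) e)

  π-apart : ∀ {x y} → π x ≡ π y → Apart Γ x y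
  π-apart {x} {y} eq = apart-trans (subst (Apart Γ x) (cong proj₁ eq) (rep-apart x)) (apart-sym Γ (rep-apart y))

  T-tournament : IsTournament T
  T-tournament = or , λ { (x , p) (y , q) x≢y → adjacent λ ap → x≢y (T-≡ (trans (sym p) (trans (rep-cong ap) q))) }

  T-countable : Countable (V T)
  T-countable = (λ x → proj₁ cΓ (proj₁ x)) , λ x y e → T-≡ (proj₂ cΓ _ _ e)

  abstract
    T-hh : HomHomogeneous T
    T-hh A h ok with extendBy pairs
      where
      pairs : ∀ {p q} → p ∈ map (λ a → proj₁ a , proj₁ (h a)) A → q ∈ map (λ a → proj₁ a , proj₁ (h a)) A → HomPair Γ p q
      pairs mp mq with ∈ₚ.∈-map⁻ _ mp | ∈ₚ.∈-map⁻ _ mq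
      ... | a , a∈ , refl | b , b∈ , refl = ok a∈ b∈ , ok b∈ a∈ , λ e → cong (proj₁ ∘ h) (T-≡ e)
    ... | g , hom , ext = (λ x → π (g (proj₁ x))) , (λ e → proj₁ (π-arcs _ _) (hom e)) ,
      λ {x} m → T-≡ (trans (cong rep (ext (∈ₚ.∈-map⁺ _ m))) (proj₂ (h x)))

  T-cycle : Σ (V T) λ a → Σ (V T) λ b → Σ (V T) λ c → Cyc T a b c
  T-cycle with someCycle
  ... | a , b , c , ab , bc , ca =
    π a , π b , π c , proj₁ (π-arcs _ _) ab , proj₁ (π-arcs _ _) bc , proj₁ (π-arcs _ _) ca

-- Tournaments containing a dominated 3-cycle

module HomTournament (em : EM) (T : Digraph) (tour : IsTournament T) (hh : HomHomogeneous T) where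
  or : IsOriented T
  or = proj₁ tour

  open Extend em T or hh public

  adj : ∀ {x y} → x ≢ y → E T x y ⊎ E T y x
  adj = proj₂ tour _ _

  record Dom (p a b c : V T) : Set where
    constructor dom
    field
      pa : E T p a
      pb : E T p b
      pc : E T p c
      ab : E T a b
      bc : E T b c
      ca : E T c a

  rot : ∀ {p a b c} → Dom p a b c → Dom p b c a
  rot (dom pa pb pc ab bc ca) = dom pb pc pa bc ca ab

  mapDom : ∀ {g p a b c} → Endo g → Dom p a b c → Dom (g p) (g a) (g b) (g c)
  mapDom hom (dom pa pb pc ab bc ca) = dom (hom pa) (hom pb) (hom pc) (hom ab) (hom bc) (hom ca)

  -- Suppose that no 3-cycle has two dominators. Then the direction of the arc between the
  -- dominator p of a 3-cycle C and a further vertex e depends only on the type of e over C.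
  module Unique {p₀ a₀ b₀ c₀ : V T} (d₀ : Dom p₀ a₀ b₀ c₀)
    (uniq : ∀ {p p' a b c} → Dom p a b c → Dom p' a b c → p ≡ p') where

    cycleIn : ∀ {p x} → E T p x → Σ (V T) λ y → Σ (V T) λ z → Dom p x y z
    cycleIn px with extend ((fwd (Dom.pa d₀) px ∷ []) ∷ [] ∷ [])
    ... | g , hom , refl ∷ refl ∷ [] = g b₀ , g c₀ , mapDom hom d₀

    dominator : ∀ {a b c} → Cyc T a b c → Σ (V T) λ p → Dom p a b c
    dominator (ab , bc , ca) with extend ((fwd (Dom.ab d₀) ab ∷ bwd (Dom.ca d₀) ca ∷ []) ∷
                                          (fwd (Dom.bc d₀) bc ∷ []) ∷ [] ∷ [])
    ... | g , hom , refl ∷ refl ∷ refl ∷ [] = g p₀ , mapDom hom d₀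

    Type₁ Type₂ : V T → V T → V T → V T → Set
    Type₁ a b c e = E T e a × E T b e × E T c e
    Type₂ a b c e = E T e a × E T e b × E T c e

    same₁ : ∀ {p a b c e p' a' b' c' e'} → Dom p a b c → Type₁ a b c e → E T e p →
      Dom p' a' b' c' → Type₁ a' b' c' e' → E T e' p'
    same₁ d@(dom _ _ _ ab bc ca) (ea , be , ce) ep d'@(dom _ _ _ ab' bc' ca') (ea' , be' , ce')
      with extend ((fwd ab ab' ∷ bwd ca ca' ∷ bwd ea ea' ∷ []) ∷ (fwd bc bc' ∷ fwd be be' ∷ []) ∷ (fwd ce ce' ∷ []) ∷ [] ∷ [])
    ... | g , hom , refl ∷ refl ∷ refl ∷ refl ∷ [] with uniq (mapDom hom d) d'
    ...   | refl = hom ep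

    same₂ : ∀ {p a b c e p' a' b' c' e'} → Dom p a b c → Type₂ a b c e → E T e p →
      Dom p' a' b' c' → Type₂ a' b' c' e' → E T e' p'
    same₂ d@(dom _ _ _ ab bc ca) (ea , eb , ce) ep d'@(dom _ _ _ ab' bc' ca') (ea' , eb' , ce')
      with extend ((fwd ab ab' ∷ bwd ca ca' ∷ bwd ea ea' ∷ []) ∷ (fwd bc bc' ∷ bwd eb eb' ∷ []) ∷ (fwd ce ce' ∷ []) ∷ [] ∷ [])
    ... | g , hom , refl ∷ refl ∷ refl ∷ refl ∷ [] with uniq (mapDom hom d) d'
    ...   | refl = hom ep

    -- A vertex of type 1 over a 3-cycle turns one of the vertices of the cycle into a vertex
    -- of type 2 over another one, and conversely.
    module NoSplit
      (no₁ : ∀ {p a b c e} → Dom p a b c → Type₁ a b c e → ¬ E T p e)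
      (no₂ : ∀ {p a b c e} → Dom p a b c → Type₂ a b c e → ¬ E T p e) where

      inCycle : ∀ {p a b c e} → Dom p a b c → E T p e → E T e a → e ≡ c
      inCycle {p} {a} {b} {c} {e} d@(dom pa pb pc ab bc ca) pe ea = dne em λ e≢c →
        case (adj {e} {b} (λ { refl → or ea ab }) , adj {e} {c} e≢c) of λ
          { (inj₁ eb , inj₁ ec) → asym≢ pe (uniq d (dom ea eb ec ab bc ca))
          ; (inj₁ eb , inj₂ ce) → no₂ d (ea , eb , ce) pe
          ; (inj₂ be , inj₁ ec) → no₂ (rot (rot d)) (ec , ea , be) pe
          ; (inj₂ be , inj₂ ce) → no₁ d (ea , be , ce) pe }

      -- Up to rotation, the remaining case is `a → e` and `b → e`. By `inCycle`, both `a` and `b`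
      -- would then be the predecessor of `e` in a 3-cycle through `e` dominated by `p`.
      outs : ∀ {p a b c e} → Dom p a b c → E T p e → e ≡ a ⊎ e ≡ b ⊎ e ≡ c
      outs {p} {a} {b} {c} {e} d@(dom pa pb pc ab bc ca) pe = dne em λ bad →
        case (adj {e} {a} (λ u → bad (inj₁ u)) , adj {e} {b} (λ u → bad (inj₂ (inj₁ u)))) of λ
          { (inj₁ ea , _) → bad (inj₂ (inj₂ (inCycle d pe ea)))
          ; (inj₂ ae , inj₁ eb) → bad (inj₁ (inCycle (rot d) pe eb))
          ; (inj₂ ae , inj₂ be) → case cycleIn pe of λ
              { (f , h , d') → asym≢ ab (trans (inCycle d' pa ae) (sym (inCycle d' pb be))) } }

      private
        -- Compare the dominators of the cycles `v, a, s` and `v, a, t`. If they are equal, there is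
        -- a fourth out-neighbour; if not, one of them belongs to the cycle of the other. Both
        -- contradict `outs`.
        noTwo : ∀ {v a s t} → E T v a → E T a s → E T s v → E T a t → E T t v → E T s t → ⊥
        noTwo {v} {a} {s} {t} va as sv at tv st with dominator (va , as , sv) | dominator (va , at , tv)
        ... | z , dz@(dom zv za zs _ _ _) | z' , dz'@(dom zv' za' zt' _ _ _) with em (z ≡ z')
        ...   | yes refl = case outs dz zt' of λ
                  { (inj₁ refl) → or tv tv ; (inj₂ (inj₁ refl)) → or at at ; (inj₂ (inj₂ refl)) → or st st }
        ...   | no z≢z' with adj z≢z'
        ...     | inj₁ zz' = case outs dz zz' of λ
                  { (inj₁ refl) → or zv' zv' ; (inj₂ (inj₁ refl)) → or za' za' ; (inj₂ (inj₂ refl)) → or za' as }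
        ...     | inj₂ z'z = case outs dz' z'z of λ
                  { (inj₁ refl) → or zv zv ; (inj₂ (inj₁ refl)) → or za za ; (inj₂ (inj₂ refl)) → or za at }

      -- The vertex `a₀` dominates a 3-cycle `b₀, s, t` in its turn. As `p₀` has no out-neighbours
      -- besides its own cycle, both `s` and `t` have arcs to `p₀` and complete `p₀ → a₀` to a
      -- 3-cycle.
      impossible : ⊥
      impossible with cycleIn (Dom.ab d₀)
      ... | s , t , dom ab as at bs st tb = noTwo pa as (back as (λ { refl → or bs bs })) at (back at (λ { refl → or tb tb })) st
        where
        open Dom d₀ using (pa; pb; pc; ca)
        back : ∀ {s} → E T a₀ s → s ≢ b₀ → E T s p₀
        back {s} as s≢b with adj {s} {p₀} (λ { refl → or pa as })
        ... | inj₁ e = e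
        ... | inj₂ ps = case outs d₀ ps of λ
                { (inj₁ refl) → ⊥-elim (or as as) ; (inj₂ (inj₁ u)) → ⊥-elim (s≢b u) ; (inj₂ (inj₂ refl)) → ⊥-elim (or as ca) }

    -- Some `e` has arcs to a dominator and into its cycle, by `noBelow`. It cannot dominate the
    -- whole cycle, so it is of type 1 or 2; this fixes the arcs for all vertices of that type, and
    -- exchanging `e` with a vertex of the cycle settles the other type.
    absurd : ⊥
    absurd with em (Σ (V T) λ p → Σ (V T) λ a → Σ (V T) λ b → Σ (V T) λ c → Σ (V T) λ e →
                    Dom p a b c × E T e p × E T e a)
    ... | no none = noBelow
      where
      noBelow : ⊥
      noBelow with extend {L = (a₀ , p₀) ∷ []} ([] ∷ [])
      ... | g , hom , ga ∷ [] with extend ((fwd (Dom.pa d₀) (subst (E T (g p₀)) ga (hom (Dom.pa d₀))) ∷ []) ∷ [] ∷ [])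
      ...   | h , hom' , hp ∷ ha ∷ [] with cycleIn (subst (λ u → E T u (h b₀)) ha (hom' (Dom.ab d₀)))
      ...     | y , z , d = none (p₀ , h b₀ , y , z , g p₀ , d , subst (E T (g p₀)) ga (hom (Dom.pa d₀)) ,
                  subst (λ u → E T u (h b₀)) hp (hom' (Dom.pb d₀)))
    ... | yes (p , a , b , c , e , d@(dom pa pb pc ab bc ca) , ep , ea) =
      case (adj {e} {b} (λ { refl → or ea ab }) , adj {e} {c} (λ { refl → or ep pc })) of λ
        { (inj₁ eb , inj₁ ec) → asym≢ ep (uniq (dom ea eb ec ab bc ca) d)
        ; (inj₁ eb , inj₂ ce) → with₂ d (ea , eb , ce) ep
        ; (inj₂ be , inj₁ ec) → with₂ (rot (rot d)) (ec , ea , be) ep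
        ; (inj₂ be , inj₂ ce) → with₁ d (ea , be , ce) ep }
      where
      with₂ : ∀ {p a b c e} → Dom p a b c → Type₂ a b c e → E T e p → ⊥
      with₂ d t ep = NoSplit.impossible
        (λ { (dom pa pb pc ab bc ca) (ea , be , ce) pe →
             or pc (same₂ d t ep (dom pe pa pb ea ab be) (ce , ca , bc)) })
        (λ d' t' pe → or pe (same₂ d t ep d' t'))
      with₁ : ∀ {p a b c e} → Dom p a b c → Type₁ a b c e → E T e p → ⊥
      with₁ d t ep = NoSplit.impossible
        (λ d' t' pe → or pe (same₁ d t ep d' t'))
        (λ { (dom pa pb pc ab bc ca) (ea , eb , ce) pe →
             or pa (same₁ d t ep (dom pb pc pe bc ce eb) (ab , ca , ea)) })

  HasDom : Set
  HasDom = Σ (V T) λ p → Σ (V T) λ a → Σ (V T) λ b → Σ (V T) λ c → Dom p a b c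

  abstract
    twoDominators : HasDom → Σ (V T) λ q → Σ (V T) λ p → Σ (V T) λ a → Σ (V T) λ b → Σ (V T) λ c →
      E T q p × Dom q a b c × Dom p a b c
    twoDominators (p , a , b , c , d) = dne em λ none → Unique.absurd d λ {p} {p'} d d' → dne em λ p≢p' →
      case adj p≢p' of λ
        { (inj₁ pp') → none (p , p' , _ , _ , _ , pp' , d , d')
        ; (inj₂ p'p) → none (p' , p , _ , _ , _ , p'p , d' , d) }

  module WithDom (h : HasDom) where
    private
      td = twoDominators h
      q = proj₁ td
      p = proj₁ (proj₂ td)
      a = proj₁ (proj₂ (proj₂ td))
      b = proj₁ (proj₂ (proj₂ (proj₂ td)))
      c = proj₁ (proj₂ (proj₂ (proj₂ (proj₂ td))))
      qp = proj₁ (proj₂ (proj₂ (proj₂ (proj₂ (proj₂ td)))))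
      dq = proj₁ (proj₂ (proj₂ (proj₂ (proj₂ (proj₂ (proj₂ td))))))
      dp = proj₂ (proj₂ (proj₂ (proj₂ (proj₂ (proj₂ (proj₂ td))))))

    abstract
      domAbove : ∀ x → Σ (V T) λ p → Σ (V T) λ a → Σ (V T) λ b → Σ (V T) λ c →
        E T x p × Dom x a b c × Dom p a b c
      domAbove x with extend {L = (q , x) ∷ []} ([] ∷ [])
      ... | g , hom , refl ∷ [] = g p , g a , g b , g c , hom qp , mapDom hom dq , mapDom hom dp

      -- Here and below two witnesses are provided, because one of them may be the vertex `v` by
      -- which a set is later coloured; see `avoid`.
      twoOut : ∀ x → Σ (V T) λ z → Σ (V T) λ z' → z ≢ z' × E T x z × E T x z'
      twoOut x with domAbove x
      ... | _ , a , b , _ , _ , d , _ = a , b , asym≢ (Dom.ab d) , Dom.pa d , Dom.pb d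

      twoIn : ∀ x → Σ (V T) λ z → Σ (V T) λ z' → z ≢ z' × E T z x × E T z' x
      twoIn x with extend {L = (a , x) ∷ []} ([] ∷ [])
      ... | g , hom , refl ∷ [] = g q , g p , asym≢ (hom qp) , hom (Dom.pa dq) , hom (Dom.pa dp)

      twoCommon : ∀ {x y} → E T x y → Σ (V T) λ z → Σ (V T) λ z' →
        z ≢ z' × (E T x z × E T y z) × E T x z' × E T y z'
      twoCommon xy with extend ((fwd qp xy ∷ []) ∷ [] ∷ [])
      ... | g , hom , refl ∷ refl ∷ [] = g a , g b , asym≢ (hom (Dom.ab dp)) ,
            (hom (Dom.pa dq) , hom (Dom.pa dp)) , hom (Dom.pb dq) , hom (Dom.pb dp)

    private
      record TwoCompletions : Set where
        constructor mk
        field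
          {u v s t} : V T
          s≢t : s ≢ t
          uv : E T u v
          vs : E T v s
          su : E T s u
          vt : E T v t
          tu : E T t u

      cycle : Σ (V T) λ s → E T a s × E T s p
      cycle with extend ((fwd (Dom.ab dp) (Dom.pa dp) ∷ []) ∷ [] ∷ [])
      ... | g , hom , ga ∷ gb ∷ [] = g c , subst (λ u → E T u (g c)) gb (hom (Dom.bc dp)) ,
            subst (E T (g c)) ga (hom (Dom.ca dp))

      -- Let `s` complete `p → a` to a 3-cycle. If `b` or `c` has an arc to `s`, this vertex and `a`
      -- both complete `s → p`. Otherwise `s → c`, and both `p` and `c` complete `a → s`.
      completions : TwoCompletions
      completions with cycle
      ... | s , as , sp with em (E T b s) | em (E T c s)
      ...   | yes bs | _ = mk (asym≢ (Dom.ab dp)) sp (Dom.pa dp) as (Dom.pb dp) bs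
      ...   | no _ | yes cs = mk (λ u → asym≢ (Dom.ca dp) (sym u)) sp (Dom.pa dp) as (Dom.pc dp) cs
      ...   | no ¬bs | no ¬cs = mk (asym≢ (Dom.pc dp)) as sp (Dom.pa dp) sc (Dom.ca dp)
        where
        sc : E T s c
        sc with adj {s} {c} (λ { refl → or sp (Dom.pc dp) })
        ... | inj₁ e = e
        ... | inj₂ e = ⊥-elim (¬cs e)

    abstract
      twoCompletions : ∀ {x y} → E T x y → Σ (V T) λ z → Σ (V T) λ z' →
        z ≢ z' × (E T y z × E T z x) × E T y z' × E T z' x
      twoCompletions xy with completions
      ... | mk {s = s} {t} s≢t uv vs su vt tu with extend ((fwd uv xy ∷ []) ∷ [] ∷ [])
      ...   | g , hom , refl ∷ refl ∷ [] = g s , g t , gs≢gt , (hom vs , hom su) , hom vt , hom tu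
        where
        gs≢gt : g s ≢ g t
        gs≢gt eq = case adj s≢t of λ { (inj₁ e) → asym≢ (hom e) eq ; (inj₂ e) → asym≢ (hom e) (sym eq) }

-- Sets of vertices of a given type

module Pieces (em : EM) (T : Digraph) (tour : IsTournament T) (hh : HomHomogeneous T) where
  open HomTournament em T tour hh public

  Arc : Bool → V T → V T → Set
  Arc true x y = E T x y
  Arc false x y = E T y x

  arc-flip : ∀ b {x y} → Arc b x y → Arc (not b) y x
  arc-flip true e = e
  arc-flip false e = e

  arc-hom : ∀ {g} → Endo g → ∀ b {x y} → Arc b x y → Arc b (g x) (g y)
  arc-hom hom true = hom
  arc-hom hom false = hom

  arc-excl : ∀ b {x y} → Arc b x y → ¬ Arc (not b) x y
  arc-excl true = or
  arc-excl false = or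

  arc-total : ∀ b {x y} → x ≢ y → Arc b x y ⊎ Arc (not b) x y
  arc-total true = adj
  arc-total false n = [ inj₂ , inj₁ ]′ (adj n)

  arc-pair : ∀ b {x x' y y'} → Arc b x x' → Arc b y y' → HomPair T (x , y) (x' , y')
  arc-pair true = fwd
  arc-pair false = bwd

  Sat : List (V T × Bool) → V T → Set
  Sat Q x = All (λ q → Arc (proj₂ q) (proj₁ q) x) Q

  Fixes : (V T → V T) → List (V T × Bool) → Set
  Fixes g Q = All (λ q → g (proj₁ q) ≡ proj₁ q) Q

  sat-hom : ∀ {g Q x} → Endo g → Fixes g Q → Sat Q x → Sat Q (g x)
  sat-hom hom [] [] = []
  sat-hom {g} {(q , b) ∷ Q} {x} hom (f ∷ fs) (a ∷ as) =
    subst (λ u → Arc b u (g x)) f (arc-hom hom b a) ∷ sat-hom hom fs as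

  private
    diag : V T × Bool → V T × V T
    diag q = proj₁ q , proj₁ q

  abstract
    -- All vertices in `L` and their targets have the same type `Q`, so the parameters of `Q` can be
    -- added as fixed points.
    moveBy : ∀ Q {L} → (∀ {p q} → p ∈ L → q ∈ L → HomPair T p q) →
      (∀ {p} → p ∈ L → Sat Q (proj₁ p) × Sat Q (proj₂ p)) →
      Σ (V T → V T) λ g → Endo g × Fixes g Q × (∀ {x y} → (x , y) ∈ L → g x ≡ y)
    moveBy Q {L} ok sat with extendBy pairs
      where
      cross : ∀ {q p} → q ∈ Q → p ∈ L → HomPair T (diag q) p
      cross {q} q∈ p∈ = arc-pair (proj₂ q) (All.lookup (proj₁ (sat p∈)) q∈) (All.lookup (proj₂ (sat p∈)) q∈)
      pairs : ∀ {p q} → p ∈ map diag Q ++ L → q ∈ map diag Q ++ L → HomPair T p q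
      pairs mp mq with ∈ₚ.∈-++⁻ (map diag Q) mp | ∈ₚ.∈-++⁻ (map diag Q) mq
      ... | inj₂ p∈ | inj₂ q∈ = ok p∈ q∈
      ... | inj₁ p∈ | inj₂ q∈ with ∈ₚ.∈-map⁻ diag p∈
      ...   | q , m , refl = cross m q∈
      pairs mp mq | inj₂ p∈ | inj₁ q∈ with ∈ₚ.∈-map⁻ diag q∈
      ... | q , m , refl with cross m p∈
      ...   | f , b , e = b , f , λ u → sym (e (sym u))
      pairs mp mq | inj₁ p∈ | inj₁ q∈ with ∈ₚ.∈-map⁻ diag p∈ | ∈ₚ.∈-map⁻ diag q∈
      ... | _ , _ , refl | _ , _ , refl = id , id , id
    ... | g , hom , ext = g , hom , All.tabulate (λ m → ext (∈ₚ.∈-++⁺ˡ (∈ₚ.∈-map⁺ diag m))) ,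
          λ m → ext (∈ₚ.∈-++⁺ʳ (map diag Q) m)

    move₁ : ∀ Q {x y} → Sat Q x → Sat Q y → Σ (V T → V T) λ g → Endo g × Fixes g Q × g x ≡ y
    move₁ Q {x} {y} sx sy with moveBy Q {(x , y) ∷ []}
        (λ { (here refl) (here refl) → (λ e → ⊥-elim (or e e)) , (λ e → ⊥-elim (or e e)) , λ _ → refl })
        (λ { (here refl) → sx , sy })
    ... | g , hom , f , ext = g , hom , f , ext (here refl)

  DomIn : List (V T × Bool) → Set
  DomIn Q = Σ (V T) λ p → Σ (V T) λ a → Σ (V T) λ b → Σ (V T) λ c →
    Dom p a b c × Sat Q p × Sat Q a × Sat Q b × Sat Q c

  Splits : List (V T × Bool) → V T → Set
  Splits Q v = ∀ c → Σ (V T) λ x → Sat Q x × Arc c v x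

  module Sub (Q : List (V T × Bool)) where

    -- does … ≡ true is a proposition, unlike Sat Q x; otherwise S would not be a tournament.
    S : Digraph
    S = digraph (Σ (V T) λ x → does (em (Sat Q x)) ≡ true) λ x y → E T (proj₁ x) (proj₁ y)

    S-≡ : ∀ {x y : V S} → proj₁ x ≡ proj₁ y → x ≡ y
    S-≡ {x , p} {_ , q} refl = cong (x ,_) (uip p q)

    toS : ∀ {x} → Sat Q x → V S
    toS {x} s = x , mem
      where
      mem : does (em (Sat Q x)) ≡ true
      mem with em (Sat Q x)
      ... | yes _ = refl
      ... | no ¬s = ⊥-elim (¬s s)

    satS : (x : V S) → Sat Q (proj₁ x)
    satS (x , p) with em (Sat Q x)
    satS (x , p) | yes s = s
    satS (x , ()) | no _

    S-tournament : IsTournament S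
    S-tournament = or , λ x y x≢y → adj (λ eq → x≢y (S-≡ eq))

    abstract
      S-hh : HomHomogeneous S
      S-hh A h ok with moveBy Q pairs sats
        where
        pairs : ∀ {p q} → p ∈ map (λ a → proj₁ a , proj₁ (h a)) A → q ∈ map (λ a → proj₁ a , proj₁ (h a)) A → HomPair T p q
        pairs mp mq with ∈ₚ.∈-map⁻ _ mp | ∈ₚ.∈-map⁻ _ mq
        ... | a , a∈ , refl | b , b∈ , refl = ok a∈ b∈ , ok b∈ a∈ , λ e → cong (proj₁ ∘ h) (S-≡ e)
        sats : ∀ {p} → p ∈ map (λ a → proj₁ a , proj₁ (h a)) A → Sat Q (proj₁ p) × Sat Q (proj₂ p)
        sats mp with ∈ₚ.∈-map⁻ _ mp
        ... | a , a∈ , refl = satS a , satS (h a)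
      ... | g , hom , f , ext = (λ x → toS (sat-hom hom f (satS x))) , hom ,
            λ m → S-≡ (ext (∈ₚ.∈-map⁺ _ m))

    module HS = HomTournament em S S-tournament S-hh

    domS : DomIn Q → HS.HasDom
    domS (p , a , b , c , dom pa pb pc ab bc ca , sp , sa , sb , sc) =
      toS sp , toS sa , toS sb , toS sc , HS.dom pa pb pc ab bc ca

    domS⁻ : ∀ {x} → (Σ (V S) λ p → Σ (V S) λ a → Σ (V S) λ b → Σ (V S) λ c → E S x p × HS.Dom x a b c × HS.Dom p a b c) →
      DomIn ((proj₁ x , true) ∷ Q)
    domS⁻ (p , a , b , c , xp , HS.dom xa xb xc _ _ _ , HS.dom pa pb pc ab bc ca) =
      proj₁ p , proj₁ a , proj₁ b , proj₁ c , dom pa pb pc ab bc ca ,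
      xp ∷ satS p , xa ∷ satS a , xb ∷ satS b , xc ∷ satS c

    -- If every x of colour c in S has a monochromatic out-neighbourhood in S, then x turns out
    -- to be the only vertex of colour c, hence determined by v. But then the other vertices
    -- of S cannot be related to x in different ways.
    module Step (d : DomIn Q) {v : V T} (split : Splits Q v) (c : Bool) where
      private module W = HS.WithDom (domS d)

      Goal : Set
      Goal = Σ (V T) λ x → Sat Q x × Arc c v x × DomIn ((x , true) ∷ Q) × Splits ((x , true) ∷ Q) v

      module Contra (none : ¬ Goal) where

        Red Blue : V S → Set
        Red x = Arc c v (proj₁ x)
        Blue x = Arc (not c) v (proj₁ x)

        mono : ∀ {x y z} → Red x → E S x y → Red y → E S x z → ¬ Blue z
        mono {x} {y} {z} rx xy ry xz bz = none (proj₁ x , satS x , rx , domS⁻ (W.domAbove x) , both c ry bz)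
          where
          both : ∀ c → Arc c v (proj₁ y) → Arc (not c) v (proj₁ z) → Splits ((proj₁ x , true) ∷ Q) v
          both true ry bz true = proj₁ y , (xy ∷ satS y) , ry
          both true ry bz false = proj₁ z , (xz ∷ satS z) , bz
          both false ry bz false = proj₁ y , (xy ∷ satS y) , ry
          both false ry bz true = proj₁ z , (xz ∷ satS z) , bz

        avoid : ∀ {P : V S → Set} {z z'} → z ≢ z' → P z → P z' → Σ (V S) λ z → P z × (Red z ⊎ Blue z)
        avoid {P} {z} {z'} z≢z' pz pz' with em (v ≡ proj₁ z)
        ... | no ne = z , pz , arc-total c ne
        ... | yes eq = z' , pz' , arc-total c (λ eq' → z≢z' (S-≡ (trans (sym eq) eq')))

        -- Otherwise a blue `y` satisfies `y → x`. A vertex `z` completing `y → x` to a 3-cycle is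
        -- above `x`, hence red, and so is a common out-neighbour of `x` and `z`. Then `z` has both
        -- a red and a blue out-neighbour.
        blueAbove : ∀ {x} → Red x → Σ (V S) λ y → E S x y × Blue y
        blueAbove {x} rx = dne em λ noBlue → contra (λ {y} xy by → noBlue (y , xy , by)) (split (not c))
          where
          contra : (∀ {y} → E S x y → ¬ Blue y) → (Σ (V T) λ y → Sat Q y × Arc (not c) v y) → ⊥
          contra nb (y , sy , by) with HS.adj {x} {toS sy} (λ { refl → arc-excl c rx by })
          ... | inj₁ xy = nb {toS sy} xy by
          ... | inj₂ yx with W.twoCompletions {toS sy} {x} yx
          ...   | z , z' , z≢z' , cz , cz' with avoid {λ z → E S x z × E S z (toS sy)} z≢z' cz cz'
          ...     | z , (xz , zy) , inj₂ bz = nb {z} xz bz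
          ...     | z , (xz , zy) , inj₁ rz with W.twoCommon {x} {z} xz
          ...       | u , u' , u≢u' , cu , cu' with avoid {λ u → E S x u × E S z u} u≢u' cu cu'
          ...         | u , (xu , zu) , inj₂ bu = nb {u} xu bu
          ...         | u , (xu , zu) , inj₁ ru = mono {z} {u} {toS sy} rz zu ru zy by

        noRedAbove : ∀ {x y} → Red x → E S x y → ¬ Red y
        noRedAbove {x} {y} rx xy ry with blueAbove {x} rx
        ... | z , xz , bz = mono {x} {y} {z} rx xy ry xz bz

        unique : ∀ {x y} → Red x → Red y → proj₁ x ≡ proj₁ y
        unique {x} {y} rx ry = dne em λ ne → case adj ne of λ
          { (inj₁ e) → noRedAbove {x} {y} rx e ry ; (inj₂ e) → noRedAbove {y} {x} ry e rx }

        conflict : ∀ {x y y'} → Red x → E S x y → Blue y → E S y' x → ¬ Blue y'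
        conflict {x} {y} {y'} rx xy by y'x by' = or y'x (subst₂ (E T) gx gy (hom xy))
          where
          moved = move₁ ((v , not c) ∷ Q) {proj₁ y} {proj₁ y'} (by ∷ satS y) (by' ∷ satS y')
          g = proj₁ moved
          hom : Endo g
          hom = proj₁ (proj₂ moved)
          fix : Fixes g ((v , not c) ∷ Q)
          fix = proj₁ (proj₂ (proj₂ moved))
          gy = proj₂ (proj₂ (proj₂ moved))
          gx : g (proj₁ x) ≡ proj₁ x
          gx = unique {toS (sat-hom hom (All.tail fix) (satS x))} {x}
            (subst (λ u → Arc c u (g (proj₁ x))) (All.head fix) (arc-hom hom c rx)) rx

        blueBelow : ∀ {x} → Red x → Σ (V S) λ y → E S y x × Blue y
        blueBelow {x} rx with W.twoIn x
        ... | z , z' , z≢z' , i , i' with avoid {λ z → E S z x} z≢z' i i'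
        ...   | y , yx , inj₁ ry = ⊥-elim (noRedAbove {y} {x} ry yx rx)
        ...   | y , yx , inj₂ by = y , yx , by

        absurd : ⊥
        absurd = clash (split c)
          where
          clash : ¬ (Σ (V T) λ x → Sat Q x × Arc c v x)
          clash (x₀ , sx , rx) with blueAbove {toS sx} rx | blueBelow {toS sx} rx
          ... | y , xy , by | y' , y'x , by' = conflict {toS sx} {y} {y'} rx xy by y'x by'

      oneStep : Goal
      oneStep = dne em Contra.absurd

  -- Adding each new vertex to the type puts all later ones above it; `oneStep` keeps the two
  -- conditions needed to continue.
  chain : ∀ {Q v} → DomIn Q → Splits Q v → ∀ m (cs : Fin m → Bool) → Σ (Fin m → V T) λ y →
    (∀ i → Sat Q (y i) × Arc (cs i) v (y i)) × (∀ {i j} → i Fin.< j → E T (y i) (y j))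
  chain d split zero cs = (λ ()) , (λ ()) , λ { {()} }
  chain {Q} {v} d split (suc m) cs with Sub.Step.oneStep Q d split (cs zero)
  ... | x , sx , cx , d' , split' with chain d' split' m (cs ∘ suc)
  ...   | y , ok , ord = y' , ok' , ord'
    where
    y' : Fin (suc m) → V T
    y' zero = x
    y' (suc i) = y i
    ok' : ∀ i → Sat Q (y' i) × Arc (cs i) v (y' i)
    ok' zero = sx , cx
    ok' (suc i) = All.tail (proj₁ (ok i)) , proj₂ (ok i)
    ord' : ∀ {i j} → i Fin.< j → E T (y' i) (y' j)
    ord' {zero} {suc j} _ = All.head (proj₁ (ok j))
    ord' {suc i} {suc j} (s≤s lt) = ord lt

-- Blow-ups by chains

module _ (em : EM) where

  -- This is one less than the `r`-th power of 2: in a tournament, at least half of the other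
  -- vertices lie on the same side of the first one.
  ramseyBound : ℕ → ℕ
  ramseyBound zero = 0
  ramseyBound (suc r) = suc (ramseyBound r ℕ.+ ramseyBound r)

  module _ {A : Set} {D : A → A → Set} where

    private
      pickAllPairs : ∀ {R : A → A → Set} (P : A → Set) {xs} → AllPairs R xs → AllPairs R (pick em P xs)
      pickAllPairs P [] = []
      pickAllPairs P {x ∷ xs} (a ∷ as) with em (P x)
      ... | yes _ = All.tabulate (λ m → All.lookup a (proj₁ (pick⁻ em P xs m))) ∷ pickAllPairs P as
      ... | no _ = pickAllPairs P as

      pickLength : ∀ (P : A → Set) xs → length xs ≡ length (pick em P xs) ℕ.+ length (pick em (¬_ ∘ P) xs)
      pickLength P [] = refl
      pickLength P (x ∷ xs) with em (P x) | em (¬ P x)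
      ... | yes p | yes ¬p = ⊥-elim (¬p p)
      ... | yes p | no _ = cong suc (pickLength P xs)
      ... | no _ | yes _ = trans (cong suc (pickLength P xs)) (sym (ℕₚ.+-suc _ _))
      ... | no ¬p | no ¬¬p = ⊥-elim (¬¬p ¬p)

    ramsey : ∀ r xs → AllPairs (λ x y → D x y ⊎ D y x) xs → ramseyBound r ℕ.≤ length xs →
      Σ (List A) λ ys → length ys ≡ r × AllPairs D ys × (∀ {y} → y ∈ ys → y ∈ xs)
    ramsey zero xs _ _ = [] , refl , [] , λ ()
    ramsey (suc r) (x ∷ xs) (a ∷ as) (s≤s le) with ramseyBound r ℕ.≤? length (pick em (D x) xs)
    ... | yes le′ with ramsey r _ (pickAllPairs (D x) as) le′
    ...   | ys , len , ap , sub = x ∷ ys , cong suc len ,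
              All.tabulate (λ m → proj₂ (pick⁻ em (D x) xs (sub m))) ∷ ap ,
              λ { (here refl) → here refl ; (there m) → there (proj₁ (pick⁻ em (D x) xs (sub m))) }
    ramsey (suc r) (x ∷ xs) (a ∷ as) (s≤s le) | no ¬le
      with ramsey r _ (pickAllPairs (¬_ ∘ D x) as) (ℕₚ.≮⇒≥ λ lt → ℕₚ.<-irrefl refl
             (ℕₚ.<-≤-trans (subst (ℕ._< _) (sym (pickLength (D x) xs)) (ℕₚ.+-mono-< (ℕₚ.≰⇒> ¬le) lt)) le))
    ...   | ys , len , ap , sub = ys ++ x ∷ [] ,
              trans (Listₚ.length-++ ys) (trans (ℕₚ.+-comm _ 1) (cong suc len)) ,
              AllPairsₚ.++⁺ ap ([] ∷ []) (All.tabulate λ m → before m ∷ []) ,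
              λ m → [ (λ m → there (proj₁ (pick⁻ em _ xs (sub m)))) , (λ { (here refl) → here refl }) ]′ (∈ₚ.∈-++⁻ ys m)
      where
      before : ∀ {y} → y ∈ ys → D y x
      before m with pick⁻ em (¬_ ∘ D x) xs (sub m)
      ... | m′ , ¬d = [ (λ d → ⊥-elim (¬d d)) , id ]′ (All.lookup a m′)

AllPairs-lookup : {A : Set} {D : A → A → Set} → ∀ {xs} → AllPairs D xs → ∀ {i j} → i Fin.< j →
  D (Data.List.lookup xs i) (Data.List.lookup xs j)
AllPairs-lookup (a ∷ _) {zero} {suc j} _ = All.lookup a (∈ₚ.∈-lookup j)
AllPairs-lookup (_ ∷ as) {suc i} {suc j} (s≤s lt) = AllPairs-lookup as lt

module Configurations (em : EM) (T : Digraph) (tour : IsTournament T) (hh : HomHomogeneous T) where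
  open Pieces em T tour hh public

  Consistent : ∀ {k} → (Fin k → Fin k → Bool) → Set
  Consistent R = ∀ i j → i ≢ j → R i j ≡ not (R j i)

  -- The lexicographic product of a tournament on the labels with a chain.
  record IsConfig {k m} (R : Fin k → Fin k → Bool) (e : Fin k → Fin m → V T) : Set where
    field
      within : ∀ ℓ {i j} → i Fin.< j → E T (e ℓ i) (e ℓ j)
      across : ∀ {ℓ ℓ'} → ℓ ≢ ℓ' → ∀ i j → Arc (R ℓ ℓ') (e ℓ i) (e ℓ' j)
  open IsConfig public

  Type : ℕ → ℕ → Set
  Type k m = Fin k → Fin m → Bool

  HasType : ∀ {k m} → (Fin k → Fin m → V T) → Type k m → V T → Set
  HasType e s x = ∀ ℓ i → Arc (s ℓ i) (e ℓ i) x

  module _ {k m : ℕ} where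
    private
      cells : List (Fin k × Fin m)
      cells = cartesianProduct (allFin k) (allFin m)

      ∈cells : ∀ ℓ i → (ℓ , i) ∈ cells
      ∈cells ℓ i = ∈ₚ.∈-cartesianProduct⁺ (∈ₚ.∈-allFin ℓ) (∈ₚ.∈-allFin i)

    typeList : (Fin k → Fin m → V T) → Type k m → List (V T × Bool)
    typeList e s = map (λ p → e (proj₁ p) (proj₂ p) , s (proj₁ p) (proj₂ p)) cells

    sat⁺ : ∀ {e s x} → HasType e s x → Sat (typeList e s) x
    sat⁺ {e} {s} {x} h = All.tabulate λ m → help m
      where
      help : ∀ {q} → q ∈ typeList e s → Arc (proj₂ q) (proj₁ q) x
      help m with ∈ₚ.∈-map⁻ _ m
      ... | (ℓ , i) , _ , refl = h ℓ i

    sat⁻ : ∀ {e s x} → Sat (typeList e s) x → HasType e s x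
    sat⁻ {e} {s} h ℓ i = All.lookup h (∈ₚ.∈-map⁺ (λ p → e (proj₁ p) (proj₂ p) , s (proj₁ p) (proj₂ p)) (∈cells ℓ i))

    fixes⁻ : ∀ {g e s} → Fixes g (typeList e s) → ∀ ℓ i → g (e ℓ i) ≡ e ℓ i
    fixes⁻ {g} {e} {s} h ℓ i = All.lookup h (∈ₚ.∈-map⁺ (λ p → e (proj₁ p) (proj₂ p) , s (proj₁ p) (proj₂ p)) (∈cells ℓ i))

    type-hom : ∀ {g e e' s x} → Endo g → (∀ ℓ i → g (e ℓ i) ≡ e' ℓ i) →
      HasType {k} {m} e s x → HasType e' s (g x)
    type-hom {g} {e} {e'} {s} {x} hom eq h ℓ i = subst (λ u → Arc (s ℓ i) u (g x)) (eq ℓ i) (arc-hom hom (s ℓ i) (h ℓ i))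

    moveConfig : ∀ {R e e'} → IsConfig {k} {m} R e → IsConfig R e' →
      Σ (V T → V T) λ g → Endo g × (∀ ℓ i → g (e ℓ i) ≡ e' ℓ i)
    moveConfig {R} {e} {e'} c c' with extendBy {L = map (λ p → e (proj₁ p) (proj₂ p) , e' (proj₁ p) (proj₂ p)) cells} pairs
      where
      cellPair : ∀ ℓ i ℓ' i' → HomPair T (e ℓ i , e' ℓ i) (e ℓ' i' , e' ℓ' i')
      cellPair ℓ i ℓ' i' with ℓ Fin.≟ ℓ'
      ... | no ne = arc-pair (R ℓ ℓ') (across c ne i i') (across c' ne i i')
      ... | yes refl with Finₚ.<-cmp i i'
      ...   | tri< lt _ _ = fwd (within c ℓ lt) (within c' ℓ lt)
      ...   | tri> _ _ gt = bwd (within c ℓ gt) (within c' ℓ gt)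
      ...   | tri≈ _ refl _ = (λ e → ⊥-elim (or e e)) , (λ e → ⊥-elim (or e e)) , λ _ → refl
      pairs : ∀ {p q} → p ∈ map (λ p → e (proj₁ p) (proj₂ p) , e' (proj₁ p) (proj₂ p)) cells →
        q ∈ map (λ p → e (proj₁ p) (proj₂ p) , e' (proj₁ p) (proj₂ p)) cells → HomPair T p q
      pairs mp mq with ∈ₚ.∈-map⁻ _ mp | ∈ₚ.∈-map⁻ _ mq
      ... | (ℓ , i) , _ , refl | (ℓ' , i') , _ , refl = cellPair ℓ i ℓ' i'
    ... | g , hom , ext = g , hom , λ ℓ i → ext (∈ₚ.∈-map⁺ (λ p → e (proj₁ p) (proj₂ p) , e' (proj₁ p) (proj₂ p)) (∈cells ℓ i))

  Claim : ∀ {k} → (Fin k → Fin k → Bool) → Set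
  Claim {k} R = ∀ m (s : Type k m) → Σ (Fin k → Fin m → V T) λ e → IsConfig R e × Σ (V T) (HasType e s)

  abstract
    -- Any two configurations of the same shape are related by an endomorphism, so a type realised
    -- over one of them is realised over all.
    realise : ∀ {k} {R : Fin k → Fin k → Bool} → Claim R → ∀ {m} {e} → IsConfig {k} {m} R e →
      ∀ s → Σ (V T) (HasType e s)
    realise claim {m} {e} c s with claim m s
    ... | e₀ , c₀ , v , h with moveConfig c₀ c
    ...   | g , hom , eq = g v , type-hom {e = e₀} {e} {s} {v} hom eq h

  -- Vertices v j are chosen over long configurations consisting of one block for every map
  -- σ : Fin r → Fin N, such that v (σ i) has type τ i over the block of σ; an initial block
  -- makes the v j distinct.
  module Ramsey {k : ℕ} {R : Fin (suc k) → Fin (suc k) → Bool} (claim : Claim R)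
    (r : ℕ) {m : ℕ} (τ : Fin r → Type (suc k) m) where
    private
      N M : ℕ
      N = ramseyBound em r
      -- The first `N` columns separate the vertices `v j`; each of the `N ^ r` possible index maps
      -- then gets its own block of length `m`.
      M = N ℕ.+ (N ℕ.^ r) ℕ.* m

      at : Fin N → (Fin r → Fin N) → Fin (suc k) → Fin m → Bool
      at j f ℓ p with Finₚ.any? (λ i → f i Fin.≟ j)
      ... | yes (i , _) = τ i ℓ p
      -- An arbitrary sign, as `j` is not an index occurring in `f`.
      ... | no _ = true

      atBlock : Fin N → Fin (suc k) → Fin (N ℕ.^ r) × Fin m → Bool
      atBlock j ℓ (σ , p) = at j (Fin.finToFun σ) ℓ p

      signAt : Fin N → Fin (suc k) → Fin N ⊎ Fin ((N ℕ.^ r) ℕ.* m) → Bool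
      signAt j ℓ (inj₁ j') = does (j Fin.≟ j')
      signAt j ℓ (inj₂ P) = atBlock j ℓ (Fin.remQuot {N ℕ.^ r} m P)

      sign : Fin N → Type (suc k) M
      sign j ℓ P = signAt j ℓ (Fin.splitAt N P)

      long : Σ (Fin (suc k) → Fin M → V T) λ e → IsConfig R e × Σ (V T) (HasType e λ _ _ → true)
      long = claim M λ _ _ → true

      e* = proj₁ long

      c* : IsConfig R e*
      c* = proj₁ (proj₂ long)

      v : Fin N → V T
      v j = proj₁ (realise claim c* (sign j))

      v-type : ∀ j → HasType e* (sign j) (v j)
      v-type j = proj₂ (realise claim c* (sign j))

      sign-init : ∀ j j' ℓ → sign j ℓ (j' Fin.↑ˡ _) ≡ does (j Fin.≟ j')
      sign-init j j' ℓ = cong (signAt j ℓ) (Finₚ.splitAt-↑ˡ N j' ((N ℕ.^ r) ℕ.* m))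

      v-init : ∀ j j' → Arc (does (j Fin.≟ j')) (e* zero (j' Fin.↑ˡ _)) (v j)
      v-init j j' = subst (λ b → Arc b (e* zero (j' Fin.↑ˡ _)) (v j)) (sign-init j j' zero) (v-type j zero (j' Fin.↑ˡ _))

      v-adj : ∀ {j j'} → j ≢ j' → E T (v j) (v j') ⊎ E T (v j') (v j)
      v-adj {j} {j'} j≢j' = adj λ eq → arc-excl true
        (subst (λ b → Arc b (e* zero (j Fin.↑ˡ _)) (v j)) (Decₚ.dec-true (j Fin.≟ j) refl) (v-init j j))
        (subst (λ b → Arc b (e* zero (j Fin.↑ˡ _)) (v j)) (Decₚ.dec-false (j' Fin.≟ j) (λ u → j≢j' (sym u)))
          (subst (Arc (does (j' Fin.≟ j)) _) (sym eq) (v-init j' j)))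

      abstract
        indices : Σ (Fin r → Fin N) λ σ → ∀ {i j} → i Fin.< j → E T (v (σ i)) (v (σ j))
        indices with ramsey em {D = λ j j' → E T (v j) (v j')} r (allFin N)
                       (AllPairs.map v-adj (Uniqueₚ.allFin⁺ N)) (ℕₚ.≤-reflexive (sym (Listₚ.length-tabulate {n = N} id)))
        ... | ys , len , ap , _ = subst (λ n → Σ (Fin n → Fin N) λ σ → ∀ {i j} → i Fin.< j → E T (v (σ i)) (v (σ j)))
                len (Data.List.lookup ys , AllPairs-lookup ap)

      σ = proj₁ indices

      σ-inj : ∀ {i j} → σ i ≡ σ j → i ≡ j
      σ-inj {i} {j} eq with Finₚ.<-cmp i j
      ... | tri< lt _ _ = ⊥-elim (asym≢ (proj₂ indices lt) (cong v eq))
      ... | tri≈ _ eq′ _ = eq′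
      ... | tri> _ _ gt = ⊥-elim (asym≢ (proj₂ indices gt) (cong v (sym eq)))

      pos : Fin m → Fin M
      pos p = N Fin.↑ʳ Fin.combine (Fin.funToFin σ) p

      pos-< : ∀ {p p'} → p Fin.< p' → pos p Fin.< pos p'
      pos-< {p} {p'} lt = subst₂ ℕ._<_ (eq p) (eq p') (ℕₚ.+-monoʳ-< N (ℕₚ.+-monoʳ-< _ lt))
        where
        eq : ∀ p → N ℕ.+ (m ℕ.* toℕ (Fin.funToFin σ) ℕ.+ toℕ p) ≡ toℕ (pos p)
        eq p = sym (trans (Finₚ.toℕ-↑ʳ N _) (cong (N ℕ.+_) (Finₚ.toℕ-combine (Fin.funToFin σ) p)))

      at-σ : ∀ {f} → (∀ i → f i ≡ σ i) → ∀ i ℓ p → at (σ i) f ℓ p ≡ τ i ℓ p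
      at-σ {f} f≗σ i ℓ p with Finₚ.any? (λ i' → f i' Fin.≟ σ i)
      ... | yes (i' , eq) = cong (λ u → τ u ℓ p) (σ-inj (trans (sym (f≗σ i')) eq))
      ... | no n = ⊥-elim (n (i , f≗σ i))

      sign-block : ∀ j (f : Fin r → Fin N) ℓ p →
        sign j ℓ (N Fin.↑ʳ Fin.combine (Fin.funToFin f) p) ≡ at j (Fin.finToFun (Fin.funToFin f)) ℓ p
      sign-block j f ℓ p =
        trans (cong (signAt j ℓ) (Finₚ.splitAt-↑ʳ N ((N ℕ.^ r) ℕ.* m) (Fin.combine (Fin.funToFin f) p)))
          (cong (atBlock j ℓ) (Finₚ.remQuot-combine {N ℕ.^ r} (Fin.funToFin f) p))

      sign-pos : ∀ i ℓ p → sign (σ i) ℓ (pos p) ≡ τ i ℓ p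
      sign-pos i ℓ p = trans (sign-block (σ i) σ ℓ p) (at-σ (Finₚ.finToFun-funToFin σ) i ℓ p)

    abstract
      chainOver : Σ (Fin (suc k) → Fin m → V T) λ e → IsConfig R e × Σ (Fin r → V T) λ w →
        (∀ {i j} → i Fin.< j → E T (w i) (w j)) × (∀ i → HasType e (τ i) (w i))
      chainOver = (λ ℓ p → e* ℓ (pos p)) ,
        record { within = λ ℓ lt → within c* ℓ (pos-< lt) ; across = λ ne i j → across c* ne (pos i) (pos j) } ,
        (λ i → v (σ i)) , proj₂ indices ,
        λ i ℓ p → subst (λ b → Arc b (e* ℓ (pos p)) (v (σ i))) (sign-pos i ℓ p) (v-type (σ i) ℓ (pos p))

-- One-point extensions by induction on the number of labels

module Universal (em : EM) (T : Digraph) (tour : IsTournament T) (hh : HomHomogeneous T)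
  (hasDom : HomTournament.HasDom em T tour hh) where
  open Configurations em T tour hh public

  Labelled : ℕ → Set
  Labelled k = Fin k → Fin k → Bool

  arc-unflip : ∀ b {x y} → Arc (not b) x y → Arc b y x
  arc-unflip true e = e
  arc-unflip false e = e

  claim₁ : (R : Labelled 1) → Claim R
  -- `chain` prescribes arcs from `v` to the chain, a type prescribes arcs from the chain to `v`;
  -- hence the negation.
  claim₁ R m s with chain {[]} {v} domIn splits m (λ i → not (s zero i))
    where
    v = proj₁ hasDom
    domIn : DomIn []
    domIn = let p , a , b , c , d = hasDom in p , a , b , c , d , [] , [] , [] , []
    splits : Splits [] v
    splits true with WithDom.twoOut hasDom v
    ... | x , _ , _ , e , _ = x , [] , e
    splits false with WithDom.twoIn hasDom v
    ... | x , _ , _ , e , _ = x , [] , e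
  ... | y , ok , ord = (λ _ → y) ,
    record { within = λ _ → ord ; across = λ { {zero} {zero} ne → ⊥-elim (ne refl) } } ,
    proj₁ hasDom , λ { zero i → arc-unflip (s zero i) (proj₂ (ok i)) }

  module Step {k : ℕ} (claims : (R : Labelled (suc k)) → Consistent R → Claim R)
    (R : Labelled (suc (suc k))) (cons : Consistent R) where

    private
      flip : ∀ {ℓ ℓ'} → ℓ ≢ ℓ' → ∀ {x y} → Arc (R ℓ ℓ') x y → Arc (R ℓ' ℓ) y x
      flip {ℓ} {ℓ'} ne a = subst (λ b → Arc b _ _) (sym (cons ℓ' ℓ (λ u → ne (sym u)))) (arc-flip (R ℓ ℓ') a)

      RH : Labelled (suc k)
      RH i j = R (suc i) (suc j)

      consH : Consistent RH
      consH i j ne = cons (suc i) (suc j) (λ u → ne (Finₚ.suc-injective u))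

      skip : Fin (suc k) → Fin (suc (suc k))
      skip zero = zero
      skip (suc i) = suc (suc i)

      skip-inj : ∀ {i j} → skip i ≡ skip j → i ≡ j
      skip-inj {zero} {zero} _ = refl
      skip-inj {suc i} {suc .i} refl = refl

      R″ : Labelled (suc k)
      R″ i j = R (skip i) (skip j)

      cons″ : Consistent R″
      cons″ i j ne = cons (skip i) (skip j) (λ u → ne (skip-inj u))

      qtype : ∀ {m} → Type (suc k) m
      qtype ℓ _ = R (suc ℓ) zero

      -- The point `c` must look like a vertex of label q over the chain with label one. It is
      -- therefore the first or the last vertex of a chain of length `suc m`, according to the sign
      -- `b`.
      record Placement (b : Bool) (m : ℕ) : Set where
        field
          pt : Fin (suc m)
          emb : Fin m → Fin (suc m)
          emb-< : ∀ {i j} → i Fin.< j → emb i Fin.< emb j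
          emb-≢ : ∀ i → emb i ≢ pt
          side : ∀ {w : Fin (suc m) → V T} → (∀ {i j} → i Fin.< j → E T (w i) (w j)) → ∀ i → Arc b (w pt) (w (emb i))

      placement : ∀ b m → Placement b m
      placement true m = record
        { pt = zero ; emb = suc ; emb-< = s≤s ; emb-≢ = λ _ () ; side = λ ord i → ord (s≤s z≤n) }
      placement false m = record
        { pt = Fin.fromℕ m ; emb = Fin.inject₁
        ; emb-< = λ {i} {j} lt → subst₂ ℕ._<_ (sym (Finₚ.toℕ-inject₁ i)) (sym (Finₚ.toℕ-inject₁ j)) lt
        ; emb-≢ = λ i u → Finₚ.fromℕ≢inject₁ (sym u)
        ; side = λ ord i → ord (subst₂ ℕ._<_ (sym (Finₚ.toℕ-inject₁ i)) (sym (Finₚ.toℕ-fromℕ m)) (Finₚ.toℕ<n i)) }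

    -- Over the configuration with labels R″ and the label q = zero, take a chain consisting of
    -- a point c and of a chain with the label one, such that c completes three points of the
    -- q-chain to a dominated 3-cycle.
    module Dominated (m : ℕ) where
      private
        open Placement (placement (R zero (suc zero)) m)

        -- The signs say that the first q-vertex dominates the 3-cycle of the second, the third and
        -- `c`. Three columns are used up for this, and the other `m` columns of the remaining
        -- labels enter the configuration `e'`.
        cType : Type (suc k) (3 ℕ.+ m)
        cType zero zero = true
        cType zero (suc zero) = false
        cType zero (suc (suc _)) = true
        cType (suc ℓ) _ = R (suc (suc ℓ)) zero

        lType : Type (suc k) (3 ℕ.+ m)
        lType ℓ _ = R (skip ℓ) (suc zero)

        τ : Fin (suc m) → Type (suc k) (3 ℕ.+ m)
        τ i = if does (i Fin.≟ pt) then cType else lType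

        ch = Ramsey.chainOver (claims R″ cons″) (suc m) τ

        e = proj₁ ch

        cfg : IsConfig R″ e
        cfg = proj₁ (proj₂ ch)

        w = proj₁ (proj₂ (proj₂ ch))

        ord : ∀ {i j} → i Fin.< j → E T (w i) (w j)
        ord = proj₁ (proj₂ (proj₂ (proj₂ ch)))

        w-type : ∀ i → HasType e (τ i) (w i)
        w-type = proj₂ (proj₂ (proj₂ (proj₂ ch)))

        c-type : HasType e cType (w pt)
        c-type ℓ p = subst (λ b → Arc ((if b then cType else lType) ℓ p) (e ℓ p) (w pt)) (Decₚ.dec-true (pt Fin.≟ pt) refl) (w-type pt ℓ p)

        l-type : ∀ i → HasType e lType (w (emb i))
        l-type i ℓ p = subst (λ b → Arc ((if b then cType else lType) ℓ p) (e ℓ p) (w (emb i)))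
          (Decₚ.dec-false (emb i Fin.≟ pt) (emb-≢ i)) (w-type (emb i) ℓ p)

        e' : Fin (suc k) → Fin m → V T
        e' zero p = w (emb p)
        e' (suc ℓ) p = e (suc ℓ) (3 Fin.↑ʳ p)

        cfg' : IsConfig RH e'
        within cfg' zero lt = ord (emb-< lt)
        within cfg' (suc ℓ) lt = within cfg (suc ℓ) (s≤s (s≤s (s≤s lt)))
        across cfg' {zero} {zero} ne i j = ⊥-elim (ne refl)
        across cfg' {zero} {suc ℓ} ne i j = flip (λ ()) (l-type i (suc ℓ) (3 Fin.↑ʳ j))
        across cfg' {suc ℓ} {zero} ne i j = l-type j (suc ℓ) (3 Fin.↑ʳ i)
        across cfg' {suc ℓ} {suc ℓ'} ne i j = across cfg ne (3 Fin.↑ʳ i) (3 Fin.↑ʳ j)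

        q-type : ∀ p → HasType e' qtype (e zero p)
        q-type p zero i = flip (λ ()) (l-type i zero p)
        q-type p (suc ℓ) i = across cfg {suc ℓ} {zero} (λ ()) (3 Fin.↑ʳ i) p

        c-qtype : HasType e' qtype (w pt)
        c-qtype zero i = flip (λ ()) (side {w} ord i)
        c-qtype (suc ℓ) i = c-type (suc ℓ) (3 Fin.↑ʳ i)

        d : Dom (e zero zero) (e zero (suc zero)) (e zero (suc (suc zero))) (w pt)
        d = dom (within cfg zero (s≤s z≤n)) (within cfg zero (s≤s z≤n)) (c-type zero zero)
          (within cfg zero (s≤s (s≤s z≤n))) (c-type zero (suc (suc zero))) (c-type zero (suc zero))

      abstract
        domOver : ∀ {e} → IsConfig {suc k} {m} RH e → DomIn (typeList e qtype)
        domOver {e₁} c₁ with moveConfig cfg' c₁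
        ... | g , hom , eq = _ , _ , _ , _ , mapDom hom d ,
          sat (q-type zero) , sat (q-type (suc zero)) , sat (q-type (suc (suc zero))) , sat c-qtype
          where
          sat : ∀ {x} → HasType e' qtype x → Sat (typeList e₁ qtype) (g x)
          sat {x} h = sat⁺ {e = e₁} {qtype} {g x} (type-hom {e = e'} {e₁} {qtype} {x} hom eq h)

    -- Chains of length two with the types `s` and `qtype`, in either order, exist over some
    -- configuration. One endomorphism takes this configuration to `e`; another one fixes `e` and
    -- takes the vertex of type `s` to `v`.
    splitsOver : ∀ {m e} → IsConfig {suc k} {m} RH e → ∀ s {v} → HasType e s v → Splits (typeList e qtype) v
    splitsOver {m} {e} c s {v} hv col = finish col
      where
      τ : Bool → Fin 2 → Type (suc k) m
      τ true zero = s
      τ true (suc _) = qtype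
      τ false zero = qtype
      τ false (suc _) = s
      place : ∀ {e''} → IsConfig RH e'' → ∀ {x u} → HasType e'' qtype x → HasType e'' s u → ∀ b → Arc b u x →
        Σ (V T) λ x → Sat (typeList e qtype) x × Arc b v x
      place {e''} c'' {x} {u} hx hu b a =
        h (g x) , sat⁺ {e = e} {qtype} {h (g x)} (type-hom {e = e} {e} {qtype} {g x} hom' (fixes⁻ {g = h} {e} {s} fix)
          (type-hom {e = e''} {e} {qtype} {x} hom eq hx)) ,
        subst (λ t → Arc b t (h (g x))) hgu (arc-hom hom' b (arc-hom hom b a))
        where
        moved = moveConfig c'' c
        g = proj₁ moved
        hom : Endo g
        hom = proj₁ (proj₂ moved)
        eq : ∀ ℓ i → g (e'' ℓ i) ≡ e ℓ i
        eq = proj₂ (proj₂ moved)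
        moved' = move₁ (typeList e s) {g u} {v} (sat⁺ {e = e} {s} {g u} (type-hom {e = e''} {e} {s} {u} hom eq hu)) (sat⁺ {e = e} {s} {v} hv)
        h = proj₁ moved'
        hom' : Endo h
        hom' = proj₁ (proj₂ moved')
        fix : Fixes h (typeList e s)
        fix = proj₁ (proj₂ (proj₂ moved'))
        hgu : h (g u) ≡ v
        hgu = proj₂ (proj₂ (proj₂ moved'))
      finish : ∀ b → Σ (V T) λ x → Sat (typeList e qtype) x × Arc b v x
      finish true with Ramsey.chainOver (claims RH consH) 2 (τ true)
      ... | e'' , c'' , w , ord , wt = place c'' {w (suc zero)} {w zero} (wt (suc zero)) (wt zero) true (ord (s≤s z≤n))
      finish false with Ramsey.chainOver (claims RH consH) 2 (τ false)
      ... | e'' , c'' , w , ord , wt = place c'' {w zero} {w (suc zero)} (wt zero) (wt (suc zero)) false (ord (s≤s z≤n))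

    claim : Claim R
    claim m s with claims RH consH m (λ ℓ → s (suc ℓ))
    ... | e , c , v , hv with chain (Dominated.domOver m c) (splitsOver c (λ ℓ → s (suc ℓ)) {v} hv) m (λ i → not (s zero i))
    ...   | y , ok , ord = e' , cfg' , v , type'
      where
      e' : Fin (suc (suc k)) → Fin m → V T
      e' zero = y
      e' (suc ℓ) = e ℓ
      cfg' : IsConfig R e'
      within cfg' zero lt = ord lt
      within cfg' (suc ℓ) lt = within c ℓ lt
      across cfg' {zero} {zero} ne i j = ⊥-elim (ne refl)
      across cfg' {zero} {suc ℓ} ne i j = flip (λ ()) (sat⁻ {e = e} {qtype} {y i} (proj₁ (ok i)) ℓ j)
      across cfg' {suc ℓ} {zero} ne i j = sat⁻ {e = e} {qtype} {y j} (proj₁ (ok j)) ℓ i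
      across cfg' {suc ℓ} {suc ℓ'} ne i j = across c (λ u → ne (cong suc u)) i j
      type' : HasType e' s v
      type' zero i = arc-unflip (s zero i) (proj₂ (ok i))
      type' (suc ℓ) i = hv ℓ i

  abstract
    claims : ∀ k (R : Labelled (suc k)) → Consistent R → Claim R
    claims zero R _ = claim₁ R
    claims (suc k) R cons = Step.claim (claims k) R cons

  private
    distinct : (F : List (V T)) → Σ (List (V T)) λ F' → AllPairs _≢_ F' × (∀ {f} → f ∈ F → f ∈ F')
    distinct [] = [] , [] , id
    distinct (f ∷ F) with distinct F
    ... | F' , u , sub with em (f ∈ F')
    ...   | yes m = F' , u , λ { (here refl) → m ; (there x) → sub x }
    ...   | no n = f ∷ F' , All.tabulate (λ { m refl → n m }) ∷ u ,
              λ { (here refl) → here refl ; (there x) → there (sub x) }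

    lookup-inj : ∀ {F : List (V T)} → AllPairs _≢_ F → ∀ {i j} → i ≢ j → Data.List.lookup F i ≢ Data.List.lookup F j
    lookup-inj u {i} {j} ne eq with Finₚ.<-cmp i j
    ... | tri< lt _ _ = AllPairs-lookup u lt eq
    ... | tri≈ _ eq′ _ = ne eq′
    ... | tri> _ _ gt = AllPairs-lookup u gt (sym eq)

  -- Without repetitions, a non-empty `F` is a configuration with chains of length one, each vertex
  -- having its own label.
  extension : ∀ (F : List (V T)) (s : V T → Bool) → Σ (V T) λ z → ∀ {f} → f ∈ F → Arc (s f) f z
  extension F s with distinct F
  ... | [] , _ , sub = proj₁ hasDom , λ m → case sub m of λ ()
  ... | F'@(f₀ ∷ F₀) , u , sub = proj₁ r , λ {f} m → hit (sub m)
    where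
    at = Data.List.lookup F'
    R : Labelled (length F')
    R i j = does (em (E T (at i) (at j)))
    R-arc : ∀ {i j} → i ≢ j → Arc (R i j) (at i) (at j)
    R-arc {i} {j} ne with em (E T (at i) (at j))
    ... | yes e = e
    ... | no n = [ (λ e → ⊥-elim (n e)) , id ]′ (adj (lookup-inj u ne))
    cons : Consistent R
    cons i j ne with em (E T (at i) (at j)) | em (E T (at j) (at i))
    ... | yes e | yes e' = ⊥-elim (or e e')
    ... | yes _ | no _ = refl
    ... | no _ | yes _ = refl
    ... | no n | no n' = ⊥-elim ([ n , n' ]′ (adj (lookup-inj u ne)))
    r = realise (claims _ R cons) {1} {λ i _ → at i}
      (record { within = λ { _ {zero} {zero} () } ; across = λ ne _ _ → R-arc ne }) (λ i _ → s (at i))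
    hit : ∀ {f} → f ∈ F' → Arc (s f) f (proj₁ r)
    hit {f} m = subst (λ u → Arc (s u) u (proj₁ r)) (sym (Anyₚ.lookup-index m)) (proj₂ r (Any.index m) zero)

-- Homogeneity and universality from one-point extensions

Extension : Digraph → Set
Extension T = ∀ (F : List (V T)) (s : V T → Bool) → Σ (V T) λ z →
  ∀ {f} → f ∈ F → (s f ≡ true → E T f z) × (s f ≡ false → E T z f)

module _ (em : EM) where

  abstract
    dom⇒extension : ∀ T (tour : IsTournament T) (hh : HomHomogeneous T) →
      HomTournament.HasDom em T tour hh → Extension T
    dom⇒extension T tour hh hd F s with Universal.extension em T tour hh hd F s
    ... | z , h = z , λ {f} m → split f (h m)
      where
      open Universal em T tour hh hd
      split : ∀ f → Arc (s f) f z → (s f ≡ true → E T f z) × (s f ≡ false → E T z f)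
      split f a with s f
      ... | true = (λ _ → a) , λ ()
      ... | false = (λ ()) , λ _ → a

    extension-op : ∀ {T} → Extension (op T) → Extension T
    extension-op ext F s with ext F (not ∘ s)
    ... | z , h = z , λ {f} m → (λ eq → proj₂ (h m) (cong not eq)) , λ eq → proj₁ (h m) (cong not eq)

  module _ {T : Digraph} (tour : IsTournament T) (cT : Countable (V T)) (ext : Extension T) where
    private
      or : IsOriented T
      or = proj₁ tour

      does-true : ∀ {P : Set} → P → does (em P) ≡ true
      does-true p = Decₚ.dec-true (em _) p

      does-false : ∀ {P : Set} → ¬ P → does (em P) ≡ false
      does-false p = Decₚ.dec-false (em _) p

      new : ∀ {z} {s : V T → Bool} f → (s f ≡ true → E T f z) × (s f ≡ false → E T z f) → f ≢ z
      new {z} {s} .z (p , q) refl with s z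
      ... | true = or (p refl) (p refl)
      ... | false = or (q refl) (q refl)

      iffs : ∀ {x y x' y'} → E T x y → E T x' y' → (E T x y ⇔ E T x' y') × (E T y x ⇔ E T y' x')
      iffs e e' = ((λ _ → e') , λ _ → e) , (λ f → ⊥-elim (or e f)) , λ f → ⊥-elim (or e' f)

      forth : ∀ {L} → PartialIso em T T L → ∀ a → (∀ b → (a , b) ∉ L) →
        Σ (V T) λ b → (∀ a → (a , b) ∉ L) ×
        ∀ {a' b'} → (a' , b') ∈ L → (E T a' a ⇔ E T b' b) × (E T a a' ⇔ E T b b')
      forth {L} ok a na = z , (λ a' m → new {s = s} z (h (∈ₚ.∈-map⁺ proj₂ m)) refl) , rel
        where
        Below : V T → Set
        Below b = Σ (V T) λ a' → (a' , b) ∈ L × E T a' a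
        s : V T → Bool
        s b = does (em (Below b))
        ex = ext (map proj₂ L) s
        z = proj₁ ex
        h : ∀ {f} → f ∈ map proj₂ L → (s f ≡ true → E T f z) × (s f ≡ false → E T z f)
        h = proj₂ ex
        rel : ∀ {a' b'} → (a' , b') ∈ L → (E T a' a ⇔ E T b' z) × (E T a a' ⇔ E T z b')
        rel {a'} {b'} m with em (E T a' a)
        ... | yes e = iffs e (proj₁ (h (∈ₚ.∈-map⁺ proj₂ m)) (does-true {Below b'} (a' , m , e)))
        ... | no ¬e = proj₂ sw , proj₁ sw
          where
          aa' : E T a a'
          aa' with proj₂ tour a' a (λ { refl → na b' m })
          ... | inj₁ e = ⊥-elim (¬e e)
          ... | inj₂ e = e
          none : ¬ Below b'
          none (a'' , m' , e) = ¬e (subst (λ u → E T u a) (proj₂ (proj₂ (ok m' m)) refl) e)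
          sw = iffs aa' (proj₂ (h (∈ₚ.∈-map⁺ proj₂ m)) (does-false {Below b'} none))

      embed : ∀ n (R : Fin n → Fin n → Set) → FinTournament n R → Embeds n R T
      embed zero R _ = (λ ()) , (λ ()) , λ ()
      embed (suc n) R (as , tot) with embed n (λ i j → R (suc i) (suc j))
        (as , λ i j ne → tot (suc i) (suc j) (λ u → ne (Finₚ.suc-injective u)))
      ... | e , inj , iff = e' , inj' , iff'
        where
        Below : V T → Set
        Below x = Σ (Fin n) λ i → e i ≡ x × R (suc i) zero
        s : V T → Bool
        s x = does (em (Below x))
        ex = ext (map e (allFin n)) s
        z = proj₁ ex
        h : ∀ i → (s (e i) ≡ true → E T (e i) z) × (s (e i) ≡ false → E T z (e i))
        h i = proj₂ ex (∈ₚ.∈-map⁺ e (∈ₚ.∈-allFin i))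
        e' : Fin (suc n) → V T
        e' zero = z
        e' (suc i) = e i
        inj' : ∀ i j → e' i ≡ e' j → i ≡ j
        inj' zero zero _ = refl
        inj' zero (suc j) eq = ⊥-elim (new {s = s} (e j) (h j) (sym eq))
        inj' (suc i) zero eq = ⊥-elim (new {s = s} (e i) (h i) eq)
        inj' (suc i) (suc j) eq = cong suc (inj i j eq)
        ups : ∀ i → R (suc i) zero → E T (e i) z
        ups i r = proj₁ (h i) (does-true {Below (e i)} (i , refl , r))
        downs : ∀ i → R zero (suc i) → E T z (e i)
        downs i r = proj₂ (h i) (does-false {Below (e i)} λ { (j , eq , r') → as r (subst (λ u → R (suc u) zero) (inj j i eq) r') })
        iff' : ∀ i j → R i j ⇔ E T (e' i) (e' j)
        iff' zero zero = (λ r → ⊥-elim (as r r)) , λ d → ⊥-elim (or d d)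
        iff' (suc i) zero = ups i , λ d → case tot (suc i) zero (λ ()) of λ
          { (inj₁ r) → r ; (inj₂ r) → ⊥-elim (or d (downs i r)) }
        iff' zero (suc i) = downs i , λ d → case tot zero (suc i) (λ ()) of λ
          { (inj₁ r) → r ; (inj₂ r) → ⊥-elim (or d (ups i r)) }
        iff' (suc i) (suc j) = iff i j

    abstract
      extension⇒universal : IsUniversalHomogeneousTournament T
      extension⇒universal = cT , homogeneous-by-forth em T cT or forth , tour , embed

-- Circular tournaments

-- Equality of colours: an arc is reversed when exactly one of its ends is replaced by its antipode.
agree : Bool → Bool → Bool
agree true b = b
agree false b = not b

DirArc : (T : Digraph) → Bool → V T → V T → Set
DirArc T true x y = E T x y
DirArc T false x y = E T y x

module Colours (T : Digraph) (o : V T) where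

  DArc : Bool → V T → V T → Set
  DArc = DirArc T

  -- The points x → o are replaced by their (virtual) antipodes, so that all points lie in the
  -- half circle following o; the order on this half circle is _⊰_.
  record _⊰_ (x y : V T) : Set where
    constructor mk⊰
    field
      bx by : Bool
      colx : DArc bx o x
      coly : DArc by o y
      arc : DArc (agree bx by) x y

-- The fields make `_⊰_` a dense linear order without end points in which both colours are dense, a
-- structure that Cantor's argument determines up to isomorphism.
record Circular (T : Digraph) : Set where
  field
    tour : IsTournament T
    o : V T
  open Colours T o public
  field
    ⊰-trans : ∀ {x y z} → x ⊰ y → y ⊰ z → x ⊰ z
    between : ∀ {x y} → x ⊰ y → ∀ c → Σ (V T) λ z → DArc c o z × x ⊰ z × z ⊰ y
    over : ∀ {x} → x ≢ o → ∀ c → Σ (V T) λ z → DArc c o z × x ⊰ z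
    under : ∀ {x} → x ≢ o → ∀ c → Σ (V T) λ z → DArc c o z × z ⊰ x
    inhabited : ∀ c → Σ (V T) λ z → DArc c o z

  or : IsOriented T
  or = proj₁ tour

  excl : ∀ b b' {x} → DArc b o x → DArc b' o x → b ≡ b'
  excl true true _ _ = refl
  excl false false _ _ = refl
  excl true false e f = ⊥-elim (or e f)
  excl false true e f = ⊥-elim (or e f)

  darc-≢ : ∀ b {x y} → DArc b x y → x ≢ y
  darc-≢ true e refl = or e e
  darc-≢ false e refl = or e e

  colour : ∀ {x} → x ≢ o → Σ Bool λ b → DArc b o x
  colour {x} ne = [ (λ e → true , e) , (λ e → false , e) ]′ (proj₂ tour o x (λ u → ne (sym u)))

  ⊰-arc : ∀ {x y} b c → x ⊰ y → DArc b o x → DArc c o y → DArc (agree b c) x y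
  ⊰-arc b c (mk⊰ bx by cx cy a) cb cc = subst₂ (λ b c → DArc (agree b c) _ _) (excl bx b cx cb) (excl by c cy cc) a

  ⊰-total : ∀ {x y} → x ≢ o → y ≢ o → x ≢ y → x ⊰ y ⊎ y ⊰ x
  ⊰-total {x} {y} nx ny ne with colour nx | colour ny
  ... | true , p | true , q = [ (λ e → inj₁ (mk⊰ true true p q e)) , (λ e → inj₂ (mk⊰ true true q p e)) ]′ (proj₂ tour x y ne)
  ... | true , p | false , q = [ (λ e → inj₂ (mk⊰ false true q p e)) , (λ e → inj₁ (mk⊰ true false p q e)) ]′ (proj₂ tour x y ne)
  ... | false , p | true , q = [ (λ e → inj₂ (mk⊰ true false q p e)) , (λ e → inj₁ (mk⊰ false true p q e)) ]′ (proj₂ tour x y ne)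
  ... | false , p | false , q = [ (λ e → inj₁ (mk⊰ false false p q e)) , (λ e → inj₂ (mk⊰ false false q p e)) ]′ (proj₂ tour x y ne)

  left≢o : ∀ {x y} → x ⊰ y → x ≢ o
  left≢o (mk⊰ bx _ cx _ _) u = darc-≢ bx cx (sym u)

  right≢o : ∀ {x y} → x ⊰ y → y ≢ o
  right≢o (mk⊰ _ by _ cy _) u = darc-≢ by cy (sym u)

module _ (em : EM) {T : Digraph} (C : Circular T) where
  open Circular C

  private
    greatest : ∀ x xs → (∀ {y} → y ∈ x ∷ xs → y ≢ o) → Σ (V T) λ m → m ∈ x ∷ xs × (∀ {y} → y ∈ x ∷ xs → y ≡ m ⊎ y ⊰ m)
    greatest x [] _ = x , here refl , λ { (here refl) → inj₁ refl }
    greatest x (x' ∷ xs) ne with greatest x' xs (λ m → ne (there m))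
    ... | m , m∈ , max with em (x ≡ m)
    ...   | yes refl = m , here refl , λ { (here refl) → inj₁ refl ; (there k) → max k }
    ...   | no x≢m with ⊰-total (ne (here refl)) (ne (there m∈)) x≢m
    ...     | inj₁ lt = m , there m∈ , λ { (here refl) → inj₂ lt ; (there k) → max k }
    ...     | inj₂ gt = x , here refl , λ { (here refl) → inj₁ refl
                                          ; (there k) → inj₂ ([ (λ { refl → gt }) , (λ l → ⊰-trans l gt) ]′ (max k)) }

    smallest : ∀ x xs → (∀ {y} → y ∈ x ∷ xs → y ≢ o) → Σ (V T) λ m → m ∈ x ∷ xs × (∀ {y} → y ∈ x ∷ xs → y ≡ m ⊎ m ⊰ y)
    smallest x [] _ = x , here refl , λ { (here refl) → inj₁ refl }
    smallest x (x' ∷ xs) ne with smallest x' xs (λ m → ne (there m))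
    ... | m , m∈ , min with em (x ≡ m)
    ...   | yes refl = m , here refl , λ { (here refl) → inj₁ refl ; (there k) → min k }
    ...   | no x≢m with ⊰-total (ne (here refl)) (ne (there m∈)) x≢m
    ...     | inj₂ lt = m , there m∈ , λ { (here refl) → inj₂ lt ; (there k) → min k }
    ...     | inj₁ gt = x , here refl , λ { (here refl) → inj₁ refl
                                          ; (there k) → inj₂ ([ (λ { refl → gt }) , (λ l → ⊰-trans gt l) ]′ (min k)) }

  gap : ∀ Lo Hi → (∀ {y} → y ∈ Lo → y ≢ o) → (∀ {y} → y ∈ Hi → y ≢ o) →
    (∀ {x y} → x ∈ Lo → y ∈ Hi → x ⊰ y) → ∀ c →
    Σ (V T) λ z → DArc c o z × (∀ {x} → x ∈ Lo → x ⊰ z) × (∀ {y} → y ∈ Hi → z ⊰ y)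
  gap [] [] _ _ _ c with inhabited c
  ... | z , cz = z , cz , (λ ()) , λ ()
  gap (x ∷ xs) [] nl _ _ c with greatest x xs nl
  ... | m , m∈ , max with over (nl m∈) c
  ...   | z , cz , lt = z , cz , (λ k → [ (λ { refl → lt }) , (λ l → ⊰-trans l lt) ]′ (max k)) , λ ()
  gap [] (y ∷ ys) _ nh _ c with smallest y ys nh
  ... | m , m∈ , min with under (nh m∈) c
  ...   | z , cz , lt = z , cz , (λ ()) , λ k → [ (λ { refl → lt }) , (λ l → ⊰-trans lt l) ]′ (min k)
  gap (x ∷ xs) (y ∷ ys) nl nh lt c with greatest x xs nl | smallest y ys nh
  ... | m , m∈ , max | n , n∈ , min with between (lt m∈ n∈) c
  ...   | z , cz , l , r = z , cz , (λ k → [ (λ { refl → l }) , (λ p → ⊰-trans p l) ]′ (max k)) ,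
          λ k → [ (λ { refl → r }) , (λ p → ⊰-trans r p) ]′ (min k)

module _ (em : EM) where

  private
    module Forth {T T' : Digraph} (C : Circular T) (C' : Circular T') where
      open Circular C
      private module C' = Circular C'

      arcs-iff : ∀ b {x y x' y'} → DArc b x y → C'.DArc b x' y' → (E T x y ⇔ E T' x' y') × (E T y x ⇔ E T' y' x')
      arcs-iff true e e' = ((λ _ → e') , λ _ → e) , (λ f → ⊥-elim (or e f)) , λ f → ⊥-elim (C'.or e' f)
      arcs-iff false e e' = ((λ f → ⊥-elim (or e f)) , λ f → ⊥-elim (C'.or e' f)) , (λ _ → e') , λ _ → e

      module _ {L : List (V T × V T')} (ok : PartialIso em T T' L) where
        image : ∀ b {x y x' y'} → (x , x') ∈ L → (y , y') ∈ L → DArc b x y → C'.DArc b x' y'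
        image true m m' e = proj₁ (proj₁ (ok m m')) e
        image false m m' e = proj₁ (proj₁ (ok m' m)) e

        image-⊰ : (o , C'.o) ∈ L → ∀ {x y x' y'} → (x , x') ∈ L → (y , y') ∈ L → x ⊰ y → x' C'.⊰ y'
        image-⊰ mo m m' (mk⊰ bx by cx cy a) = C'.mk⊰ bx by (image bx mo m cx) (image by mo m' cy) (image (agree bx by) m m' a)

        forth : (o , C'.o) ∈ L → ∀ a → (∀ b → (a , b) ∉ L) →
          Σ (V T') λ b → (∀ a → (a , b) ∉ L) ×
          ∀ {a' b'} → (a' , b') ∈ L → (E T a' a ⇔ E T' b' b) × (E T a a' ⇔ E T' b b')
        forth mo a na with colour {a} (λ { refl → na _ mo })
        ... | c , ca with gap em C' (map proj₂ (pick em (λ p → proj₁ p ⊰ a) L)) (map proj₂ (pick em (λ p → a ⊰ proj₁ p) L)) lo≢ hi≢ mid c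
          where
          lo≢ : ∀ {y} → y ∈ map proj₂ (pick em (λ p → proj₁ p ⊰ a) L) → y ≢ C'.o
          lo≢ m with pickMap⁻ proj₂ em _ L m
          ... | p , p∈ , lt , refl = λ eq → left≢o lt (proj₂ (proj₂ (ok p∈ mo)) eq)
          hi≢ : ∀ {y} → y ∈ map proj₂ (pick em (λ p → a ⊰ proj₁ p) L) → y ≢ C'.o
          hi≢ m with pickMap⁻ proj₂ em _ L m
          ... | p , p∈ , lt , refl = λ eq → right≢o lt (proj₂ (proj₂ (ok p∈ mo)) eq)
          mid : ∀ {x y} → x ∈ map proj₂ (pick em (λ p → proj₁ p ⊰ a) L) → y ∈ map proj₂ (pick em (λ p → a ⊰ proj₁ p) L) → x C'.⊰ y
          mid m m' with pickMap⁻ proj₂ em _ L m | pickMap⁻ proj₂ em _ L m'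
          ... | p , p∈ , lt , refl | q , q∈ , lt' , refl = image-⊰ mo p∈ q∈ (⊰-trans lt lt')
        ...   | z , cz , lo , hi = z , (λ a' m → case rel m of λ { (b , _ , e) → C'.darc-≢ b e refl }) ,
                  λ m → case rel m of λ { (b , e , e') → arcs-iff b e e' }
          where
          -- The arc with the base point is the colour; every other arc is determined by the colours
          -- of its ends and their order.
          rel : ∀ {a' b'} → (a' , b') ∈ L → Σ Bool λ b → DArc b a' a × C'.DArc b b' z
          rel {a'} {b'} m with em (a' ≡ o)
          ... | yes refl = c , ca , subst (λ u → C'.DArc c u z) (proj₁ (proj₂ (ok mo m)) refl) cz
          ... | no ne with colour ne | ⊰-total ne (λ { refl → na _ mo }) (λ { refl → na _ m })
          ...   | b , cb | inj₁ lt = agree b c , ⊰-arc b c lt cb ca ,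
                    C'.⊰-arc b c (lo (pickMap⁺ proj₂ em (λ p → proj₁ p ⊰ a) m lt)) (image b mo m cb) cz
          ...   | b , cb | inj₂ gt = not (agree c b) , rev (agree c b) (⊰-arc c b gt ca cb) ,
                    rev' (agree c b) (C'.⊰-arc c b (hi (pickMap⁺ proj₂ em (λ p → a ⊰ proj₁ p) m gt)) cz (image b mo m cb))
            where
            rev : ∀ b {x y} → DArc b x y → DArc (not b) y x
            rev true e = e
            rev false e = e
            rev' : ∀ b {x y} → C'.DArc b x y → C'.DArc (not b) y x
            rev' true e = e
            rev' false e = e

  abstract
    circular-unique : ∀ {T T'} → Countable (V T) → Countable (V T') → Circular T → Circular T' → T ≅ T'
    circular-unique {T} {T'} cT cT' C C' = IsoBackForth.isoPQ em {T} {T'} cT cT' (Circular.or C) (Circular.or C')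
      (λ L → (Circular.o C , Circular.o C') ∈ L) (λ _ → there)
      (λ ok mo → Forth.forth C C' ok mo) back
      {(Circular.o C , Circular.o C') ∷ []}
      (λ { (here refl) (here refl) → ((λ e → ⊥-elim (Circular.or C e e)) , λ e → ⊥-elim (Circular.or C' e e)) ,
                                     (λ _ → refl) , λ _ → refl })
      (here refl)
      where
      back : ∀ {L} → PartialIso em T T' L → (Circular.o C , Circular.o C') ∈ L → ∀ b → (∀ a → (a , b) ∉ L) →
        Σ (V T) λ a → (∀ b → (a , b) ∉ L) ×
        ∀ {a' b'} → (a' , b') ∈ L → (E T a' a ⇔ E T' b' b) × (E T a a' ⇔ E T' b b')
      back {L} ok mo b n with Forth.forth C' C (partialIso-swap em {T} {T'} ok) (∈ₚ.∈-map⁺ _ mo) b (λ a m → n a (swap-∈ m))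
      ... | a , na , r = a , (λ b m → na b (∈ₚ.∈-map⁺ _ m)) , λ m →
            (proj₂ (proj₁ (r (∈ₚ.∈-map⁺ _ m))) , proj₁ (proj₁ (r (∈ₚ.∈-map⁺ _ m)))) ,
            (proj₂ (proj₂ (r (∈ₚ.∈-map⁺ _ m))) , proj₁ (proj₂ (r (∈ₚ.∈-map⁺ _ m))))

-- Tournaments whose 3-cycles have no common in- or out-neighbour

module LocallyTransitive (em : EM) (T : Digraph) (tour : IsTournament T) (hh : HomHomogeneous T)
  (noDom : ∀ {p a b c} → E T p a → E T p b → E T p c → ¬ Cyc T a b c)
  (noCod : ∀ {p a b c} → E T a p → E T b p → E T c p → ¬ Cyc T a b c)
  (someCycle : Σ (V T) λ a → Σ (V T) λ b → Σ (V T) λ c → Cyc T a b c)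
  {s t u : V T} (st : E T s t) (tu : E T t u) (su : E T s u) where
  open HomTournament em T tour hh
  open Colours T s

  private
    o = s

    excl : ∀ b b' {x y} → DArc b x y → DArc b' x y → b ≡ b'
    excl true true _ _ = refl
    excl false false _ _ = refl
    excl true false e f = ⊥-elim (or e f)
    excl false true e f = ⊥-elim (or e f)

    total : ∀ b {x y} → x ≢ y → DArc b x y ⊎ DArc (not b) x y
    total true n = adj n
    total false n = [ inj₂ , inj₁ ]′ (adj n)

    pair : ∀ b {x x' y y'} → DArc b x x' → DArc b y y' → HomPair T (x , y) (x' , y')
    pair true = fwd
    pair false = bwd

    darc-hom : ∀ {g} → Endo g → ∀ b {x y} → DArc b x y → DArc b (g x) (g y)
    darc-hom hom true = hom
    darc-hom hom false = hom

    -- A cyclic triple of `_⊰_` shows up among `o, x, y, z` as a 3-cycle with a common in- or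
    -- out-neighbour; the colours decide which of the four vertices is the apex.
    noTurn : ∀ bx by bz {x y z} → DArc bx o x → DArc by o y → DArc bz o z →
      DArc (agree bx by) x y → DArc (agree by bz) y z → ¬ DArc (not (agree bx bz)) x z
    noTurn true true true ox oy oz xy yz zx = noDom ox oy oz (xy , yz , zx)
    noTurn false false false xo yo zo xy yz zx = noCod xo yo zo (xy , yz , zx)
    noTurn true true false ox oy zo xy zy xz = noCod xy zy oy (xz , zo , ox)
    noTurn true false true ox yo oz yx zy zx = noCod yx ox zx (yo , oz , zy)
    noTurn true false false ox yo zo yx yz xz = noDom yo yx yz (ox , xz , zo)
    noTurn false true true xo oy oz yx yz xz = noCod oz yz xz (oy , yx , xo)
    noTurn false true false xo oy zo yx zy zx = noDom zo zy zx (oy , yx , xo)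
    noTurn false false true xo yo oz xy zy xz = noDom xo xz xy (oz , zy , yo)

    agree-sym : ∀ b c → agree b c ≡ agree c b
    agree-sym true true = refl
    agree-sym true false = refl
    agree-sym false true = refl
    agree-sym false false = refl

    rev-excl : ∀ b {x y} → DArc b x y → ¬ DArc b y x
    rev-excl true = or
    rev-excl false = or

    trans⊰ : ∀ {x y z} → x ⊰ y → y ⊰ z → x ⊰ z
    trans⊰ {x} {y} {z} (mk⊰ bx by cx cy xy) (mk⊰ by' bz cy' cz yz) with excl by by' cy cy'
    ... | refl with total (agree bx bz) x≢z
      where
      x≢z : x ≢ z
      x≢z refl with excl bx bz cx cz
      ... | refl = rev-excl (agree bx by) xy (subst (λ b → DArc b y x) (agree-sym by bx) yz)
    ...   | inj₁ a = mk⊰ bx bz cx cz a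
    ...   | inj₂ a = ⊥-elim (noTurn bx by bz cx cy cz xy yz a)

    -- Of the four tournaments on four vertices, two are a 3-cycle with a common in- or
    -- out-neighbour. The transitive one and the strong one remain.
    record Chain₄ : Set where
      constructor chain₄
      field
        {c₀ c₁ c₂ c₃} : V T
        e₀₁ : E T c₀ c₁
        e₀₂ : E T c₀ c₂
        e₀₃ : E T c₀ c₃
        e₁₂ : E T c₁ c₂
        e₁₃ : E T c₁ c₃
        e₂₃ : E T c₂ c₃

    record Strong₄ : Set where
      constructor strong₄
      field
        {h₀ h₁ h₂ h₃} : V T
        e₀₁ : E T h₀ h₁
        e₁₂ : E T h₁ h₂
        e₂₃ : E T h₂ h₃
        e₃₀ : E T h₃ h₀
        e₀₂ : E T h₀ h₂
        e₁₃ : E T h₁ h₃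

    abstract
      someChain : Chain₄
      someChain with extend {L = (s , s) ∷ (t , u) ∷ []} ((fwd st su ∷ []) ∷ [] ∷ [])
      ... | g , hom , gs ∷ gt ∷ [] = chain₄ st su sw tu tw uw
        where
        sw : E T s (g u)
        sw = subst (λ v → E T v (g u)) gs (hom su)
        uw : E T u (g u)
        uw = subst (λ v → E T v (g u)) gt (hom tu)
        tw : E T t (g u)
        tw with adj {t} {g u} (λ eq → or tu (subst (E T u) (sym eq) uw))
        ... | inj₁ e = e
        ... | inj₂ e = ⊥-elim (noDom st su sw (tu , uw , e))

      -- Complete `s → u` to a 3-cycle by a vertex `w`. Whichever way the arc between `t` and `w`
      -- points, the four vertices form a strong tournament.
      someStrong : Strong₄
      someStrong = build someCycle
        where
        build : (Σ (V T) λ a → Σ (V T) λ b → Σ (V T) λ c → Cyc T a b c) → Strong₄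
        build (a , b , c , ab , bc , ca) with extend ((fwd ab su ∷ []) ∷ [] ∷ [])
        ... | g , hom , refl ∷ refl ∷ [] with adj {t} {g c} (λ { refl → or st (hom ca) })
        ...   | inj₁ tw = strong₄ st tu (hom bc) (hom ca) su tw
        ...   | inj₂ wt = strong₄ (hom ca) st tu (hom bc) wt su

    record Config (b b' c : Bool) : Set where
      constructor config
      field
        {O X Y Z} : V T
        ox : DArc b O X
        oy : DArc b' O Y
        oz : DArc c O Z
        xy : DArc (agree b b') X Y
        xz : DArc (agree b c) X Z
        zy : DArc (agree c b') Z Y

    -- Each of the eight configurations is a chain or a strong tournament with four vertices.
    abstract
      configs : ∀ b b' c → Config b b' c
      configs true true true = let chain₄ e₀₁ e₀₂ e₀₃ e₁₂ e₁₃ e₂₃ = someChain in config e₀₁ e₀₃ e₀₂ e₁₃ e₁₂ e₂₃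
      configs true false true = let chain₄ e₀₁ e₀₂ e₀₃ e₁₂ e₁₃ e₂₃ = someChain in config e₁₂ e₀₁ e₁₃ e₀₂ e₂₃ e₀₃
      configs true true false = let strong₄ e₀₁ e₁₂ e₂₃ e₃₀ e₀₂ e₁₃ = someStrong in config e₁₂ e₁₃ e₀₁ e₂₃ e₀₂ e₃₀
      configs true false false = let chain₄ e₀₁ e₀₂ e₀₃ e₁₂ e₁₃ e₂₃ = someChain in config e₂₃ e₁₂ e₀₂ e₁₃ e₀₃ e₀₁
      configs false true true = let strong₄ e₀₁ e₁₂ e₂₃ e₃₀ e₀₂ e₁₃ = someStrong in config e₃₀ e₀₂ e₀₁ e₂₃ e₁₃ e₁₂
      configs false false true = let strong₄ e₀₁ e₁₂ e₂₃ e₃₀ e₀₂ e₁₃ = someStrong in config e₀₂ e₁₂ e₂₃ e₀₁ e₃₀ e₁₃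
      configs false true false = let strong₄ e₀₁ e₁₂ e₂₃ e₃₀ e₀₂ e₁₃ = someStrong in config e₁₃ e₃₀ e₂₃ e₀₁ e₁₂ e₀₂
      configs false false false = let chain₄ e₀₁ e₀₂ e₀₃ e₁₂ e₁₃ e₂₃ = someChain in config e₀₃ e₂₃ e₁₃ e₀₂ e₀₁ e₁₂

      colour : ∀ {x} → x ≢ o → Σ Bool λ b → DArc b o x
      colour ne = [ (λ e → true , e) , (λ e → false , e) ]′ (adj (λ u → ne (sym u)))

      between : ∀ {x y} → x ⊰ y → ∀ c → Σ (V T) λ z → DArc c o z × x ⊰ z × z ⊰ y
      between {x} {y} (mk⊰ b b' cx cy a) c with configs b b' c
      ... | config {O} {X} {Y} {Z} ox oy oz xy xz zy
        with extend {L = (O , o) ∷ (X , x) ∷ (Y , y) ∷ []}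
               ((pair b ox cx ∷ pair b' oy cy ∷ []) ∷ (pair (agree b b') xy a ∷ []) ∷ [] ∷ [])
      ...   | g , hom , go ∷ refl ∷ refl ∷ [] = g Z , cz , mk⊰ b c cx cz (darc-hom hom (agree b c) xz) , mk⊰ c b' cz cy (darc-hom hom (agree c b') zy)
        where
        cz : DArc c o (g Z)
        cz = subst (λ v → DArc c v (g Z)) go (darc-hom hom c oz)

      over : ∀ {x} → x ≢ o → ∀ c → Σ (V T) λ z → DArc c o z × x ⊰ z
      over {x} ne c with colour ne
      ... | b , cx with configs b c true
      ...   | config {O} {X} {Y} {Z} ox oy oz xy xz zy
        with extend {L = (O , o) ∷ (X , x) ∷ []} ((pair b ox cx ∷ []) ∷ [] ∷ [])
      ...     | g , hom , go ∷ refl ∷ [] = g Y , cy , mk⊰ b c cx cy (darc-hom hom (agree b c) xy)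
        where
        cy : DArc c o (g Y)
        cy = subst (λ v → DArc c v (g Y)) go (darc-hom hom c oy)

      under : ∀ {x} → x ≢ o → ∀ c → Σ (V T) λ z → DArc c o z × z ⊰ x
      under {x} ne c with colour ne
      ... | b , cx with configs c b true
      ...   | config {O} {X} {Y} {Z} ox oy oz xy xz zy
        with extend {L = (O , o) ∷ (Y , x) ∷ []} ((pair b oy cx ∷ []) ∷ [] ∷ [])
      ...     | g , hom , go ∷ refl ∷ [] = g X , cx' , mk⊰ c b cx' cx (darc-hom hom (agree c b) xy)
        where
        cx' : DArc c o (g X)
        cx' = subst (λ v → DArc c v (g X)) go (darc-hom hom c ox)

      inhabited : ∀ c → Σ (V T) λ z → DArc c o z
      inhabited c with configs c c c
      ... | config {O} {X} ox _ _ _ _ _ with extend {L = (O , o) ∷ []} ([] ∷ [])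
      ...   | g , hom , go ∷ [] = g X , subst (λ v → DArc c v (g X)) go (darc-hom hom c ox)

  abstract
    circular : Circular T
    circular = record
      { tour = tour ; o = o ; ⊰-trans = trans⊰ ; between = between ; over = over ; under = under
      ; inhabited = inhabited }

-- Rational points of odd denominator

Odd : ℕ → Set
Odd n = n % 2 ≡ 1

odd-or-even : ∀ n → Odd n ⊎ n % 2 ≡ 0
odd-or-even n with n % 2 | m%n<n n 2
... | zero | _ = inj₂ refl
... | suc zero | _ = inj₁ refl
... | suc (suc _) | s≤s (s≤s ())

odd-factor : ∀ m n → Odd (m ℕ.* n) → Odd m
odd-factor m n odd with odd-or-even m
... | inj₁ o = o
... | inj₂ e = case trans (sym odd) (n∣m⇒m%n≡0 (m ℕ.* n) 2 (∣m⇒∣m*n n (m%n≡0⇒n∣m m 2 e))) of λ ()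

odd-product : ∀ m n k → Odd m → Odd n → m ℕ.* n ≢ 2 ℕ.* k
odd-product m n k om on eq with euclidsLemma m n prime[2] (divides k (trans eq (ℕₚ.*-comm 2 k)))
... | inj₁ d = case trans (sym om) (n∣m⇒m%n≡0 m 2 d) of λ ()
... | inj₂ d = case trans (sym on) (n∣m⇒m%n≡0 n 2 d) of λ ()

-- For u = a/b < w = c/d take N = 1 + 2bd: the interval between aN/b and cN/d has length
-- greater than 2, so that p = ⌊aN/b⌋ + 1 lies in it.
odd-between-ℕ : ∀ a b-1 c d-1 → a ℕ.* suc d-1 ℕ.< c ℕ.* suc b-1 →
  let b = suc b-1 ; d = suc d-1 ; N = suc ((b ℕ.* d) ℕ.* 2) in
  Σ ℕ λ p → a ℕ.* N ℕ.< p ℕ.* b × p ℕ.* d ℕ.< c ℕ.* N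
odd-between-ℕ a b-1 c d-1 lt = suc q , above-a , ℕₚ.*-cancelʳ-< b (suc q ℕ.* d) (c ℕ.* N) below-c
  where
  open ℕₚ.≤-Reasoning
  b = suc b-1
  d = suc d-1
  N = suc ((b ℕ.* d) ℕ.* 2)
  q = (a ℕ.* N) / b
  above-a : a ℕ.* N ℕ.< suc q ℕ.* b
  above-a = begin-strict
    a ℕ.* N                        ≡⟨ m≡m%n+[m/n]*n (a ℕ.* N) b ⟩
    (a ℕ.* N) % b ℕ.+ q ℕ.* b     <⟨ ℕₚ.+-monoˡ-< (q ℕ.* b) (m%n<n (a ℕ.* N) b) ⟩
    suc q ℕ.* b                    ∎
  below-c : suc q ℕ.* d ℕ.* b ℕ.< c ℕ.* N ℕ.* b
  below-c = begin-strict
    suc q ℕ.* d ℕ.* b                     ≡⟨ eq₁ q d b ⟩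
    d ℕ.* (q ℕ.* b) ℕ.+ b ℕ.* d           ≤⟨ ℕₚ.+-monoˡ-≤ (b ℕ.* d) (ℕₚ.*-monoʳ-≤ d (m/n*n≤m (a ℕ.* N) b)) ⟩
    d ℕ.* (a ℕ.* N) ℕ.+ b ℕ.* d           <⟨ ℕₚ.+-monoʳ-< (d ℕ.* (a ℕ.* N)) (s≤s (ℕₚ.m≤m*n (b ℕ.* d) 2)) ⟩
    d ℕ.* (a ℕ.* N) ℕ.+ N                 ≡⟨ eq₂ d a N ⟩
    suc (a ℕ.* d) ℕ.* N                   ≤⟨ ℕₚ.*-monoˡ-≤ N lt ⟩
    c ℕ.* b ℕ.* N                         ≡⟨ eq₃ c b N ⟩
    c ℕ.* N ℕ.* b                         ∎
    where
    eq₁ : ∀ q d b → suc q ℕ.* d ℕ.* b ≡ d ℕ.* (q ℕ.* b) ℕ.+ b ℕ.* d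
    eq₁ = ℕ-Solver.solve-∀
    eq₂ : ∀ d a N → d ℕ.* (a ℕ.* N) ℕ.+ N ≡ suc (a ℕ.* d) ℕ.* N
    eq₂ = ℕ-Solver.solve-∀
    eq₃ : ∀ c b N → c ℕ.* b ℕ.* N ≡ c ℕ.* N ℕ.* b
    eq₃ = ℕ-Solver.solve-∀

-- Reduction divides the denominator by a gcd, and a divisor of an odd number is odd.
odd-denominator : ∀ p M → Odd (suc M) → Odd (ℚ.denominatorℕ (ℚ′.fromℚᵘ (mkℚᵘ (+ p) M)))
odd-denominator p M odd = odd-factor (ℚ.denominatorℕ x) ℤ.∣ g ∣ (subst Odd (sym eq) odd)
  where
  x = ℚ′.fromℚᵘ (mkℚᵘ (+ p) M)
  g = ℤGCD.gcd (+ p) (+ suc M)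
  eq : ℚ.denominatorℕ x ℕ.* ℤ.∣ g ∣ ≡ suc M
  eq = trans (sym (ℤₚ.abs-* (ℚ′.↧ x) g)) (cong ℤ.∣_∣ (ℚₚ.↧-/ (+ p) (suc M)))

odd-between : ∀ u w → 0ℚ ℚ′.≤ u → u ℚ′.< w → Σ ℚ λ z → u ℚ′.< z × z ℚ′.< w × Odd (ℚ.denominatorℕ z)
odd-between (mkℚ -[1+ _ ] _ _) _ (ℚ′.*≤* ()) _
odd-between (mkℚ (+ a) b-1 _) (mkℚ -[1+ c ] d-1 _) _ (ℚ′.*<* lt) with subst (ℤ._< _) (sym (ℤₚ.pos-* a (suc d-1))) lt
... | ()
odd-between u@(mkℚ (+ a) b-1 _) w@(mkℚ (+ c) d-1 _) _ (ℚ′.*<* lt)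
  with odd-between-ℕ a b-1 c d-1 (ℤₚ.drop‿+<+ (subst₂ ℤ._<_ (sym (ℤₚ.pos-* a (suc d-1))) (sym (ℤₚ.pos-* c (suc b-1))) lt))
... | p , lo , hi = ℚ′.fromℚᵘ z ,
    ℚₚ.toℚᵘ-cancel-< (ℚᵘₚ.<-respʳ-≃ (ℚᵘₚ.≃-sym (ℚₚ.toℚᵘ-fromℚᵘ z)) (ℚᵘ.*<* (fromℕ a (suc M) p (suc b-1) lo))) ,
    ℚₚ.toℚᵘ-cancel-< (ℚᵘₚ.<-respˡ-≃ (ℚᵘₚ.≃-sym (ℚₚ.toℚᵘ-fromℚᵘ z)) (ℚᵘ.*<* (fromℕ p (suc d-1) c (suc M) hi))) ,
    odd-denominator p M ([m+kn]%n≡m%n 1 (suc b-1 ℕ.* suc d-1) 2)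
  where
  M = (suc b-1 ℕ.* suc d-1) ℕ.* 2
  z = mkℚᵘ (+ p) M
  fromℕ : ∀ m n k l → m ℕ.* n ℕ.< k ℕ.* l → + m ℤ.* + n ℤ.< + k ℤ.* + l
  fromℕ m n k l h = subst₂ ℤ._<_ (ℤₚ.pos-* m n) (ℤₚ.pos-* k l) (ℤ.+<+ h)

-- Clearing denominators in `m/e = 1/2 + n/d` gives `d e = 2 (m d - n e)`, a product of odd numbers
-- that is even.
half-apart : ∀ x y → Odd (ℚ.denominatorℕ x) → Odd (ℚ.denominatorℕ y) → y ≢ ½ ℚ′.+ x
half-apart x@(mkℚ n d-1 _) y@(mkℚ m e-1 _) ox oy eq
  with ℚᵘₚ.≃-trans (ℚₚ.toℚᵘ-cong eq) (ℚₚ.toℚᵘ-homo-+ ½ x)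
... | ℚᵘ.*≡* h = odd-product (suc d-1) (suc e-1) ℤ.∣ k ∣ ox oy
        (trans (sym (ℤₚ.abs-* d e)) (trans (cong ℤ.∣_∣ key) (ℤₚ.abs-* (+ 2) k)))
  where
  d = + suc d-1
  e = + suc e-1
  k = m ℤ.* d ℤ.- n ℤ.* e
  ring : ∀ m d n e → + 2 ℤ.* (m ℤ.* d ℤ.- n ℤ.* e) ≡ m ℤ.* (+ 2 ℤ.* d) ℤ.- n ℤ.* + 2 ℤ.* e
  ring = ℤ-Solver.solve-∀
  ring' : ∀ d n e → (+ 1 ℤ.* d ℤ.+ n ℤ.* + 2) ℤ.* e ℤ.- n ℤ.* + 2 ℤ.* e ≡ d ℤ.* e
  ring' = ℤ-Solver.solve-∀
  key : d ℤ.* e ≡ + 2 ℤ.* k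
  key = sym (trans (ring m d n e) (trans (cong (ℤ._- n ℤ.* + 2 ℤ.* e) h) (ring' d n e)))

module _ where
  open ℚ′ using (_+_; _-_; _<_)

  sub-add : ∀ p q → (p - q) + q ≡ p
  sub-add p q = trans (ℚₚ.+-assoc p (ℚ′.- q) q) (trans (cong (λ t → p + t) (ℚₚ.+-inverseˡ q)) (ℚₚ.+-identityʳ p))

  add-sub : ∀ p q → (p + q) - q ≡ p
  add-sub p q = trans (ℚₚ.+-assoc p q (ℚ′.- q)) (trans (cong (λ t → p + t) (ℚₚ.+-inverseʳ q)) (ℚₚ.+-identityʳ p))

  from-sub-< : ∀ {p q r} → p - q < r → p < r + q
  from-sub-< {p} {q} {r} h = subst (_< r + q) (sub-add p q) (ℚₚ.+-monoˡ-< q h)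

  to-sub-< : ∀ {p q r} → p < r + q → p - q < r
  to-sub-< {p} {q} {r} h = subst (p - q <_) (add-sub r q) (ℚₚ.+-monoˡ-< (ℚ′.- q) h)

  from-<-sub : ∀ {p q r} → r < p - q → r + q < p
  from-<-sub {p} {q} {r} h = subst (r + q <_) (sub-add p q) (ℚₚ.+-monoˡ-< q h)

  to-<-sub : ∀ {p q r} → r + q < p → r < p - q
  to-<-sub {p} {q} {r} h = subst (_< p - q) (add-sub r q) (ℚₚ.+-monoˡ-< (ℚ′.- q) h)

-- S(2) as a circular tournament

module S2Circular where
  open ℚ′ using (_+_; _-_; _<_; _≤_)

  S2-≡ : ∀ {x y : S2Point} → proj₁ x ≡ proj₁ y → x ≡ y
  S2-≡ {q , a , b , c} {.q , a' , b' , c'} refl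
    rewrite ℚₚ.≤-irrelevant a a' | ℚₚ.<-irrelevant b b' | uip c c' = refl

  o : S2Point
  o = 0ℚ , ℚₚ.≤-refl , ℚ′.*<* (ℤ.+<+ (s≤s z≤n)) , refl

  open Colours S2 o

  0<½ : 0ℚ < ½
  0<½ = ℚ′.*<* (ℤ.+<+ (s≤s z≤n))

  S2-oriented : IsOriented S2
  S2-oriented (inj₁ (a , b)) (inj₁ (c , d)) = ℚₚ.<-asym a c
  S2-oriented (inj₁ (a , b)) (inj₂ (c , d)) = ℚₚ.<-asym b d
  S2-oriented (inj₂ (a , b)) (inj₁ (c , d)) = ℚₚ.<-asym b d
  S2-oriented (inj₂ (a , b)) (inj₂ (c , d)) = ℚₚ.<-asym a c

  S2-total : ∀ x y → x ≢ y → S2Arc x y ⊎ S2Arc y x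
  S2-total x@(q , _ , _ , oq) y@(r , _ , _ , or) ne with ℚₚ.<-cmp q r
  ... | tri≈ _ eq _ = ⊥-elim (ne (S2-≡ eq))
  ... | tri< lt _ _ with ℚₚ.<-cmp (r - q) ½
  ...   | tri< h _ _ = inj₁ (inj₁ (lt , h))
  ...   | tri> _ _ h = inj₂ (inj₂ (lt , h))
  ...   | tri≈ _ eq _ = ⊥-elim (half-apart q r oq or (trans (sym (sub-add r q)) (cong (_+ q) eq)))
  S2-total x@(q , _ , _ , oq) y@(r , _ , _ , or) ne | tri> _ _ lt with ℚₚ.<-cmp (q - r) ½
  ...   | tri< h _ _ = inj₂ (inj₁ (lt , h))
  ...   | tri> _ _ h = inj₁ (inj₂ (lt , h))
  ...   | tri≈ _ eq _ = ⊥-elim (half-apart r q or oq (trans (sym (sub-add q r)) (cong (_+ r) eq)))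

  -- The position of a point after rotating the half circle of points x → o by π.
  key : Bool → ℚ → ℚ
  key true q = q
  key false q = q - ½

  Half : Bool → ℚ → Set
  Half true q = 0ℚ < q × q < ½
  Half false q = ½ < q × q < 1ℚ

  private
    minus-0 : ∀ q → q - 0ℚ ≡ q
    minus-0 q = ℚₚ.+-identityʳ q

  half⁻ : ∀ b (x : S2Point) → DArc b o x → Half b (proj₁ x)
  half⁻ true (q , 0≤q , q<1 , _) (inj₁ (a , b)) = a , subst (_< ½) (minus-0 q) b
  half⁻ true (q , 0≤q , q<1 , _) (inj₂ (a , b)) = ⊥-elim (ℚₚ.<-irrefl refl (ℚₚ.<-≤-trans a 0≤q))
  half⁻ false (q , 0≤q , q<1 , _) (inj₁ (a , b)) = ⊥-elim (ℚₚ.<-irrefl refl (ℚₚ.<-≤-trans a 0≤q))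
  half⁻ false (q , 0≤q , q<1 , _) (inj₂ (a , b)) = subst (½ <_) (minus-0 q) b , q<1

  half⁺ : ∀ b (x : S2Point) → Half b (proj₁ x) → DArc b o x
  half⁺ true (q , _) (a , b) = inj₁ (a , subst (_< ½) (sym (minus-0 q)) b)
  half⁺ false (q , _) (a , b) = inj₂ (ℚₚ.<-trans 0<½ a , subst (½ <_) (sym (minus-0 q)) a)

  key-arc : ∀ b c (x y : S2Point) → Half b (proj₁ x) → Half c (proj₁ y) →
    key b (proj₁ x) < key c (proj₁ y) → DArc (agree b c) x y
  key-arc true true (q , _) (r , _) (0<q , q<½) (0<r , r<½) lt =
    inj₁ (lt , to-sub-< (ℚₚ.<-trans r<½ (subst (_< ½ + q) (ℚₚ.+-identityʳ ½) (ℚₚ.+-monoʳ-< ½ 0<q))))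
  key-arc false false (q , _) (r , _) (½<q , q<1) (½<r , r<1) lt =
    inj₁ (subst (q <_) (sub-add r ½) (from-sub-< lt) , to-sub-< (ℚₚ.<-trans r<1 (ℚₚ.+-monoʳ-< ½ ½<q)))
  key-arc true false (q , _) (r , _) (0<q , q<½) (½<r , r<1) lt =
    inj₂ (ℚₚ.<-trans q<½ ½<r , to-<-sub (subst (_< r) (ℚₚ.+-comm q ½) (from-<-sub lt)))
  key-arc false true (q , _) (r , _) (½<q , q<1) (0<r , r<½) lt =
    inj₁ (ℚₚ.<-trans r<½ ½<q , to-sub-< (subst (q <_) (ℚₚ.+-comm r ½) (from-sub-< lt)))

  -- Follows from `key-arc` by trichotomy: equal keys with different colours would belong to
  -- antipodal points.
  key-total : ∀ b c (x y : S2Point) → Half b (proj₁ x) → Half c (proj₁ y) → DArc (agree b c) x y →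
    key b (proj₁ x) < key c (proj₁ y)
  key-total b c x y hx hy a with ℚₚ.<-cmp (key b (proj₁ x)) (key c (proj₁ y))
  ... | tri< lt _ _ = lt
  ... | tri> _ _ gt = ⊥-elim (clash b c a (key-arc c b y x hy hx gt))
    where
    clash : ∀ b c → DArc (agree b c) x y → ¬ DArc (agree c b) y x
    clash true true = S2-oriented {x} {y}
    clash true false = S2-oriented {y} {x}
    clash false true = S2-oriented {y} {x}
    clash false false = S2-oriented {x} {y}
  ... | tri≈ _ eq _ = ⊥-elim (clash b c hx hy a eq)
    where
    irr : ∀ {x y} → proj₁ x ≡ proj₁ y → ¬ S2Arc x y
    irr refl (inj₁ (l , _)) = ℚₚ.<-irrefl refl l
    irr refl (inj₂ (l , _)) = ℚₚ.<-irrefl refl l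
    shifted : ∀ {q r} → q ≡ r - ½ → r ≡ ½ + q
    shifted {q} {r} e = trans (sym (sub-add r ½)) (trans (cong (_+ ½) (sym e)) (ℚₚ.+-comm q ½))
    clash : ∀ b c → Half b (proj₁ x) → Half c (proj₁ y) → DArc (agree b c) x y → key b (proj₁ x) ≢ key c (proj₁ y)
    clash true true _ _ a e = irr {x} {y} e a
    clash false false _ _ a e = irr {x} {y} (trans (sym (sub-add (proj₁ x) ½)) (trans (cong (_+ ½) e) (sub-add (proj₁ y) ½))) a
    clash true false _ _ _ e = half-apart (proj₁ x) (proj₁ y) (odd x) (odd y) (shifted e)
      where
      odd : ∀ (x : S2Point) → Odd (ℚ.denominatorℕ (proj₁ x))
      odd (_ , _ , _ , o) = o
    clash false true _ _ _ e = half-apart (proj₁ y) (proj₁ x) (odd y) (odd x) (shifted (sym e))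
      where
      odd : ∀ (x : S2Point) → Odd (ℚ.denominatorℕ (proj₁ x))
      odd (_ , _ , _ , o) = o

  key-bounds : ∀ b {q} → Half b q → 0ℚ < key b q × key b q < ½
  key-bounds true h = h
  key-bounds false {q} (½<q , q<1) = to-<-sub {q} {½} {0ℚ} (subst (_< q) (sym (ℚₚ.+-identityˡ ½)) ½<q) , to-sub-< {q} {½} {½} q<1

  -- Oddness concerns the point and not its key, so for the colour `false` the point is sought in
  -- the interval shifted by ½.
  dense : ∀ k l → 0ℚ ≤ k → k < l → l ≤ ½ → ∀ c → Σ S2Point λ z → Half c (proj₁ z) × k < key c (proj₁ z) × key c (proj₁ z) < l
  dense k l 0≤k k<l l≤½ true with odd-between k l 0≤k k<l
  ... | z , k<z , z<l , odd = (z , ℚₚ.<⇒≤ 0<z , ℚₚ.<-trans z<½ (ℚ′.*<* (ℤ.+<+ (s≤s (s≤s z≤n)))) , odd) ,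
        (0<z , z<½) , k<z , z<l
    where
    0<z = ℚₚ.≤-<-trans 0≤k k<z
    z<½ = ℚₚ.<-≤-trans z<l l≤½
  dense k l 0≤k k<l l≤½ false with odd-between (k + ½) (l + ½) (ℚₚ.<⇒≤ (ℚₚ.<-≤-trans 0<½ ½≤k+½)) (ℚₚ.+-monoˡ-< ½ k<l)
    where
    ½≤k+½ : ½ ≤ k + ½
    ½≤k+½ = subst (_≤ k + ½) (ℚₚ.+-identityˡ ½) (ℚₚ.+-monoˡ-≤ ½ 0≤k)
  ... | z , k<z , z<l , odd = (z , ℚₚ.<⇒≤ (ℚₚ.<-trans 0<½ ½<z) , z<1 , odd) , (½<z , z<1) , to-<-sub k<z , to-sub-< z<l
    where
    ½<z : ½ < z
    ½<z = ℚₚ.≤-<-trans (subst (_≤ k + ½) (ℚₚ.+-identityˡ ½) (ℚₚ.+-monoˡ-≤ ½ 0≤k)) k<z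
    z<1 : z < 1ℚ
    z<1 = ℚₚ.<-≤-trans z<l (ℚₚ.+-monoˡ-≤ ½ l≤½)

  ⊰-key : ∀ {x y} (r : x ⊰ y) → key (_⊰_.bx r) (proj₁ x) < key (_⊰_.by r) (proj₁ y)
  ⊰-key {x} {y} (mk⊰ b c cx cy a) = key-total b c x y (half⁻ b x cx) (half⁻ c y cy) a

  key-⊰ : ∀ {x y} b c → Half b (proj₁ x) → Half c (proj₁ y) → key b (proj₁ x) < key c (proj₁ y) → x ⊰ y
  key-⊰ {x} {y} b c hx hy lt = mk⊰ b c (half⁺ b x hx) (half⁺ c y hy) (key-arc b c x y hx hy lt)

  half-excl : ∀ b c {q} → Half b q → Half c q → b ≡ c
  half-excl true true _ _ = refl
  half-excl false false _ _ = refl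
  half-excl true false (_ , a) (b , _) = ⊥-elim (ℚₚ.<-asym a b)
  half-excl false true (b , _) (_ , a) = ⊥-elim (ℚₚ.<-asym a b)

  S2-trans : ∀ {x y z} → x ⊰ y → y ⊰ z → x ⊰ z
  S2-trans {x} {y} {z} p@(mk⊰ b c cx cy a) q@(mk⊰ c' d cy' cz a')
    with half-excl c c' (half⁻ c y cy) (half⁻ c' y cy')
  ... | refl = key-⊰ b d (half⁻ b x cx) (half⁻ d z cz) (ℚₚ.<-trans (⊰-key p) (⊰-key q))

  S2-half : ∀ {x} → x ≢ o → Σ Bool λ b → Half b (proj₁ x)
  S2-half {x} ne = [ (λ e → true , half⁻ true x e) , (λ e → false , half⁻ false x e) ]′ (S2-total o x (λ u → ne (sym u)))

  S2-between : ∀ {x y} → x ⊰ y → ∀ c → Σ S2Point λ z → DArc c o z × x ⊰ z × z ⊰ y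
  S2-between {x} {y} r@(mk⊰ b b' cx cy a) c
    with dense (key b (proj₁ x)) (key b' (proj₁ y)) (ℚₚ.<⇒≤ (proj₁ (key-bounds b (half⁻ b x cx)))) (⊰-key r)
           (ℚₚ.<⇒≤ (proj₂ (key-bounds b' (half⁻ b' y cy)))) c
  ... | z , hz , l , u = z , half⁺ c z hz , key-⊰ b c (half⁻ b x cx) hz l , key-⊰ c b' hz (half⁻ b' y cy) u

  S2-over : ∀ {x} → x ≢ o → ∀ c → Σ S2Point λ z → DArc c o z × x ⊰ z
  S2-over {x} ne c with S2-half {x} ne
  ... | b , hx with dense (key b (proj₁ x)) ½ (ℚₚ.<⇒≤ (proj₁ (key-bounds b hx))) (proj₂ (key-bounds b hx)) ℚₚ.≤-refl c
  ...   | z , hz , l , u = z , half⁺ c z hz , key-⊰ b c hx hz l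

  S2-under : ∀ {x} → x ≢ o → ∀ c → Σ S2Point λ z → DArc c o z × z ⊰ x
  S2-under {x} ne c with S2-half {x} ne
  ... | b , hx with dense 0ℚ (key b (proj₁ x)) ℚₚ.≤-refl (proj₁ (key-bounds b hx)) (ℚₚ.<⇒≤ (proj₂ (key-bounds b hx))) c
  ...   | z , hz , l , u = z , half⁺ c z hz , key-⊰ c b hz hx u

  S2-inhabited : ∀ c → Σ S2Point λ z → DArc c o z
  S2-inhabited c with dense 0ℚ ½ ℚₚ.≤-refl 0<½ ℚₚ.≤-refl c
  ... | z , hz , _ = z , half⁺ c z hz

  abstract
    S2-circular : Circular S2
    S2-circular = record
      { tour = (λ {x} {y} → S2-oriented {x} {y}) , S2-total ; o = o
      ; ⊰-trans = S2-trans ; between = S2-between ; over = S2-over ; under = S2-under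
      ; inhabited = S2-inhabited }

  private
    unary : ℕ → Bin
    unary zero = leaf
    unary (suc n) = node leaf (unary n)

    unary-inj : ∀ m n → unary m ≡ unary n → m ≡ n
    unary-inj zero zero _ = refl
    unary-inj (suc m) (suc n) e = cong suc (unary-inj m n (cong (λ { (node _ t) → t ; leaf → leaf }) e))

    -- Coordinates are non-negative, so the absolute value of the numerator loses nothing; the pair
    -- becomes a tree in order to reuse the coding of `Bin`.
    tree : S2Point → Bin
    tree (mkℚ n d _ , _) = node (unary ℤ.∣ n ∣) (unary d)

    numerator-inj : ∀ p q → 0ℚ ≤ p → 0ℚ ≤ q → ℤ.∣ ℚ′.↥ p ∣ ≡ ℤ.∣ ℚ′.↥ q ∣ → ℚ′.↥ p ≡ ℚ′.↥ q
    numerator-inj (mkℚ -[1+ _ ] _ _) _ (ℚ′.*≤* ()) _ _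
    numerator-inj (mkℚ (+ _) _ _) (mkℚ -[1+ _ ] _ _) _ (ℚ′.*≤* ()) _
    numerator-inj (mkℚ (+ _) _ _) (mkℚ (+ _) _ _) _ _ e = cong +_ e

    tree-inj : ∀ x y → tree x ≡ tree y → x ≡ y
    tree-inj (x@(mkℚ n d _) , p , _) (y@(mkℚ m e _) , q , _) eq
      with numerator-inj x y p q (unary-inj ℤ.∣ n ∣ ℤ.∣ m ∣ (cong (λ { (node t _) → t ; leaf → leaf }) eq))
         | unary-inj d e (cong (λ { (node _ t) → t ; leaf → leaf }) eq)
    ... | refl | refl = S2-≡ refl

  abstract
    S2-countable : Countable S2Point
    S2-countable = (λ x → proj₁ Bin-countable (tree x)) , λ x y e → tree-inj x y (proj₂ Bin-countable (tree x) (tree y) e)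

-- The non-transitive case

module NonTransitive (em : EM) (Γ : Digraph) (or : IsOriented Γ) (cΓ : Countable (V Γ))
  (hh : HomHomogeneous Γ) (wc : WeaklyConnected Γ) (¬tr : ¬ Transitive Γ)
  (T : Digraph) (T-tournament : IsTournament T) (T-countable : Countable (V T)) (T-hh : HomHomogeneous T)
  (T-cycle : Σ (V T) λ a → Σ (V T) λ b → Σ (V T) λ c → Cyc T a b c)
  (π : V Γ → V T) (π-surjective : Surjective π) (π-arcs : ∀ x y → E Γ x y ⇔ E T (π x) (π y))
  (π-apart : ∀ {x y} → π x ≡ π y → Apart Γ x y) where
  open Quotient em Γ or cΓ hh wc ¬tr using (someCycle; twin-out; apart-trans)
  open Extend em Γ or hh
  open NonAdjacent em Γ or hh

  private
    opT-tournament : IsTournament (op T)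
    opT-tournament = proj₁ T-tournament , λ x y ne → proj₂ T-tournament y x (λ u → ne (sym u))

    module HT = HomTournament em T T-tournament T-hh
    module HTᵒ = HomTournament em (op T) opT-tournament (op-hh T T-hh)

    universal-case : Extension T → Classification Γ
    universal-case ext = case9 T (extension⇒universal em T-tournament T-countable ext)
      (V Γ) cΓ π π-surjective record
      { to = id ; from = id ; from-to = λ _ → refl ; to-from = λ _ → refl ; arcs = π-arcs }

    outNeighbour : ∀ x → Σ (V Γ) λ y → E Γ x y
    outNeighbour x with someCycle
    ... | a , b , c , ab , _ with extend {L = (a , x) ∷ []} ([] ∷ [])
    ...   | g , hom , refl ∷ [] = g b , hom ab

    apartPair : ∀ {x x' y y'} → Apart Γ x x' → x ≢ x' → HomPair Γ (x , y) (x' , y')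
    apartPair (n , n') d = apart n n' d

  module NoCodominated (noCod : ∀ {p a b c} → E Γ a p → E Γ b p → E Γ c p → ¬ Cyc Γ a b c) where

    -- Three distinct twins could be mapped to a 3-cycle.
    twins≤2 : ∀ {x y z} → Apart Γ x y → Apart Γ y z → x ≡ y ⊎ y ≡ z ⊎ x ≡ z
    twins≤2 {x} {y} {z} xy yz = dne em λ bad → contra (λ u → bad (inj₁ u)) (λ u → bad (inj₂ (inj₁ u))) λ u → bad (inj₂ (inj₂ u))
      where
      contra : x ≢ y → y ≢ z → x ≢ z → ⊥
      contra x≢y y≢z x≢z with someCycle | outNeighbour x
      ... | a , b , c , cyc | w , xw
        with extend {L = (x , a) ∷ (y , b) ∷ (z , c) ∷ []}
               ((apartPair xy x≢y ∷ apartPair (apart-trans xy yz) x≢z ∷ []) ∷ (apartPair yz y≢z ∷ []) ∷ [] ∷ [])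
      ...   | g , hom , refl ∷ refl ∷ refl ∷ [] =
                noCod (hom xw) (hom (twin-out xy xw)) (hom (twin-out (apart-trans xy yz) xw)) cyc

  module NoTriple (noTriple : ∀ {x y z} → E Γ x y → E Γ y z → ¬ E Γ x z) where
    private
      -- Distinct twins have a common out-neighbour and can be mapped onto an arc, which would
      -- produce a transitive triple.
      twins-≡ : ∀ {x y} → Apart Γ x y → x ≡ y
      twins-≡ {x} {y} xy = dne em contra
        where
        contra : x ≢ y → ⊥
        contra x≢y with someCycle | outNeighbour x
        ... | a , b , _ , ab , _ | w , xw
          with extend {L = (x , a) ∷ (y , b) ∷ []} ((apartPair xy x≢y ∷ []) ∷ [] ∷ [])
        ...   | g , hom , refl ∷ refl ∷ [] = noTriple ab (hom (twin-out xy xw)) (hom xw)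

      a = proj₁ someCycle
      b = proj₁ (proj₂ someCycle)
      c = proj₁ (proj₂ (proj₂ someCycle))

      ab : E Γ a b
      ab = proj₁ (proj₂ (proj₂ (proj₂ someCycle)))
      bc : E Γ b c
      bc = proj₁ (proj₂ (proj₂ (proj₂ (proj₂ someCycle))))
      ca : E Γ c a
      ca = proj₂ (proj₂ (proj₂ (proj₂ (proj₂ someCycle))))

      abstract
        -- For a fourth vertex `e`, two of the three arcs joining it to the cycle have the same
        -- direction at `e`; with the arc between their other ends they form a transitive triple.
        cover : ∀ e → e ≡ a ⊎ e ≡ b ⊎ e ≡ c
        cover e = dne em λ bad → contra (adj (λ u → bad (inj₁ u))) (adj (λ u → bad (inj₂ (inj₁ u)))) (adj (λ u → bad (inj₂ (inj₂ u))))
          where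
          adj : ∀ {x} → e ≢ x → E Γ e x ⊎ E Γ x e
          adj ne = adjacent (λ ap → ne (twins-≡ ap))
          contra : E Γ e a ⊎ E Γ a e → E Γ e b ⊎ E Γ b e → E Γ e c ⊎ E Γ c e → ⊥
          contra (inj₁ ea) (inj₁ eb) _ = noTriple ea ab eb
          contra (inj₂ ae) (inj₂ be) _ = noTriple ab be ae
          contra _ (inj₁ eb) (inj₁ ec) = noTriple eb bc ec
          contra _ (inj₂ be) (inj₂ ce) = noTriple bc ce be
          contra (inj₁ ea) _ (inj₁ ec) = noTriple ec ca ea
          contra (inj₂ ae) _ (inj₂ ce) = noTriple ca ae ce

      vertex : Fin 3 → V Γ
      vertex zero = a
      vertex (suc zero) = b
      vertex (suc (suc zero)) = c

      index : ∀ e → Σ (Fin 3) λ i → vertex i ≡ e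
      index e = [ (λ u → zero , sym u) , [ (λ u → suc zero , sym u) , (λ u → suc (suc zero) , sym u) ]′ ]′ (cover e)

      vertex-inj : ∀ i j → vertex i ≡ vertex j → i ≡ j
      vertex-inj zero zero _ = refl
      vertex-inj (suc zero) (suc zero) _ = refl
      vertex-inj (suc (suc zero)) (suc (suc zero)) _ = refl
      vertex-inj zero (suc zero) u = ⊥-elim (asym≢ ab u)
      vertex-inj zero (suc (suc zero)) u = ⊥-elim (asym≢ ca (sym u))
      vertex-inj (suc zero) zero u = ⊥-elim (asym≢ ab (sym u))
      vertex-inj (suc zero) (suc (suc zero)) u = ⊥-elim (asym≢ bc u)
      vertex-inj (suc (suc zero)) zero u = ⊥-elim (asym≢ ca u)
      vertex-inj (suc (suc zero)) (suc zero) u = ⊥-elim (asym≢ bc (sym u))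

      vertex-arcs : ∀ i j → E Γ (vertex i) (vertex j) ⇔ C3Arc i j
      vertex-arcs zero zero = (λ e → ⊥-elim (or e e)) , λ ()
      vertex-arcs zero (suc zero) = (λ _ → a01) , λ _ → ab
      vertex-arcs zero (suc (suc zero)) = (λ e → ⊥-elim (or e ca)) , λ ()
      vertex-arcs (suc zero) zero = (λ e → ⊥-elim (or e ab)) , λ ()
      vertex-arcs (suc zero) (suc zero) = (λ e → ⊥-elim (or e e)) , λ ()
      vertex-arcs (suc zero) (suc (suc zero)) = (λ _ → a12) , λ _ → bc
      vertex-arcs (suc (suc zero)) zero = (λ _ → a20) , λ _ → ca
      vertex-arcs (suc (suc zero)) (suc zero) = (λ e → ⊥-elim (or e bc)) , λ ()
      vertex-arcs (suc (suc zero)) (suc (suc zero)) = (λ e → ⊥-elim (or e e)) , λ ()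

    cycle : Γ ≅ C₃
    cycle = record
      { to = λ x → proj₁ (index x) ; from = vertex ; from-to = λ x → proj₂ (index x)
      ; to-from = λ i → vertex-inj _ _ (proj₂ (index (vertex i)))
      ; arcs = λ x y → subst₂ (λ u v → E Γ u v ⇔ C3Arc (proj₁ (index x)) (proj₁ (index y)))
                 (proj₂ (index x)) (proj₂ (index y)) (vertex-arcs _ _) }

  module Circle (noCodT : ∀ {p a b c} → E T a p → E T b p → E T c p → ¬ Cyc T a b c) where

    private
      noCodΓ : ∀ {p a b c} → E Γ a p → E Γ b p → E Γ c p → ¬ Cyc Γ a b c
      noCodΓ ap bp cp (ab , bc , ca) = noCodT (proj₁ (π-arcs _ _) ap) (proj₁ (π-arcs _ _) bp) (proj₁ (π-arcs _ _) cp)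
        (proj₁ (π-arcs _ _) ab , proj₁ (π-arcs _ _) bc , proj₁ (π-arcs _ _) ca)

    circular-case : T ≅ S2 → Classification Γ
    circular-case φ = case8 (V Γ) cΓ (to φ ∘ π) surjective kernel record
      { to = id ; from = id ; from-to = λ _ → refl ; to-from = λ _ → refl
      ; arcs = λ x y → (λ e → proj₁ (arcs φ _ _) (proj₁ (π-arcs x y) e)) , λ e → proj₂ (π-arcs x y) (proj₂ (arcs φ _ _) e) }
      where
      surjective : Surjective (to φ ∘ π)
      surjective p with π-surjective (from φ p)
      ... | v , eq = v , trans (cong (to φ) eq) (to-from φ p)
      twins : ∀ x y → to φ (π x) ≡ to φ (π y) → Apart Γ x y
      twins x y eq = π-apart (trans (sym (from-to φ (π x))) (trans (cong (from φ) eq) (from-to φ (π y))))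
      kernel : KernelClassesAtMost2 (to φ ∘ π)
      kernel x y z e e' = NoCodominated.twins≤2 noCodΓ (twins x y e) (twins y z e')

  classify : Classification Γ
  classify = decide (em HT.HasDom) (em HTᵒ.HasDom) (em (Σ (V T) λ x → Σ (V T) λ y → Σ (V T) λ z → E T x y × E T y z × E T x z))
    where
    decide : Dec HT.HasDom → Dec HTᵒ.HasDom →
      Dec (Σ (V T) λ x → Σ (V T) λ y → Σ (V T) λ z → E T x y × E T y z × E T x z) → Classification Γ
    decide (yes d) _ _ = universal-case (dom⇒extension em T T-tournament T-hh d)
    decide (no _) (yes d) _ = universal-case (extension-op em {T} (dom⇒extension em (op T) opT-tournament (op-hh T T-hh) d))
    decide (no _) (no _) (no none) = case7 (NoTriple.cycle λ {x} {y} {z} xy yz xz →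
      none (π x , π y , π z , proj₁ (π-arcs x y) xy , proj₁ (π-arcs y z) yz , proj₁ (π-arcs x z) xz))
    decide (no ¬d) (no ¬c) (yes (x , y , z , xy , yz , xz)) = Circle.circular-case noCodT
      (circular-unique em T-countable S2Circular.S2-countable
        (LocallyTransitive.circular em T T-tournament T-hh noDomT noCodT T-cycle {x} {y} {z} xy yz xz) S2Circular.S2-circular)
      where
      noDomT : ∀ {p a b c} → E T p a → E T p b → E T p c → ¬ Cyc T a b c
      noDomT {p} {a} {b} {c} pa pb pc (ab , bc , ca) = ¬d (p , a , b , c , HT.dom pa pb pc ab bc ca)
      noCodT : ∀ {p a b c} → E T a p → E T b p → E T c p → ¬ Cyc T a b c
      noCodT {p} {a} {b} {c} ap bp cp (ab , bc , ca) = ¬c (p , a , c , b , HTᵒ.dom ap cp bp ca bc ab)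

classify-nonTransitive : (em : EM) (Γ : Digraph) → IsOriented Γ → Countable (V Γ) →
  HomHomogeneous Γ → WeaklyConnected Γ → ¬ Transitive Γ → Classification Γ
classify-nonTransitive em Γ or cΓ hh wc ¬tr = NonTransitive.classify em Γ or cΓ hh wc ¬tr
  Q.T Q.T-tournament Q.T-countable Q.T-hh Q.T-cycle Q.π Q.π-surjective Q.π-arcs Q.π-apart
  where module Q = Quotient em Γ or cΓ hh wc ¬tr

theorem2p26 : ExcludedMiddle (lsuc 0ℓ) →
    (Γ : Digraph) → NonEmpty Γ → IsOriented Γ → Countable (V Γ) →
    HomHomogeneous Γ → WeaklyConnected Γ → Classification Γ
theorem2p26 em₁ Γ ne or cΓ hh wc = decide (em (Transitive Γ))
  where
  em : EM
  em P = Decₚ.map′ lower lift (em₁ {Lift (lsuc 0ℓ) P})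
  decide : Dec (Transitive Γ) → Classification Γ
  decide (yes tr) = Posets.classify em Γ ne or cΓ hh wc tr
  decide (no ¬tr) = classify-nonTransitive em Γ or cΓ hh wc ¬tr
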